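{- There exist absolute constants $c>0$ and $C>0$ such that the following holds. Let $G=C(X,S)$ be a non-bipartite Cayley graph of a finite group $X$ with respect to a symmetric subset $S\subseteq X$, let $d=|S|$ be its degree, let $N=|X|$, and let $t_1\le t_2\le\cdots\le t_N=1$ be the eigenvalues, counted with multiplicity, of the normalized adjacency matrix of $G$. Then for every $i\in\{1,\dots,N-1\}$, $$t_i\in\left[-1+\frac{c\,h_{out}^2}{d},\;1-\frac{C\,h_{out}^2}{d}\right],$$ where $h_{out}$ is the outer vertex isoperimetric constant of $G$.
   Context: A subset $S$ of a group $X$ is symmetric if $x^{ -1}\in S$ for every $x\in S$. The Cayley graph $C(X,S)$ is the undirected graph with vertex set $X$ in which $x$ and $y$ are adjacent (written $x\sim y$) if and only if $xy^{ -1}\in S$. Self-loops are allowed (they occur at every vertex exactly when the identity lies in $S$); a self-loop counts once in the degree, so the graph is $d$-regular with $d=|S|$; a graph with a self-loop is not bipartite. The normalized adjacency matrix is $D^{ -1}A=\frac1d A$, where $A_{xy}=1$ if $x\sim y$ and $0$ otherwise (including $A_{xx}=1$ if there is a self-loop at $x$), and $D$ is the diagonal matrix of vertex degrees. For a subset $V_1$ of the vertex set $V$, the outer vertex boundary is $\partial_{out}(V_1)=\{y\in V\setminus V_1 : \exists\, x\in V_1,\ x\sim y\}$, and the outer vertex isoperimetric constant is $$h_{out}=\min_{\emptyset\ne V_1\subseteq V,\ |V_1|\le |V|/2}\frac{|\partial_{out}(V_1)|}{|V_1|}$$ (it is assumed that $|V|\ge 2$ so that this is defined). -}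

module Defs where

open import Algebra.Bundles using (Group; CommutativeRing)
import Algebra.Properties.CommutativeMonoid.Sum as CommutativeMonoidSum
import Algebra.Properties.AbelianGroup as AbelianGroupProperties
import Algebra.Properties.CommutativeSemigroup as CommutativeSemigroupProperties
import Algebra.Properties.Group as GroupProperties
import Algebra.Properties.Ring as RingProperties
open import Data.Bool.Base using (Bool; true; false; if_then_else_)
open import Data.Fin.Base as Fin using (Fin; toℕ; punchIn)
import Data.Fin.Properties as Fin
open import Data.Fin.Subset
  using (Subset; inside; outside; Nonempty; ∣_∣; ⁅_⁆)
  renaming (_∈_ to _∈ₛ_; _∉_ to _∉ₛ_)
open import Data.Fin.Subset.Properties
  using (nonempty?; x∈p⇒∣p-x∣<∣p∣; ∣⁅x⁆∣≡1; x∈⁅x⁆)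
  renaming (_∈?_ to _∈ₛ?_)
open import Data.Integer.Base as ℤ using (+_)
open import Data.Nat.Base as ℕ using (ℕ; zero; suc)
import Data.Nat.Properties as ℕ
open import Data.Product.Base using (Σ; ∃; ∃-syntax; _×_; _,_; proj₁; proj₂)
open import Data.Rational.Base as ℚ using (ℚ; 0ℚ; 1ℚ; ½)
import Data.Rational.Properties as ℚ
open import Data.Sum.Base using (_⊎_; inj₁; inj₂)
open import Data.Vec.Base as Vec using ([]; _∷_)
open import Data.Vec.Functional using (Vector)
open import Function.Base using (_∘_; const)
open import Function.Bundles using (Inverse)
open import Level using (0ℓ)
open import Relation.Binary.PropositionalEquality
  using (_≡_; _≢_; refl; sym; trans; cong; cong₂; subst; setoid)
open import Relation.Nullary.Decidable
  using (Dec; yes; no; ⌊_⌋; ¬?; _×-dec_)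
open import Relation.Nullary.Negation using (¬_; contradiction)
open import Relation.Unary using (Pred; Decidable)

------------------------------------------------------------------------
-- Real numbers
--
-- ℝ consists of the Cauchy sequences of rationals (with a modulus of
-- convergence); two of them are the same real number when they are
-- related by _≃_.  The operations are pointwise.

private
  module ℚG = AbelianGroupProperties ℚ.+-0-abelianGroup
  module ℚR = RingProperties (CommutativeRing.ring ℚ.+-*-commutativeRing)
  module ℚ+ = CommutativeSemigroupProperties
    (CommutativeRing.+-commutativeSemigroup ℚ.+-*-commutativeRing)

  cancel : ∀ p q → p ≡ (p ℚ.- q) ℚ.+ q
  cancel p q = sym (ℚR.//-rightDividesˡ q p)

  telescope : ∀ a b c → a ℚ.- c ≡ (a ℚ.- b) ℚ.+ (b ℚ.- c)
  telescope a b c = trans (cong (ℚ._- c) (cancel a b)) (ℚ.+-assoc (a ℚ.- b) b (ℚ.- c))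

  dist : ℚ → ℚ → ℚ
  dist p q = ℚ.∣ p ℚ.- q ∣

Eventually : Pred ℕ 0ℓ → Set
Eventually P = ∃[ n₀ ] ∀ n → n₀ ℕ.≤ n → P n

record ℝ : Set where
  constructor mkℝ
  field
    seq    : ℕ → ℚ
    cauchy : ∀ ε → 0ℚ ℚ.< ε →
             ∃[ n₀ ] ∀ m n → n₀ ℕ.≤ m → n₀ ℕ.≤ n → ℚ.∣ seq m ℚ.- seq n ∣ ℚ.< ε

open ℝ public

infix 4 _≃_ _≤ᴿ_ _<ᴿ_

_≃_ : ℝ → ℝ → Set
x ≃ y = ∀ ε → 0ℚ ℚ.< ε → Eventually λ n → ℚ.∣ seq x n ℚ.- seq y n ∣ ℚ.< ε

_≤ᴿ_ : ℝ → ℝ → Set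
x ≤ᴿ y = ∀ ε → 0ℚ ℚ.< ε → Eventually λ n → seq x n ℚ.≤ seq y n ℚ.+ ε

_<ᴿ_ : ℝ → ℝ → Set
x <ᴿ y = ∃[ ε ] 0ℚ ℚ.< ε × Eventually λ n → seq x n ℚ.+ ε ℚ.≤ seq y n

private
  ⊔-left : ∀ a b m → a ℕ.⊔ b ℕ.≤ m → a ℕ.≤ m
  ⊔-left a b m = ℕ.≤-trans (ℕ.m≤m⊔n a b)

  ⊔-right : ∀ a b m → a ℕ.⊔ b ℕ.≤ m → b ℕ.≤ m
  ⊔-right a b m = ℕ.≤-trans (ℕ.m≤n⊔m a b)

  ∧-eventually : ∀ {P Q R : Pred ℕ 0ℓ} → (∀ n → P n → Q n → R n) →
                 Eventually P → Eventually Q → Eventually R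
  ∧-eventually f (a , p) (b , q) = a ℕ.⊔ b , λ n le →
    f n (p n (⊔-left a b n le)) (q n (⊔-right a b n le))

  half : ∀ ε → ½ ℚ.* ε ℚ.+ ½ ℚ.* ε ≡ ε
  half ε = trans (sym (ℚ.*-distribʳ-+ ε ½ ½)) (ℚ.*-identityˡ ε)

  half-pos : ∀ {ε} → 0ℚ ℚ.< ε → 0ℚ ℚ.< ½ ℚ.* ε
  half-pos {ε} ε>0 =
    subst (ℚ._< ½ ℚ.* ε) (ℚ.*-zeroʳ ½) (ℚ.*-monoʳ-<-pos ½ ε>0)

  dist-refl : ∀ p → dist p p ≡ 0ℚ
  dist-refl p = cong ℚ.∣_∣ (ℚ.+-inverseʳ p)

  dist-sym : ∀ p q → dist p q ≡ dist q p
  dist-sym p q = trans (cong ℚ.∣_∣ (sym (ℚG.⁻¹-anti-homo‿- q p))) (ℚ.∣-p∣≡∣p∣ (q ℚ.- p))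

  module _ {ε : ℚ} where
    open ℚ.≤-Reasoning

    split : ∀ a b {c} → c ≡ a ℚ.+ b → ℚ.∣ a ∣ ℚ.< ½ ℚ.* ε → ℚ.∣ b ∣ ℚ.< ½ ℚ.* ε →
            ℚ.∣ c ∣ ℚ.< ε
    split a b {c} eq a< b< = begin-strict
      ℚ.∣ c ∣                ≡⟨ cong ℚ.∣_∣ eq ⟩
      ℚ.∣ a ℚ.+ b ∣          ≤⟨ ℚ.∣p+q∣≤∣p∣+∣q∣ a b ⟩
      ℚ.∣ a ∣ ℚ.+ ℚ.∣ b ∣    <⟨ ℚ.+-mono-< a< b< ⟩
      ½ ℚ.* ε ℚ.+ ½ ℚ.* ε    ≡⟨ half ε ⟩
      ε                      ∎

  dist-trans : ∀ {ε} a b c → dist a b ℚ.< ½ ℚ.* ε → dist b c ℚ.< ½ ℚ.* ε →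
               dist a c ℚ.< ε
  dist-trans a b c = split (a ℚ.- b) (b ℚ.- c) (telescope a b c)

  +-dist : ∀ {ε} a b c d → dist a c ℚ.< ½ ℚ.* ε → dist b d ℚ.< ½ ℚ.* ε →
           dist (a ℚ.+ b) (c ℚ.+ d) ℚ.< ε
  +-dist a b c d = split (a ℚ.- c) (b ℚ.- d)
    (trans (cong (a ℚ.+ b ℚ.+_) (ℚ.neg-distrib-+ c d))
           (ℚ+.interchange a b (ℚ.- c) (ℚ.- d)))

  neg-dist : ∀ {ε} a b → dist a b ℚ.< ε → dist (ℚ.- a) (ℚ.- b) ℚ.< ε
  neg-dist {ε} a b = subst (ℚ._< ε) (trans (sym (ℚ.∣-p∣≡∣p∣ (a ℚ.- b)))
    (cong ℚ.∣_∣ (ℚ.neg-distrib-+ a (ℚ.- b))))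

  abstract
    over : ∀ (ε B : ℚ) → 0ℚ ℚ.< B → ℚ
    over ε B B>0 = (ℚ.1/ B) {{ℚ.pos⇒nonZero B {{ℚ.positive B>0}}}} ℚ.* ε

    over-pos : ∀ {ε B} (B>0 : 0ℚ ℚ.< B) → 0ℚ ℚ.< ε → 0ℚ ℚ.< over ε B B>0
    over-pos {ε} {B} B>0 ε>0 = ℚ.positive⁻¹ _
      {{ℚ.pos*pos⇒pos ((ℚ.1/ B) {{ℚ.pos⇒nonZero B {{ℚ.positive B>0}}}})
         {{ℚ.1/pos⇒pos B {{ℚ.positive B>0}}}} ε {{ℚ.positive ε>0}}}}

    scale : ∀ {ε B} (B>0 : 0ℚ ℚ.< B) a b → ℚ.∣ a ∣ ℚ.≤ B →
            ℚ.∣ b ∣ ℚ.< over ε B B>0 → ℚ.∣ a ℚ.* b ∣ ℚ.< ε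
    scale {ε} {B} B>0 a b a≤ b< = begin-strict
      ℚ.∣ a ℚ.* b ∣                    ≡⟨ ℚ.∣p*q∣≡∣p∣*∣q∣ a b ⟩
      ℚ.∣ a ∣ ℚ.* ℚ.∣ b ∣              ≤⟨ ℚ.*-monoʳ-≤-nonNeg ℚ.∣ b ∣ {{ℚ.nonNegative (ℚ.0≤∣p∣ b)}} a≤ ⟩
      B ℚ.* ℚ.∣ b ∣                    <⟨ ℚ.*-monoʳ-<-pos B {{ℚ.positive B>0}} b< ⟩
      B ℚ.* over ε B B>0               ≡⟨ ℚ.*-assoc B _ ε ⟨
      (B ℚ.* (ℚ.1/ B) {{nz}}) ℚ.* ε    ≡⟨ cong (ℚ._* ε) (ℚ.*-inverseʳ B {{nz}}) ⟩
      1ℚ ℚ.* ε                         ≡⟨ ℚ.*-identityˡ ε ⟩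
      ε                                ∎
      where
      open ℚ.≤-Reasoning
      nz : ℚ.NonZero B
      nz = ℚ.pos⇒nonZero B {{ℚ.positive B>0}}

  *-dist : ∀ {ε A D} (A>0 : 0ℚ ℚ.< A) (D>0 : 0ℚ ℚ.< D) a b c d →
           ℚ.∣ a ∣ ℚ.≤ A → ℚ.∣ d ∣ ℚ.≤ D →
           dist a c ℚ.< over (½ ℚ.* ε) D D>0 → dist b d ℚ.< over (½ ℚ.* ε) A A>0 →
           dist (a ℚ.* b) (c ℚ.* d) ℚ.< ε
  *-dist A>0 D>0 a b c d a≤ d≤ ac bd = split (a ℚ.* (b ℚ.- d)) (d ℚ.* (a ℚ.- c))
    (trans (telescope (a ℚ.* b) (a ℚ.* d) (c ℚ.* d))
      (cong₂ ℚ._+_ (sym (ℚR.x[y-z]≈xy-xz a b d))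
        (trans (sym (ℚR.[y-z]x≈yx-zx d a c)) (ℚ.*-comm (a ℚ.- c) d))))
    (scale A>0 a (b ℚ.- d) a≤ bd) (scale D>0 d (a ℚ.- c) d≤ ac)

  0<1 : 0ℚ ℚ.< 1ℚ
  0<1 = ℚ.positive⁻¹ 1ℚ

  bounded : ∀ x → ∃[ B ] 0ℚ ℚ.< B × Eventually λ n → ℚ.∣ seq x n ∣ ℚ.≤ B
  bounded x with cauchy x 1ℚ 0<1
  ... | n₀ , close = 1ℚ ℚ.+ ℚ.∣ seq x n₀ ∣ ,
    ℚ.+-mono-<-≤ 0<1 (ℚ.0≤∣p∣ (seq x n₀)) , n₀ , λ n le → begin
      ℚ.∣ seq x n ∣                                 ≡⟨ cong ℚ.∣_∣ (cancel (seq x n) (seq x n₀)) ⟩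
      ℚ.∣ (seq x n ℚ.- seq x n₀) ℚ.+ seq x n₀ ∣     ≤⟨ ℚ.∣p+q∣≤∣p∣+∣q∣ (seq x n ℚ.- seq x n₀) (seq x n₀) ⟩
      dist (seq x n) (seq x n₀) ℚ.+ ℚ.∣ seq x n₀ ∣  ≤⟨ ℚ.+-monoˡ-≤ ℚ.∣ seq x n₀ ∣ (ℚ.<⇒≤ (close n n₀ le ℕ.≤-refl)) ⟩
      1ℚ ℚ.+ ℚ.∣ seq x n₀ ∣                         ∎
    where
    open ℚ.≤-Reasoning

fromℚ : ℚ → ℝ
fromℚ q = mkℝ (const q) λ ε ε>0 →
  0 , λ _ _ _ _ → subst (ℚ._< ε) (sym (dist-refl q)) ε>0

0ᴿ 1ᴿ : ℝ
0ᴿ = fromℚ 0ℚ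
1ᴿ = fromℚ 1ℚ

infixl 6 _+ᴿ_ _-ᴿ_
infixl 7 _*ᴿ_
infix  8 -ᴿ_

_+ᴿ_ : ℝ → ℝ → ℝ
x +ᴿ y = mkℝ (λ n → seq x n ℚ.+ seq y n) λ ε ε>0 →
  let a , p = cauchy x (½ ℚ.* ε) (half-pos ε>0)
      b , q = cauchy y (½ ℚ.* ε) (half-pos ε>0)
      ≤ˡ = ⊔-left a b
      ≤ʳ = ⊔-right a b
  in a ℕ.⊔ b , λ m n l k →
       +-dist (seq x m) (seq y m) (seq x n) (seq y n)
         (p m n (≤ˡ m l) (≤ˡ n k)) (q m n (≤ʳ m l) (≤ʳ n k))

-ᴿ_ : ℝ → ℝ
-ᴿ x = mkℝ (λ n → ℚ.- seq x n) λ ε ε>0 →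
  let a , p = cauchy x ε ε>0
  in a , λ m n l k → neg-dist (seq x m) (seq x n) (p m n l k)

_-ᴿ_ : ℝ → ℝ → ℝ
x -ᴿ y = x +ᴿ -ᴿ y

private
  *-cauchy : ∀ x y ε → 0ℚ ℚ.< ε → ∃[ n₀ ] ∀ m n → n₀ ℕ.≤ m → n₀ ℕ.≤ n →
             dist (seq x m ℚ.* seq y m) (seq x n ℚ.* seq y n) ℚ.< ε
  *-cauchy x y ε ε>0 = combine (bounded x) (bounded y)
    where
    combine : (∃[ A ] 0ℚ ℚ.< A × Eventually λ n → ℚ.∣ seq x n ∣ ℚ.≤ A) →
              (∃[ D ] 0ℚ ℚ.< D × Eventually λ n → ℚ.∣ seq y n ∣ ℚ.≤ D) →
              ∃[ n₀ ] ∀ m n → n₀ ℕ.≤ m → n₀ ℕ.≤ n →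
              dist (seq x m ℚ.* seq y m) (seq x n ℚ.* seq y n) ℚ.< ε
    combine (A , A>0 , u , x≤) (D , D>0 , v , y≤) = n₀ , λ m n l k →
      *-dist A>0 D>0 (seq x m) (seq y m) (seq x n) (seq y n)
        (x≤ m (⊔-left u v m (l₁ m l))) (y≤ n (⊔-right u v n (l₁ n k)))
        (proj₂ cx m n (⊔-left a b m (l₂ m l)) (⊔-left a b n (l₂ n k)))
        (proj₂ cy m n (⊔-right a b m (l₂ m l)) (⊔-right a b n (l₂ n k)))
      where
      cx = cauchy x (over (½ ℚ.* ε) D D>0) (over-pos D>0 (half-pos ε>0))
      cy = cauchy y (over (½ ℚ.* ε) A A>0) (over-pos A>0 (half-pos ε>0))
      a = proj₁ cx
      b = proj₁ cy
      n₀ = (u ℕ.⊔ v) ℕ.⊔ (a ℕ.⊔ b)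
      l₁ : ∀ m → n₀ ℕ.≤ m → u ℕ.⊔ v ℕ.≤ m
      l₁ = ⊔-left (u ℕ.⊔ v) (a ℕ.⊔ b)
      l₂ : ∀ m → n₀ ℕ.≤ m → a ℕ.⊔ b ℕ.≤ m
      l₂ = ⊔-right (u ℕ.⊔ v) (a ℕ.⊔ b)

_*ᴿ_ : ℝ → ℝ → ℝ
x *ᴿ y = mkℝ (λ n → seq x n ℚ.* seq y n) (*-cauchy x y)

private
  pointwise : ∀ {x y} → (∀ n → seq x n ≡ seq y n) → x ≃ y
  pointwise {x} {y} eq ε ε>0 = 0 , λ n _ → subst (ℚ._< ε)
    (sym (trans (cong (dist (seq x n)) (sym (eq n))) (dist-refl (seq x n)))) ε>0

  ≃-sym : ∀ {x y} → x ≃ y → y ≃ x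
  ≃-sym {x} {y} x≃y ε ε>0 =
    let a , p = x≃y ε ε>0
    in a , λ n l → subst (ℚ._< ε) (dist-sym (seq x n) (seq y n)) (p n l)

  ≃-trans : ∀ {x y z} → x ≃ y → y ≃ z → x ≃ z
  ≃-trans {x} {y} {z} x≃y y≃z ε ε>0 =
    ∧-eventually (λ n → dist-trans (seq x n) (seq y n) (seq z n))
      (x≃y _ (half-pos ε>0)) (y≃z _ (half-pos ε>0))

  +-cong : ∀ {x y u v} → x ≃ y → u ≃ v → x +ᴿ u ≃ y +ᴿ v
  +-cong {x} {y} {u} {v} x≃y u≃v ε ε>0 =
    ∧-eventually (λ n → +-dist (seq x n) (seq u n) (seq y n) (seq v n))
      (x≃y _ (half-pos ε>0)) (u≃v _ (half-pos ε>0))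

  *-cong : ∀ {x y u v} → x ≃ y → u ≃ v → x *ᴿ u ≃ y *ᴿ v
  *-cong {x} {y} {u} {v} x≃y u≃v ε ε>0 =
    let A , A>0 , x≤ = bounded x
        D , D>0 , v≤ = bounded v
    in ∧-eventually
         (λ n (a , d) (p , q) →
            *-dist A>0 D>0 (seq x n) (seq u n) (seq y n) (seq v n) a d p q)
         (∧-eventually (λ n → _,_) x≤ v≤)
         (∧-eventually (λ n → _,_) (x≃y _ (over-pos D>0 (half-pos ε>0)))
                                   (u≃v _ (over-pos A>0 (half-pos ε>0))))

  -‿cong : ∀ {x y} → x ≃ y → -ᴿ x ≃ -ᴿ y
  -‿cong {x} {y} x≃y ε ε>0 =
    let a , p = x≃y ε ε>0
    in a , λ n l → neg-dist (seq x n) (seq y n) (p n l)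

ℝ-commutativeRing : CommutativeRing 0ℓ 0ℓ
ℝ-commutativeRing = record
  { Carrier = ℝ ; _≈_ = _≃_ ; _+_ = _+ᴿ_ ; _*_ = _*ᴿ_ ; -_ = -ᴿ_ ; 0# = 0ᴿ ; 1# = 1ᴿ
  ; isCommutativeRing = record
    { isRing = record
      { +-isAbelianGroup = record
        { isGroup = record
          { isMonoid = record
            { isSemigroup = record
              { isMagma = record
                { isEquivalence = record
                  { refl  = λ {x} → pointwise {x} {x} (λ _ → refl)
                  ; sym   = λ {x} {y} → ≃-sym {x} {y}
                  ; trans = λ {x} {y} {z} → ≃-trans {x} {y} {z}
                  }
                ; ∙-cong = λ {x} {y} {u} {v} → +-cong {x} {y} {u} {v}
                }
              ; assoc = λ x y z → pointwise {(x +ᴿ y) +ᴿ z} {x +ᴿ (y +ᴿ z)}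
                  λ n → ℚ.+-assoc (seq x n) (seq y n) (seq z n)
              }
            ; identity = (λ x → pointwise {0ᴿ +ᴿ x} {x} λ n → ℚ.+-identityˡ (seq x n))
                       , (λ x → pointwise {x +ᴿ 0ᴿ} {x} λ n → ℚ.+-identityʳ (seq x n))
            }
          ; inverse = (λ x → pointwise { -ᴿ x +ᴿ x} {0ᴿ} λ n → ℚ.+-inverseˡ (seq x n))
                    , (λ x → pointwise {x -ᴿ x} {0ᴿ} λ n → ℚ.+-inverseʳ (seq x n))
          ; ⁻¹-cong = λ {x} {y} → -‿cong {x} {y}
          }
        ; comm = λ x y → pointwise {x +ᴿ y} {y +ᴿ x} λ n → ℚ.+-comm (seq x n) (seq y n)
        }
      ; *-cong = λ {x} {y} {u} {v} → *-cong {x} {y} {u} {v}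
      ; *-assoc = λ x y z → pointwise {(x *ᴿ y) *ᴿ z} {x *ᴿ (y *ᴿ z)}
          λ n → ℚ.*-assoc (seq x n) (seq y n) (seq z n)
      ; *-identity = (λ x → pointwise {1ᴿ *ᴿ x} {x} λ n → ℚ.*-identityˡ (seq x n))
                   , (λ x → pointwise {x *ᴿ 1ᴿ} {x} λ n → ℚ.*-identityʳ (seq x n))
      ; distrib = (λ x y z → pointwise {x *ᴿ (y +ᴿ z)} {x *ᴿ y +ᴿ x *ᴿ z}
                     λ n → ℚ.*-distribˡ-+ (seq x n) (seq y n) (seq z n))
                , (λ x y z → pointwise {(y +ᴿ z) *ᴿ x} {y *ᴿ x +ᴿ z *ᴿ x}
                     λ n → ℚ.*-distribʳ-+ (seq x n) (seq y n) (seq z n))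
      }
    ; *-comm = λ x y → pointwise {x *ᴿ y} {y *ᴿ x} λ n → ℚ.*-comm (seq x n) (seq y n)
    }
  }

------------------------------------------------------------------------
-- Determinants and eigenvalues

Matrix : ℕ → Set
Matrix n = Fin n → Fin n → ℝ

open CommutativeMonoidSum (CommutativeRing.+-commutativeMonoid ℝ-commutativeRing) public
  using () renaming (sum to ∑)
open CommutativeMonoidSum (CommutativeRing.*-commutativeMonoid ℝ-commutativeRing) public
  using () renaming (sum to ∏)

alternate : ℕ → ℝ → ℝ
alternate zero    x = x
alternate (suc k) x = -ᴿ alternate k x

-- Laplace expansion along the first row.
det : ∀ {n} → Matrix n → ℝ
det {zero}  M = 1ᴿ
det {suc n} M = ∑ λ j → alternate (toℕ j)
  (M Fin.zero j *ᴿ det (λ i k → M (Fin.suc i) (punchIn j k)))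

identityMatrix : ∀ {n} → Matrix n
identityMatrix i j = if ⌊ i Fin.≟ j ⌋ then 1ᴿ else 0ᴿ

charPoly : ∀ {n} → Matrix n → ℝ → ℝ
charPoly M x = det (λ i j → x *ᴿ identityMatrix i j -ᴿ M i j)

-- t lists the eigenvalues of M, repeated according to their
-- multiplicity as roots of the characteristic polynomial, in
-- non-decreasing order.
IsSpectrum : ∀ {n} → Matrix n → Vector ℝ n → Set
IsSpectrum M t =
  (∀ x → charPoly M x ≃ ∏ (λ i → x -ᴿ t i)) × (∀ i j → i Fin.≤ j → t i ≤ᴿ t j)

------------------------------------------------------------------------
-- Finite graphs, with self-loops allowed

record Graph (n : ℕ) : Set₁ where
  infix 4 _∼_ _∼?_
  field
    _∼_   : Fin n → Fin n → Set
    _∼?_  : ∀ x y → Dec (x ∼ y)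
    ∼-sym : ∀ {x y} → x ∼ y → y ∼ x

module _ {n : ℕ} (G : Graph n) where
  open Graph G

  Bipartite : Set
  Bipartite = Σ (Fin n → Bool) λ colour → ∀ x y → x ∼ y → colour x ≢ colour y

  adjacencyMatrix : Matrix n
  adjacencyMatrix x y = if ⌊ x ∼? y ⌋ then 1ᴿ else 0ᴿ

  InBoundary : Subset n → Fin n → Set
  InBoundary V₁ y = y ∉ₛ V₁ × ∃[ x ] (x ∈ₛ V₁ × x ∼ y)

  inBoundary? : ∀ V₁ → Decidable (InBoundary V₁)
  inBoundary? V₁ y =
    ¬? (y ∈ₛ? V₁) ×-dec Fin.any? (λ x → (x ∈ₛ? V₁) ×-dec (x ∼? y))

  ∂ₒᵤₜ : Subset n → Subset n
  ∂ₒᵤₜ V₁ = Vec.tabulate (λ y → ⌊ inBoundary? V₁ y ⌋)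

nonempty⇒nonZero : ∀ {n} {p : Subset n} → Nonempty p → ℕ.NonZero ∣ p ∣
nonempty⇒nonZero (x , x∈p) = ℕ.>-nonZero (ℕ.≤-<-trans ℕ.z≤n (x∈p⇒∣p-x∣<∣p∣ x∈p))

module _ {n : ℕ} (G : Graph n) where

  expansion : (V₁ : Subset n) → .(Nonempty V₁) → ℚ
  expansion V₁ ne = (+ ∣ ∂ₒᵤₜ G V₁ ∣ ℚ./ ∣ V₁ ∣) {{nonempty⇒nonZero ne}}

  Admissible : Subset n → Set
  Admissible V₁ = Nonempty V₁ × 2 ℕ.* ∣ V₁ ∣ ℕ.≤ n

  -- h is the minimum of |∂ₒᵤₜ V₁| / |V₁| over the nonempty V₁ with
  -- |V₁| ≤ n / 2.
  IsOuterIsoperimetricConstant : ℚ → Set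
  IsOuterIsoperimetricConstant h =
    (∃[ V₁ ] Σ (Admissible V₁) λ adm → h ≡ expansion V₁ (proj₁ adm)) ×
    (∀ V₁ (adm : Admissible V₁) → h ℚ.≤ expansion V₁ (proj₁ adm))

private
  minimum : ∀ {n} {P : Pred (Subset n) 0ℓ} → Decidable P →
            (f : ∀ V → .(P V) → ℚ) →
            (∀ V → ¬ P V) ⊎ ∃[ V ] Σ (P V) λ p → ∀ W (q : P W) → f V p ℚ.≤ f W q
  minimum {zero} P? f with P? []
  ... | yes p = inj₂ ([] , p , λ { [] q → ℚ.≤-refl })
  ... | no ¬p = inj₁ λ { [] → ¬p }
  minimum {suc n} P? f
    with minimum (P? ∘ (inside ∷_)) (λ V → f (inside ∷ V))
       | minimum (P? ∘ (outside ∷_)) (λ V → f (outside ∷ V))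
  ... | inj₁ ¬a | inj₁ ¬b = inj₁ λ { (true ∷ V) → ¬a V ; (false ∷ V) → ¬b V }
  ... | inj₂ (V , p , l) | inj₁ ¬b = inj₂ (_ , p , λ
    { (true  ∷ W) q → l W q
    ; (false ∷ W) q → contradiction q (¬b W) })
  ... | inj₁ ¬a | inj₂ (V , p , l) = inj₂ (_ , p , λ
    { (true  ∷ W) q → contradiction q (¬a W)
    ; (false ∷ W) q → l W q })
  ... | inj₂ (V , p , l) | inj₂ (V′ , p′ , l′)
    with ℚ.≤-total (f (inside ∷ V) p) (f (outside ∷ V′) p′)
  ... | inj₁ le = inj₂ (_ , p , λ
    { (true  ∷ W) q → l W q
    ; (false ∷ W) q → ℚ.≤-trans le (l′ W q) })
  ... | inj₂ le = inj₂ (_ , p′ , λ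
    { (true  ∷ W) q → ℚ.≤-trans le (l W q)
    ; (false ∷ W) q → l′ W q })

outerIsoperimetricConstant-exists : ∀ {n} (G : Graph n) → 2 ℕ.≤ n →
  ∃[ h ] IsOuterIsoperimetricConstant G h
outerIsoperimetricConstant-exists {suc n} G 2≤n = conclude
  (minimum {P = Admissible G} (λ V → nonempty? V ×-dec 2 ℕ.* ∣ V ∣ ℕ.≤? suc n)
           (λ V adm → expansion G V (proj₁ adm)))
  where
  conclude : (∀ V → ¬ Admissible G V) ⊎
             (∃[ V ] Σ (Admissible G V) λ p → ∀ W (q : Admissible G W) →
                expansion G V (proj₁ p) ℚ.≤ expansion G W (proj₁ q)) →
             ∃[ h ] IsOuterIsoperimetricConstant G h
  conclude (inj₁ none) = contradiction
    ( (Fin.zero , x∈⁅x⁆ Fin.zero)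
    , subst (λ k → 2 ℕ.* k ℕ.≤ suc n) (sym (∣⁅x⁆∣≡1 {suc n} Fin.zero)) 2≤n)
    (none ⁅ Fin.zero ⁆)
  conclude (inj₂ (V , adm , l)) = expansion G V (proj₁ adm) , (V , adm , refl) , l

------------------------------------------------------------------------
-- Cayley graphs of finite groups

record FiniteGroup : Set₁ where
  field
    group       : Group 0ℓ 0ℓ
    order       : ℕ
    enumeration : Inverse (Group.setoid group) (setoid (Fin order))

  open Group group public
  open Inverse enumeration public
    using () renaming (to to index; from to element; to-cong to index-cong)

-- Subsets of X, and the vertices of its Cayley graphs, are handled
-- through the enumeration of X: the element x is in S when index x ∈ S,
-- and the vertex i stands for element i.
module _ (X : FiniteGroup) (S : Subset (FiniteGroup.order X)) where
  open FiniteGroup X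

  Symmetric : Set
  Symmetric = ∀ x → index x ∈ₛ S → index (x ⁻¹) ∈ₛ S

  cayleyGraph : Symmetric → Graph order
  cayleyGraph symmetric = record
    { _∼_   = λ i j → index (element i ∙ element j ⁻¹) ∈ₛ S
    ; _∼?_  = λ i j → index (element i ∙ element j ⁻¹) ∈ₛ? S
    ; ∼-sym = λ {i} {j} i∼j →
        subst (_∈ₛ S) (index-cong (⁻¹-anti-homo-// (element i) (element j)))
          (symmetric (element i ∙ element j ⁻¹) i∼j)
    }
    where open GroupProperties group using (⁻¹-anti-homo-//)

  nonBipartite⇒nonZero : (symmetric : Symmetric) →
                         ¬ Bipartite (cayleyGraph symmetric) → ℕ.NonZero ∣ S ∣
  nonBipartite⇒nonZero symmetric ¬bip with nonempty? S
  ... | yes ne = nonempty⇒nonZero ne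
  ... | no ¬ne = contradiction
    (const true , λ i j i∼j _ → ¬ne (_ , i∼j)) ¬bip

-- D⁻¹A for a d-regular graph.
normalisedAdjacencyMatrix : ∀ {n} → Graph n → (d : ℕ) → .{{ℕ.NonZero d}} → Matrix n
normalisedAdjacencyMatrix G d x y = fromℚ (+ 1 ℚ./ d) *ᴿ adjacencyMatrix G x y

module Submission where

-- Write κ = h²/16 and call m a centre of f if κ ∑ (f x - m)² is at most the
-- Dirichlet energy D f = ∑ (f x - f y)² over adjacent pairs.  A co-area argument
-- on the positive and negative parts of f minus a median shows that every f has
-- a centre; this gives the upper bound, since then the Rayleigh quotients
-- orthogonal to the constants are at most 1 - κ/2d.
--
-- For the lower bound, suppose that E f = ∑ (f x + f y)² is far below κ ∑ f².
-- As D ∣f∣ ≤ E f, ∣f∣ is nearly constant, so after scaling and truncation f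
-- becomes an F with values in [-1, 1], mostly close to ±1.  For each g the
-- product F x F (x g) has Dirichlet energy at most 4 E F, so it is nearly
-- constant; its sign χ g is a homomorphism to ±1, and for most x and g the signs
-- of F (x g) and F x χ g agree.  For s ∈ S most F (s z) and F z have opposite
-- signs, which forces χ s = -1, so that χ is a proper 2-colouring.
--
-- Eigenvalues are only known as roots of the characteristic polynomial P.  If
-- ∣⟨f, B f⟩∣ ≥ η ⟨f, f⟩ for all f, Gaussian elimination gives ∣det B∣ ≥ ηⁿ, so P is
-- bounded away from 0 below the lower bound, and (adding a multiple of the
-- all-ones matrix to remove the eigenvalue 1) ∣P x∣ is at least a multiple of
-- ∣x - 1∣ above the upper bound.  The operations on ℝ being pointwise, all of
-- this is needed for rational matrices and vectors only.
open import Algebra.Bundles using (CommutativeRing)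
import Algebra.Properties.Semiring.Sum as SemiringSum
open import Algebra.Structures using (IsGroup)
open import Data.Bool.Base using (Bool; true; false; not; _∧_; _xor_; if_then_else_)
open import Data.Fin.Base as Fin using (Fin; zero; suc; toℕ; fromℕ; punchIn)
import Data.Fin.Permutation as Permutation
import Data.Fin.Properties as Fin
open import Data.Fin.Subset using (Subset; Nonempty) renaming (_∈_ to _∈ₛ_)
open import Data.Fin.Subset.Properties using (nonempty?) renaming (_∈?_ to _∈ₛ?_)
import Data.Integer.Base as ℤ
import Data.Integer.Properties as ℤ
open import Data.Nat.Base as ℕ using (ℕ; zero; suc)
import Data.Nat.Properties as ℕ
open import Data.Product.Base using (Σ; ∃-syntax; _×_; _,_; proj₁; proj₂)
open import Data.Rational.Base as ℚ using (ℚ)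
import Data.Rational.Properties as ℚ
import Data.Rational.Unnormalised.Base as ℚᵘ
import Data.Rational.Unnormalised.Properties as ℚᵘ
open import Data.Sum.Base using (_⊎_; inj₁; inj₂; [_,_]′)
open import Data.Unit.Base using (⊤; tt)
open import Data.Vec.Base as Vec using (lookup)
open import Data.Vec.Functional using (Vector; _∷_)
open import Data.Vec.Properties using (lookup∘tabulate; tabulate∘lookup; []=⇒lookup; lookup⇒[]=)
import Defs as R
open import Function.Base using (_∘_; const; flip; case_of_; _∋_)
open import Function.Bundles using (Inverse)
open import Level using (0ℓ)
open import Relation.Binary.PropositionalEquality
  using (_≡_; _≢_; refl; sym; trans; cong; cong₂; subst; subst₂; isEquivalence; module ≡-Reasoning)
open import Relation.Nullary.Decidable using (Dec; yes; no; ⌊_⌋; dec⇒maybe)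
open import Relation.Nullary.Negation using (¬_; contradiction)
open import Relation.Unary using (Pred; Decidable)
open import Tactic.RingSolver using (solve-∀)
open import Tactic.RingSolver.Core.AlmostCommutativeRing using (fromCommutativeRing)

-- The obstacle in the lower bound is that left and right translations play different roles. Right
-- translations are automorphisms of the graph, and χ describes how the sign of F changes under
-- them; the edges are left multiplications by elements of S. The link is s z = z (z⁻¹ s z), where
-- the right multiplier depends on z. Hence bad points are counted over pairs (z, g) and not for one
-- fixed multiplier, and χ is evaluated on conjugates, which is harmless for a homomorphism into an
-- abelian group.
--
-- The degree enters only through D f = 2d ∑ f² - 2 ⟨f, A f⟩ and its analogue for E. The energies
-- are not normalised: in the co-area argument the largest difference at a vertex is bounded by the
-- sum over its edges, so no power of d is lost and the gap is κ/2d. This gives C = 1/32 and c =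
-- ε₀/32.
--
-- With ε₀ = 1/1600 a fixed multiplier is bad at a fraction of at most 72 · 4ε₀ = 0.18 of the
-- points, and the two union bounds need 3 · 0.18 < 1 and 2 · 0.18 + 0.02 < 1.

module RationalSums where

  open import Data.Integer.Base using (+_)
  open import Data.Rational.Base hiding (ℚ; floor; _≃_)
  open import Data.Rational.Properties

  ℚ-ring = fromCommutativeRing +-*-commutativeRing (λ x → dec⇒maybe (0ℚ ≟ x))

  infix 8 _²
  _² : ℚ → ℚ
  p ² = p * p

  2ℚ 3ℚ 4ℚ 8ℚ 16ℚ 72ℚ : ℚ
  2ℚ = + 2 / 1
  3ℚ = + 3 / 1
  4ℚ = + 4 / 1
  8ℚ = + 8 / 1
  16ℚ = + 16 / 1
  72ℚ = + 72 / 1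

  p≤q⇒0≤q-p : ∀ {p q} → p ≤ q → 0ℚ ≤ q - p
  p≤q⇒0≤q-p {p} {q} p≤q = subst (_≤ q - p) (+-inverseʳ p) (+-monoˡ-≤ (- p) p≤q)

  p<q⇒0<q-p : ∀ {p q} → p < q → 0ℚ < q - p
  p<q⇒0<q-p {p} {q} p<q = subst (_< q - p) (+-inverseʳ p) (+-monoˡ-< (- p) p<q)

  -- Most inequalities below are proved in this form: the difference is written as a combination of
  -- products of nonnegative quantities, and the ring solver checks the identity.
  ≤-by-difference : ∀ {p q} r → 0ℚ ≤ r → p + r ≡ q → p ≤ q
  ≤-by-difference {p} {q} r 0≤r eq =
    subst₂ _≤_ (+-identityʳ p) eq (+-monoʳ-≤ p 0≤r)

  <-by-difference : ∀ {p q} r → 0ℚ < r → p + r ≡ q → p < q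
  <-by-difference {p} {q} r 0<r eq =
    subst₂ _<_ (+-identityʳ p) eq (+-monoʳ-< p 0<r)

  ≤-+ʳ : ∀ {p q} → 0ℚ ≤ q → p ≤ p + q
  ≤-+ʳ 0≤q = ≤-by-difference _ 0≤q refl

  ≤-+ˡ : ∀ {p q} → 0ℚ ≤ q → p ≤ q + p
  ≤-+ˡ {p} {q} 0≤q = ≤-by-difference _ 0≤q (+-comm p q)

  +-nonneg : ∀ {p q} → 0ℚ ≤ p → 0ℚ ≤ q → 0ℚ ≤ p + q
  +-nonneg = +-mono-≤

  *-nonneg : ∀ {p q} → 0ℚ ≤ p → 0ℚ ≤ q → 0ℚ ≤ p * q
  *-nonneg {p} {q} 0≤p 0≤q = nonNegative⁻¹ (p * q)
    {{nonNeg*nonNeg⇒nonNeg p {{nonNegative 0≤p}} q {{nonNegative 0≤q}}}}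

  *-pos : ∀ {p q} → 0ℚ < p → 0ℚ < q → 0ℚ < p * q
  *-pos {p} {q} 0<p 0<q = positive⁻¹ (p * q)
    {{pos*pos⇒pos p {{positive 0<p}} q {{positive 0<q}}}}

  *-monoˡ : ∀ {p q r} → 0ℚ ≤ r → p ≤ q → r * p ≤ r * q
  *-monoˡ {r = r} 0≤r = *-monoˡ-≤-nonNeg r {{nonNegative 0≤r}}

  *-monoʳ : ∀ {p q r} → 0ℚ ≤ r → p ≤ q → p * r ≤ q * r
  *-monoʳ {r = r} 0≤r = *-monoʳ-≤-nonNeg r {{nonNegative 0≤r}}

  *-mono : ∀ {p q r s} → 0ℚ ≤ r → 0ℚ ≤ q → p ≤ q → r ≤ s → p * r ≤ q * s
  *-mono 0≤r 0≤q p≤q r≤s = ≤-trans (*-monoʳ 0≤r p≤q) (*-monoˡ 0≤q r≤s)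

  *-cancelˡ : ∀ {p q r} → 0ℚ < r → r * p ≤ r * q → p ≤ q
  *-cancelˡ {r = r} 0<r = *-cancelˡ-≤-pos r {{positive 0<r}}

  ²-nonneg : ∀ p → 0ℚ ≤ p ²
  ²-nonneg p = [ (λ 0≤p → *-nonneg 0≤p 0≤p)
               , (λ p≤0 → subst (0ℚ ≤_) (square p)
                   (*-nonneg (neg-antimono-≤ p≤0) (neg-antimono-≤ p≤0))) ]′
               (≤-total 0ℚ p)
    where
    square : ∀ p → - p * - p ≡ p * p
    square = solve-∀ ℚ-ring

  ²-mono : ∀ {p q} → 0ℚ ≤ p → p ≤ q → p ² ≤ q ²
  ²-mono 0≤p p≤q = *-mono 0≤p (≤-trans 0≤p p≤q) p≤q p≤q

  ∣p∣²≡p² : ∀ p → ∣ p ∣ ² ≡ p ²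
  ∣p∣²≡p² p = trans (sym (∣p*q∣≡∣p∣*∣q∣ p p)) (0≤p⇒∣p∣≡p (²-nonneg p))

  p≤∣p∣ : ∀ p → p ≤ ∣ p ∣
  p≤∣p∣ p with ≤-total 0ℚ p
  ... | inj₁ 0≤p = ≤-reflexive (sym (0≤p⇒∣p∣≡p 0≤p))
  ... | inj₂ p≤0 = ≤-trans p≤0 (0≤∣p∣ p)

  -∣p∣≤p : ∀ p → - ∣ p ∣ ≤ p
  -∣p∣≤p p = subst₂ _≤_ (cong -_ (∣-p∣≡∣p∣ p)) (neg-involutive p)
    (neg-antimono-≤ (p≤∣p∣ (- p)))
    where
    neg-involutive : ∀ p → - - p ≡ p
    neg-involutive = solve-∀ ℚ-ring

  open SemiringSum (CommutativeRing.semiring +-*-commutativeRing) public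
    using (∑-distrib-+; ∑-comm; *-distribˡ-sum; *-distribʳ-sum; sum-permute; sum-replicate-zero)
    renaming (sum to ∑; sum-cong-≗ to ∑-cong)

  ∑-mono : ∀ {n} {f g : Fin n → ℚ} → (∀ i → f i ≤ g i) → ∑ f ≤ ∑ g
  ∑-mono {zero}  f≤g = ≤-refl
  ∑-mono {suc n} f≤g = +-mono-≤ (f≤g zero) (∑-mono (f≤g ∘ suc))

  ∑-nonneg : ∀ {n} {f : Fin n → ℚ} → (∀ i → 0ℚ ≤ f i) → 0ℚ ≤ ∑ f
  ∑-nonneg {n} {f} 0≤f = subst (_≤ ∑ f) (sum-replicate-zero n) (∑-mono {f = const 0ℚ} 0≤f)

  term≤∑ : ∀ {n} {f : Fin n → ℚ} → (∀ i → 0ℚ ≤ f i) → ∀ i → f i ≤ ∑ f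
  term≤∑ {f = f} 0≤f zero    = ≤-by-difference _ (∑-nonneg (0≤f ∘ suc)) refl
  term≤∑ {f = f} 0≤f (suc i) = ≤-trans (term≤∑ (0≤f ∘ suc) i)
    (≤-by-difference _ (0≤f zero) (+-comm _ (f zero)))

  -- The averaging principle: every point with prescribed good behaviour is found through it.
  ∑<∑⇒∃< : ∀ {n} {f g : Fin n → ℚ} → ∑ f < ∑ g → ∃[ i ] f i < g i
  ∑<∑⇒∃< {zero} lt = contradiction lt (<-irrefl refl)
  ∑<∑⇒∃< {suc n} {f} {g} lt with f zero <? g zero
  ... | yes f<g = zero , f<g
  ... | no  f≮g with ∑<∑⇒∃< {f = f ∘ suc} {g = g ∘ suc}
                       (≰⇒> λ le → <-irrefl refl (<-≤-trans lt (+-mono-≤ (≮⇒≥ f≮g) le)))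
  ...   | i , f<g = suc i , f<g

  ∑-linear : ∀ {n} a b (f g : Fin n → ℚ) →
             ∑ (λ i → a * f i + b * g i) ≡ a * ∑ f + b * ∑ g
  ∑-linear a b f g = trans (∑-distrib-+ (λ i → a * f i) (λ i → b * g i))
    (sym (cong₂ _+_ (*-distribˡ-sum a f) (*-distribˡ-sum b g)))

  ∑-linear₃ : ∀ {n} a b c (f g h : Fin n → ℚ) →
              ∑ (λ i → a * f i + b * g i + c * h i) ≡ a * ∑ f + b * ∑ g + c * ∑ h
  ∑-linear₃ a b c f g h = trans (∑-distrib-+ (λ i → a * f i + b * g i) (λ i → c * h i))
    (cong₂ _+_ (∑-linear a b f g) (sym (*-distribˡ-sum c h)))

  ∑₂ : ∀ {m n} → (Fin m → Fin n → ℚ) → ℚ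
  ∑₂ f = ∑ λ i → ∑ (f i)

  ∑₂-mono : ∀ {m n} {f g : Fin m → Fin n → ℚ} → (∀ i j → f i j ≤ g i j) → ∑₂ f ≤ ∑₂ g
  ∑₂-mono f≤g = ∑-mono λ i → ∑-mono (f≤g i)

  ∑₂-cong : ∀ {m n} {f g : Fin m → Fin n → ℚ} → (∀ i j → f i j ≡ g i j) → ∑₂ f ≡ ∑₂ g
  ∑₂-cong f≡g = ∑-cong λ i → ∑-cong (f≡g i)

  ∑₂-linear : ∀ {m n} a b (f g : Fin m → Fin n → ℚ) →
              ∑₂ (λ i j → a * f i j + b * g i j) ≡ a * ∑₂ f + b * ∑₂ g
  ∑₂-linear a b f g = trans (∑-cong λ i → ∑-linear a b (f i) (g i))
    (∑-linear a b (λ i → ∑ (f i)) (λ i → ∑ (g i)))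

  ∑₂-scale : ∀ {m n} a (f : Fin m → Fin n → ℚ) → ∑₂ (λ i j → a * f i j) ≡ a * ∑₂ f
  ∑₂-scale a f = trans (∑-cong λ i → sym (*-distribˡ-sum a (f i)))
    (sym (*-distribˡ-sum a (λ i → ∑ (f i))))

  ind : Bool → ℚ
  ind b = if b then 1ℚ else 0ℚ

  ind-nonneg : ∀ b → 0ℚ ≤ ind b
  ind-nonneg true  = <⇒≤ (positive⁻¹ 1ℚ)
  ind-nonneg false = ≤-refl

  ind≤1 : ∀ b → ind b ≤ 1ℚ
  ind≤1 true  = ≤-refl
  ind≤1 false = ind-nonneg true

  #_ : ∀ {n} → (Fin n → Bool) → ℚ
  # p = ∑ (ind ∘ p)

  -- The rational number n, kept as a sum of ones so that counts compare with it term by term.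
  size : ℕ → ℚ
  size n = ∑ {n} (const 1ℚ)

-- Vertex expansion and the Poincaré inequality

module VertexExpansion where

  open import Data.Rational.Base hiding (ℚ; floor; _≃_)
  open import Data.Rational.Properties
  open RationalSums

  minimiser : ∀ {n} {P : Pred (Fin n) 0ℓ} → Decidable P → (f : Fin n → ℚ) →
              (∀ i → ¬ P i) ⊎ ∃[ i ] (P i × ∀ j → P j → f i ≤ f j)
  minimiser {zero} P? f = inj₁ λ ()
  minimiser {suc n} P? f with P? zero | minimiser (P? ∘ suc) (f ∘ suc)
  ... | no ¬p | inj₁ none = inj₁ λ { zero → ¬p ; (suc i) → none i }
  ... | no ¬p | inj₂ (i , p , least) = inj₂ (suc i , p , λ
    { zero q → contradiction q ¬p ; (suc j) q → least j q })
  ... | yes p | inj₁ none = inj₂ (zero , p , λ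
    { zero _ → ≤-refl ; (suc j) q → contradiction q (none j) })
  ... | yes p | inj₂ (i , q , least) with ≤-total (f zero) (f (suc i))
  ...   | inj₁ le = inj₂ (zero , p , λ { zero _ → ≤-refl ; (suc j) r → ≤-trans le (least j r) })
  ...   | inj₂ le = inj₂ (suc i , q , λ { zero _ → le ; (suc j) r → least j r })

  ind-mono : ∀ {b c} → (b ≡ true → c ≡ true) → ind b ≤ ind c
  ind-mono {false} {c} _ = ind-nonneg c
  ind-mono {true} {c} imp = ≤-reflexive (cong ind (sym (imp refl)))

  #-mono : ∀ {n} {p q : Fin n → Bool} → (∀ i → p i ≡ true → q i ≡ true) → # p ≤ # q
  #-mono p⊆q = ∑-mono λ i → ind-mono (p⊆q i)

  ⌊⌋-true : ∀ {P : Set} {P? : Dec P} → P → ⌊ P? ⌋ ≡ true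
  ⌊⌋-true {P? = yes _} _ = refl
  ⌊⌋-true {P? = no ¬p} p = contradiction p ¬p

  ⌊⌋-false : ∀ {P : Set} {P? : Dec P} → ¬ P → ⌊ P? ⌋ ≡ false
  ⌊⌋-false {P? = yes p} ¬p = contradiction p ¬p
  ⌊⌋-false {P? = no _} _ = refl

  true-⌊⌋ : ∀ {P : Set} {P? : Dec P} → ⌊ P? ⌋ ≡ true → P
  true-⌊⌋ {P? = yes p} _ = p

  positive? : ∀ {n} → (Fin n → ℚ) → Fin n → Bool
  positive? w x = ⌊ 0ℚ <? w x ⌋

  half-mono : ∀ {n} {p q : Fin n → Bool} → (∀ i → p i ≡ true → q i ≡ true) →
    2ℚ * # q ≤ size n → 2ℚ * # p ≤ size n
  half-mono p⊆q = ≤-trans (*-monoˡ (<⇒≤ (positive⁻¹ 2ℚ)) (#-mono p⊆q))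

  #≡0 : ∀ {n} {p : Fin n → Bool} → (∀ i → p i ≡ false) → # p ≡ 0ℚ
  #≡0 {n} none = trans (∑-cong λ i → cong ind (none i)) (sum-replicate-zero n)

  -- The median found is the least value with at most half of the points above it.
  median : ∀ {n} (f : Fin n → ℚ) → ∃[ m ]
           2ℚ * # (λ x → ⌊ m <? f x ⌋) ≤ size n × 2ℚ * # (λ x → ⌊ f x <? m ⌋) ≤ size n
  median {zero} f = 0ℚ , ≤-refl , ≤-refl
  median {suc n} f = case minimiser {P = Light} light? f of λ
    { (inj₁ none) → contradiction maximum-light (none maximum)
    ; (inj₂ (i , light , least)) → f i , light , ≮⇒≥ (heavy-below i least) }
    where
    above : Fin (suc n) → Fin (suc n) → Bool
    above x y = ⌊ f x <? f y ⌋

    Light : Fin (suc n) → Set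
    Light x = 2ℚ * # (above x) ≤ size (suc n)

    light? : Decidable Light
    light? x = 2ℚ * # (above x) ≤? size (suc n)

    greatest : ∃[ i ] ∀ j → f j ≤ f i
    greatest with minimiser {P = const ⊤} (const (yes tt)) (-_ ∘ f)
    ... | inj₁ none = contradiction tt (none zero)
    ... | inj₂ (i , _ , least) = i , λ j → neg-cancel (least j tt)
      where
      neg-cancel : ∀ {p q} → - p ≤ - q → q ≤ p
      neg-cancel {p} {q} le = ≤-by-difference _ (p≤q⇒0≤q-p le) (identity p q)
        where
        identity : ∀ p q → q + (- q - - p) ≡ p
        identity = solve-∀ ℚ-ring

    maximum = proj₁ greatest

    maximum-light : Light maximum
    maximum-light = subst (λ s → 2ℚ * s ≤ size (suc n))
      (sym (#≡0 {p = above maximum} λ j → ⌊⌋-false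
        (λ lt → <-irrefl refl (<-≤-trans lt (proj₂ greatest j)))))
      (∑-nonneg {suc n} λ _ → ind-nonneg true)

    below : Fin (suc n) → Fin (suc n) → Bool
    below i x = ⌊ f x <? f i ⌋

    -- Let f j be the largest value below f i. No point lies strictly between the two values, so the
    -- points above f j and those below f i are disjoint; if the latter are more than half, j is
    -- light, against the minimality of f i.
    heavy-below : ∀ i → (∀ j → Light j → f i ≤ f j) → ¬ size (suc n) < 2ℚ * # (below i)
    heavy-below i least heavy with minimiser {P = λ x → f x < f i} (λ x → f x <? f i) (-_ ∘ f)
    ... | inj₁ none = <-irrefl refl (<-≤-trans heavy (subst (λ s → 2ℚ * s ≤ size (suc n))
            (sym (#≡0 {p = below i} λ j → ⌊⌋-false (none j)))
            (∑-nonneg {suc n} λ _ → ind-nonneg true)))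
    ... | inj₂ (j , j<i , largest) = <-irrefl refl (<-≤-trans j<i (least j light))
      where
      disjoint : ∀ x → 1ℚ * ind (above j x) + 1ℚ * ind (below i x) ≤ 1ℚ
      disjoint x with f j <? f x | f x <? f i
      ... | no _ | no _ = <⇒≤ (positive⁻¹ 1ℚ)
      ... | no _ | yes _ = ≤-refl
      ... | yes _ | no _ = ≤-refl
      ... | yes j<x | yes x<i = contradiction (neg-antimono-< j<x) (λ lt →
              <-irrefl refl (<-≤-trans lt (largest x x<i)))

      light : Light j
      light = ≤-by-difference _
        (+-nonneg (p≤q⇒0≤q-p (<⇒≤ heavy))
          (+-nonneg (p≤q⇒0≤q-p total) (p≤q⇒0≤q-p total)))
        (identity (# (above j)) (# (below i)) (size (suc n)))
        where
        total : 1ℚ * # (above j) + 1ℚ * # (below i) ≤ size (suc n)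
        total =
          subst (_≤ size (suc n)) (∑-linear 1ℚ 1ℚ (ind ∘ above j) (ind ∘ below i)) (∑-mono disjoint)
        identity : ∀ a b s →
          2ℚ * a + ((2ℚ * b - s) + ((s - (1ℚ * a + 1ℚ * b)) + (s - (1ℚ * a + 1ℚ * b)))) ≡ s
        identity = solve-∀ ℚ-ring

  ⊔-lipschitz : ∀ p q → ((0ℚ ⊔ p) - (0ℚ ⊔ q)) ² ≤ (p - q) ²
  ⊔-lipschitz p q with ≤-total 0ℚ p | ≤-total 0ℚ q
  ... | inj₁ 0≤p | inj₁ 0≤q rewrite p≤q⇒p⊔q≡q 0≤p | p≤q⇒p⊔q≡q 0≤q = ≤-refl
  ... | inj₂ p≤0 | inj₂ q≤0 rewrite p≥q⇒p⊔q≡p p≤0 | p≥q⇒p⊔q≡p q≤0 = ²-nonneg (p - q)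
  ... | inj₁ 0≤p | inj₂ q≤0 rewrite p≤q⇒p⊔q≡q 0≤p | p≥q⇒p⊔q≡p q≤0 =
    ²-mono (p≤q⇒0≤q-p 0≤p) (+-monoʳ-≤ p (neg-antimono-≤ q≤0))
  ... | inj₂ p≤0 | inj₁ 0≤q rewrite p≥q⇒p⊔q≡p p≤0 | p≤q⇒p⊔q≡q 0≤q =
    subst₂ _≤_ (swap 0ℚ q) (swap p q)
      (²-mono (p≤q⇒0≤q-p 0≤q) (+-monoʳ-≤ q (neg-antimono-≤ p≤0)))
    where
    swap : ∀ p q → (q - p) * (q - p) ≡ (p - q) * (p - q)
    swap = solve-∀ ℚ-ring

  ²≤⊔²+⊔² : ∀ p → p ² ≤ (0ℚ ⊔ p) ² + (0ℚ ⊔ (- p)) ²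
  ²≤⊔²+⊔² p with ≤-total 0ℚ p
  ... | inj₁ 0≤p rewrite p≤q⇒p⊔q≡q 0≤p =
    ≤-by-difference _ (²-nonneg (0ℚ ⊔ (- p))) refl
  ... | inj₂ p≤0 rewrite p≤q⇒p⊔q≡q (neg-antimono-≤ p≤0) =
    ≤-by-difference _ (²-nonneg (0ℚ ⊔ p)) (identity p (0ℚ ⊔ p))
    where
    identity : ∀ p q → p * p + q * q ≡ q * q + - p * - p
    identity = solve-∀ ℚ-ring

  module Expansion {n} (adj : Fin n → Fin n → Bool) where

    edge : Fin n → Fin n → ℚ
    edge x y = ind (adj x y)

    -- For a symmetric `adj` every edge between distinct vertices counts in both directions, whence
    -- the factor 2 in `dirichlet≡`.
    dirichlet : (Fin n → ℚ) → ℚ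
    dirichlet f = ∑₂ λ x y → edge x y * (f x - f y) ²

    -- Here `q` may be any set that contains the outer boundary of `p`. This lets the co-area
    -- argument use a set on which b is large in place of the boundary itself.
    module _ (h : ℚ) (0≤h : 0ℚ ≤ h) (h≤2 : h ≤ 2ℚ)
      (isoperimetry : ∀ p q → 2ℚ * # p ≤ size n →
         (∀ x y → adj x y ≡ true → p x ≡ true → p y ≡ false → q y ≡ true) → h * # p ≤ # q)
      where

      -- The discrete co-area argument, peeling off the lowest level set.
      coarea : ∀ k (w b : Fin n → ℚ) → (∀ x → 0ℚ ≤ w x) → (∀ y → 0ℚ ≤ b y) →
               2ℚ * # (positive? w) ≤ size n → # (positive? w) ≤ size k →
               (∀ x y → adj x y ≡ true → w x - w y ≤ b y) → h * ∑ w ≤ ∑ b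
      coarea k w b 0≤w 0≤b half fuel gradient
        with minimiser {P = λ x → 0ℚ < w x} (λ x → 0ℚ <? w x) w
      ... | inj₁ none = ≤-trans
            (subst (h * ∑ w ≤_) (*-zeroʳ h) (*-monoˡ 0≤h
              (subst (∑ w ≤_) (sum-replicate-zero n) (∑-mono {g = const 0ℚ} (≮⇒≥ ∘ none)))))
            (∑-nonneg 0≤b)
      coarea zero w b 0≤w 0≤b half fuel gradient | inj₂ (i , 0<wi , _) =
        contradiction (≤-trans (term≤∑ (λ x → ind-nonneg (positive? w x)) i) fuel)
          λ le → <-irrefl refl (<-≤-trans (positive⁻¹ 1ℚ)
            (subst (_≤ 0ℚ) (cong ind (⌊⌋-true {P? = 0ℚ <? w i} 0<wi)) le))
      coarea (suc k) w b 0≤w 0≤b half fuel gradient | inj₂ (i , 0<τ , least) =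
        ≤-by-difference _
          (+-nonneg (p≤q⇒0≤q-p peeled) (*-nonneg (<⇒≤ 0<τ) (p≤q⇒0≤q-p boundary)))
          (recombine h τ (∑ w) (∑ b) (# p) (# q))
        where
        τ = w i

        -- q contains the boundary of p, and b is at least τ on q.
        p q : Fin n → Bool
        p = positive? w
        q y = not (p y) ∧ ⌊ τ ≤? b y ⌋

        -- Both functions lose a layer of height τ: w on its support, b on q. The two sides of the
        -- claim drop by h τ times the size of p and by τ times the size of q, which `boundary`
        -- compares. The coefficients are written out to fit `∑-linear`.
        w′ b′ : Fin n → ℚ
        w′ x = 1ℚ * w x + (- τ) * ind (p x)
        b′ y = 1ℚ * b y + (- τ) * ind (q y)

        0-1 : ∀ u v → 1ℚ * u + (- v) * 0ℚ ≡ u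
        0-1 = solve-∀ ℚ-ring

        1-1 : ∀ u v → 1ℚ * u + (- v) * 1ℚ ≡ u - v
        1-1 = solve-∀ ℚ-ring

        data Layer (x : Fin n) : Set where
          inside  : p x ≡ true → q x ≡ false → τ ≤ w x → w′ x ≡ w x - τ → b′ x ≡ b x → Layer x
          rim     : p x ≡ false → q x ≡ true → w x ≡ 0ℚ → τ ≤ b x → w′ x ≡ 0ℚ → b′ x ≡ b x - τ → Layer x
          outside : p x ≡ false → q x ≡ false → w x ≡ 0ℚ → b x < τ → w′ x ≡ 0ℚ → b′ x ≡ b x → Layer x

        level : ∀ x → Layer x
        level x with 0ℚ <? w x in eq | τ ≤? b x in eq′
        ... | yes 0<w | _ = inside (cong ⌊_⌋ eq) qx (least x 0<w)
              (trans (cong (λ c → 1ℚ * w x + (- τ) * ind c) (cong ⌊_⌋ eq)) (1-1 (w x) τ))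
              (trans (cong (λ c → 1ℚ * b x + (- τ) * ind c) qx) (0-1 (b x) τ))
          where qx = cong (λ c → not ⌊ c ⌋ ∧ ⌊ τ ≤? b x ⌋) eq
        ... | no 0≮w | yes τ≤b = rim (cong ⌊_⌋ eq) qx w≡0 τ≤b
              (trans (trans (cong (λ c → 1ℚ * w x + (- τ) * ind c) (cong ⌊_⌋ eq)) (0-1 (w x) τ)) w≡0)
              (trans (cong (λ c → 1ℚ * b x + (- τ) * ind c) qx) (1-1 (b x) τ))
          where
          qx = cong₂ (λ c d → not ⌊ c ⌋ ∧ ⌊ d ⌋) eq eq′
          w≡0 = ≤-antisym (≮⇒≥ 0≮w) (0≤w x)
        ... | no 0≮w | no τ≰b = outside (cong ⌊_⌋ eq) qx w≡0 (≰⇒> τ≰b)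
              (trans (trans (cong (λ c → 1ℚ * w x + (- τ) * ind c) (cong ⌊_⌋ eq)) (0-1 (w x) τ)) w≡0)
              (trans (cong (λ c → 1ℚ * b x + (- τ) * ind c) qx) (0-1 (b x) τ))
          where
          qx = cong₂ (λ c d → not ⌊ c ⌋ ∧ ⌊ d ⌋) eq eq′
          w≡0 = ≤-antisym (≮⇒≥ 0≮w) (0≤w x)

        w-0 : ∀ {u v} → v ≡ 0ℚ → u - v ≡ u
        w-0 {u} refl = +-identityʳ u

        boundary : h * # p ≤ # q
        boundary = isoperimetry p q half rim-or-inside
          where
          rim-or-inside : ∀ x y → adj x y ≡ true → p x ≡ true → p y ≡ false → q y ≡ true
          rim-or-inside x y x∼y px py with level x | level y
          ... | rim px′ _ _ _ _ _     | _ = case trans (sym px) px′ of λ ()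
          ... | outside px′ _ _ _ _ _ | _ = case trans (sym px) px′ of λ ()
          ... | inside _ _ τ≤w _ _    | inside py′ _ _ _ _ = case trans (sym py′) py of λ ()
          ... | inside _ _ τ≤w _ _    | rim _ qy _ _ _ _ = qy
          ... | inside _ _ τ≤w _ _    | outside _ _ wy≡0 b<τ _ _ =
            contradiction (≤-trans τ≤w (subst (_≤ b y) (w-0 wy≡0) (gradient x y x∼y)))
              (λ le → <-irrefl refl (<-≤-trans b<τ le))

        0≤w′ : ∀ x → 0ℚ ≤ w′ x
        0≤w′ x with level x
        ... | inside _ _ τ≤w eq _ = subst (0ℚ ≤_) (sym eq) (p≤q⇒0≤q-p τ≤w)
        ... | rim _ _ _ _ eq _ = ≤-reflexive (sym eq)
        ... | outside _ _ _ _ eq _ = ≤-reflexive (sym eq)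

        0≤b′ : ∀ x → 0ℚ ≤ b′ x
        0≤b′ x with level x
        ... | inside _ _ _ _ eq = subst (0ℚ ≤_) (sym eq) (0≤b x)
        ... | rim _ _ _ τ≤b _ eq = subst (0ℚ ≤_) (sym eq) (p≤q⇒0≤q-p τ≤b)
        ... | outside _ _ _ _ _ eq = subst (0ℚ ≤_) (sym eq) (0≤b x)

        0-≤ : ∀ {u v} → 0ℚ ≤ u → 0ℚ ≤ v → 0ℚ - u ≤ v
        0-≤ {u} {v} 0≤u 0≤v = ≤-by-difference (u + v) (+-nonneg 0≤u 0≤v) (cancel u v)
          where
          cancel : ∀ u v → (0ℚ - u) + (u + v) ≡ v
          cancel = solve-∀ ℚ-ring

        -- If x lies in p, a neighbour y cannot be `outside`, since b y ≥ w x - w y ≥ τ when w y =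
        -- 0. So τ either cancels in the difference (y inside) or is subtracted from both sides (y
        -- on the rim).
        gradient′ : ∀ x y → adj x y ≡ true → w′ x - w′ y ≤ b′ y
        gradient′ x y x∼y with level x
        ... | rim _ _ _ _ eq _ = subst (λ u → u - w′ y ≤ b′ y) (sym eq) (0-≤ (0≤w′ y) (0≤b′ y))
        ... | outside _ _ _ _ eq _ = subst (λ u → u - w′ y ≤ b′ y) (sym eq) (0-≤ (0≤w′ y) (0≤b′ y))
        ... | inside _ _ τ≤w wx≡ _ with level y
        ...   | inside _ _ _ wy≡ by≡ = subst₂ _≤_
                (sym (trans (cong₂ _-_ wx≡ wy≡) (shift (w x) (w y) τ))) (sym by≡) (gradient x y x∼y)
          where
          shift : ∀ u v t → (u - t) - (v - t) ≡ u - v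
          shift = solve-∀ ℚ-ring
        ...   | rim _ _ wy≡0 _ wy′≡0 by≡ = subst₂ _≤_
                (trans (cong (_- τ) (w-0 {w x} wy≡0)) (sym (trans (w-0 wy′≡0) wx≡))) (sym by≡)
                (+-monoˡ-≤ (- τ) (gradient x y x∼y))
        ...   | outside _ _ wy≡0 b<τ _ _ =
            contradiction (≤-trans τ≤w (subst (_≤ b y) (w-0 wy≡0) (gradient x y x∼y)))
              (λ le → <-irrefl refl (<-≤-trans b<τ le))

        p′⊆p : ∀ x → positive? w′ x ≡ true → p x ≡ true
        p′⊆p x p′x with level x
        ... | inside px _ _ _ _ = px
        ... | rim _ _ _ _ eq _ = contradiction (subst (0ℚ <_) eq (true-⌊⌋ p′x)) (<-irrefl refl)
        ... | outside _ _ _ _ eq _ = contradiction (subst (0ℚ <_) eq (true-⌊⌋ p′x)) (<-irrefl refl)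

        lost : ∀ x → 0ℚ ≤ 1ℚ * ind (p x) + (- 1ℚ) * ind (positive? w′ x)
        lost x = subst (0ℚ ≤_) (as-difference (ind (p x)) (ind (positive? w′ x)))
          (p≤q⇒0≤q-p (ind-mono (p′⊆p x)))
          where
          as-difference : ∀ u v → u - v ≡ 1ℚ * u + (- 1ℚ) * v
          as-difference = solve-∀ ℚ-ring

        lost-at-i : 1ℚ * ind (p i) + (- 1ℚ) * ind (positive? w′ i) ≡ 1ℚ
        lost-at-i = cong₂ (λ c d → 1ℚ * ind c + (- 1ℚ) * ind d) pi≡true
          (⌊⌋-false {P? = 0ℚ <? w′ i} λ 0<w′ → <-irrefl refl (subst (0ℚ <_) w′≡0 0<w′))
          where
          pi≡true : p i ≡ true
          pi≡true = ⌊⌋-true {P? = 0ℚ <? w i} 0<τ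
          w′≡0 : w′ i ≡ 0ℚ
          w′≡0 = trans (cong (λ c → 1ℚ * w i + (- τ) * ind c) pi≡true)
            (trans (1-1 (w i) τ) (+-inverseʳ τ))

        -- The minimiser i leaves the support, so the bound k on the size of the support drops by
        -- one; this makes the recursion structural.
        shrunk : # (positive? w′) ≤ size k
        shrunk = ≤-by-difference _
          (+-nonneg (p≤q⇒0≤q-p fuel) (p≤q⇒0≤q-p
            (subst₂ _≤_ lost-at-i (∑-linear 1ℚ (- 1ℚ) (ind ∘ p) (ind ∘ positive? w′)) (term≤∑ lost i))))
          (identity (# (positive? w′)) (# p) (size k))
          where
          identity : ∀ a b s → a + (((1ℚ + s) - b) + ((1ℚ * b + (- 1ℚ) * a) - 1ℚ)) ≡ s
          identity = solve-∀ ℚ-ring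

        peeled : h * (1ℚ * ∑ w + (- τ) * # p) ≤ 1ℚ * ∑ b + (- τ) * # q
        peeled = subst₂ (λ u v → h * u ≤ v)
          (∑-linear 1ℚ (- τ) w (ind ∘ p)) (∑-linear 1ℚ (- τ) b (ind ∘ q))
          (coarea k w′ b′ 0≤w′ 0≤b′ (half-mono p′⊆p half) shrunk gradient′)

        recombine : ∀ h τ W B P Q →
          h * W + (((1ℚ * B + (- τ) * Q) - h * (1ℚ * W + (- τ) * P)) + τ * (Q - h * P)) ≡ B
        recombine = solve-∀ ℚ-ring

      -- Cheeger's argument: `coarea` is applied to h g², whose increments along edges are
      -- controlled by g and its differences. The difference at a neighbour is bounded by the whole
      -- sum `gap y`, and these sums add up to the Dirichlet energy.
      poincaré-half : ∀ g → (∀ x → 0ℚ ≤ g x) → 2ℚ * # (positive? g) ≤ size n →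
                      h ² * ∑ (λ x → g x ²) ≤ 8ℚ * dirichlet g
      poincaré-half g 0≤g half = ≤-by-difference _
        (+-nonneg (*-nonneg (<⇒≤ (positive⁻¹ 2ℚ)) (p≤q⇒0≤q-p bound))
          (*-nonneg (p≤q⇒0≤q-p h≤2) (*-nonneg (<⇒≤ (positive⁻¹ 2ℚ)) 0≤D)))
        (identity h G (dirichlet g))
        where
        G = ∑ λ x → g x ²

        gap : Fin n → ℚ
        gap y = ∑ λ x → edge x y * (g x - g y) ²

        gap-nonneg : ∀ x y → 0ℚ ≤ edge x y * (g x - g y) ²
        gap-nonneg x y = *-nonneg (ind-nonneg (adj x y)) (²-nonneg (g x - g y))

        0≤D : 0ℚ ≤ dirichlet g
        0≤D = ∑-nonneg λ x → ∑-nonneg λ y → gap-nonneg x y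

        -- With D = g x - g y we have w x - w y = h D² + 2 h D g y, and the last term is
        -- at most 2 D² + h²/2 (g y)².
        w b : Fin n → ℚ
        w x = h * g x ²
        b y = (h + 2ℚ) * gap y + (½ * h ²) * g y ²

        0≤h+2 : 0ℚ ≤ h + 2ℚ
        0≤h+2 = +-nonneg 0≤h (<⇒≤ (positive⁻¹ 2ℚ))

        0≤b : ∀ y → 0ℚ ≤ b y
        0≤b y = +-nonneg (*-nonneg 0≤h+2 (∑-nonneg λ x → gap-nonneg x y))
          (*-nonneg (*-nonneg (<⇒≤ (positive⁻¹ ½)) (²-nonneg h)) (²-nonneg (g y)))

        w⊆g : ∀ x → positive? w x ≡ true → positive? g x ≡ true
        w⊆g x wx = ⌊⌋-true (≰⇒> λ g≤0 → <-irrefl refl (subst (0ℚ <_)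
          (trans (cong (λ u → h * u ²) (≤-antisym g≤0 (0≤g x))) (*-zeroʳ h)) (true-⌊⌋ wx)))

        gradient : ∀ x y → adj x y ≡ true → w x - w y ≤ b y
        gradient x y x∼y = ≤-by-difference _
          (+-nonneg (*-nonneg 0≤h+2 (p≤q⇒0≤q-p (subst (_≤ gap y)
               (trans (cong (λ c → ind c * (g x - g y) ²) x∼y) (*-identityˡ _))
                 (term≤∑ (λ x → gap-nonneg x y) x))))
            (*-nonneg (<⇒≤ (positive⁻¹ ½)) (²-nonneg (2ℚ * (g x - g y) - h * g y))))
          (square h (g x) (g y) (gap y))
          where
          square : ∀ h u v s → (h * (u * u) - h * (v * v)) +
            ((h + 2ℚ) * (s - (u - v) * (u - v)) +
              ½ * ((2ℚ * (u - v) - h * v) * (2ℚ * (u - v) - h * v))) ≡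
            (h + 2ℚ) * s + (½ * (h * h)) * (v * v)
          square = solve-∀ ℚ-ring

        -- The term with ½ h² is absorbed by the left side, and h ≤ 2 then bounds the remaining 2 (h
        -- + 2) by 8.
        bound : h * (h * G) ≤ (h + 2ℚ) * dirichlet g + (½ * h ²) * G
        bound = subst₂ (λ u v → h * u ≤ v)
          (sym (*-distribˡ-sum h (λ x → g x ²)))
          (trans (∑-linear (h + 2ℚ) (½ * h ²) gap (λ x → g x ²))
            (cong (λ s → (h + 2ℚ) * s + (½ * h ²) * G) (∑-comm λ y x → edge x y * (g x - g y) ²)))
          (coarea n w b (λ x → *-nonneg 0≤h (²-nonneg (g x))) 0≤b (half-mono w⊆g half)
            (∑-mono λ x → ind≤1 (positive? w x)) gradient)

        identity : ∀ h G D → h * h * G +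
          (2ℚ * (((h + 2ℚ) * D + (½ * (h * h)) * G) - h * (h * G)) + (2ℚ - h) * (2ℚ * D)) ≡ 8ℚ * D
        identity = solve-∀ ℚ-ring

      -- Positive and negative part of f - m are contractions of f, so each costs at most 8 times
      -- the energy of f; the median keeps both supports within half of the vertices.
      poincaré : ∀ f → ∃[ m ] h ² * ∑ (λ x → (f x - m) ²) ≤ 16ℚ * dirichlet f
      poincaré f with median f
      ... | m , above , below = m , (begin
        h ² * ∑ (λ x → (f x - m) ²)
          ≤⟨ *-monoˡ (²-nonneg h) (∑-mono λ x → ²≤⊔²+⊔² (f x - m)) ⟩
        h ² * ∑ (λ x → f⁺ x ² + f⁻ x ²)
          ≡⟨ cong (h ² *_) (∑-distrib-+ (λ x → f⁺ x ²) (λ x → f⁻ x ²)) ⟩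
        h ² * (∑ (λ x → f⁺ x ²) + ∑ (λ x → f⁻ x ²))
          ≡⟨ *-distribˡ-+ (h ²) (∑ λ x → f⁺ x ²) (∑ λ x → f⁻ x ²) ⟩
        h ² * ∑ (λ x → f⁺ x ²) + h ² * ∑ (λ x → f⁻ x ²)
          ≤⟨ +-mono-≤ (poincaré-half f⁺ (λ x → p≤p⊔q 0ℚ (f x - m)) (half-mono f⁺⊆above above))
                      (poincaré-half f⁻ (λ x → p≤p⊔q 0ℚ (- (f x - m))) (half-mono f⁻⊆below below)) ⟩
        8ℚ * dirichlet f⁺ + 8ℚ * dirichlet f⁻
          ≤⟨ +-mono-≤ (*-monoˡ 0≤8
              (contraction f⁺ λ x y → ≤-trans (⊔-lipschitz (f x - m) (f y - m))
                (≤-reflexive (shift⁺ (f x) (f y) m))))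
                      (*-monoˡ 0≤8 (contraction f⁻ λ x y → ≤-trans
                        (⊔-lipschitz (- (f x - m)) (- (f y - m))) (≤-reflexive (shift⁻ (f x) (f y) m)))) ⟩
        8ℚ * dirichlet f + 8ℚ * dirichlet f          ≡⟨ double (dirichlet f) ⟩
        16ℚ * dirichlet f                            ∎)
        where
        open ≤-Reasoning

        f⁺ f⁻ : Fin n → ℚ
        f⁺ x = 0ℚ ⊔ (f x - m)
        f⁻ x = 0ℚ ⊔ (- (f x - m))

        0≤8 : 0ℚ ≤ 8ℚ
        0≤8 = <⇒≤ (positive⁻¹ 8ℚ)

        double : ∀ d → 8ℚ * d + 8ℚ * d ≡ 16ℚ * d
        double = solve-∀ ℚ-ring

        contraction : ∀ g → (∀ x y → (g x - g y) ² ≤ (f x - f y) ²) → dirichlet g ≤ dirichlet f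
        contraction g lip = ∑₂-mono λ x y → *-monoˡ (ind-nonneg (adj x y)) (lip x y)

        shift⁺ : ∀ p q m → ((p - m) - (q - m)) * ((p - m) - (q - m)) ≡ (p - q) * (p - q)
        shift⁺ = solve-∀ ℚ-ring

        shift⁻ : ∀ p q m → (- (p - m) - - (q - m)) * (- (p - m) - - (q - m)) ≡ (p - q) * (p - q)
        shift⁻ = solve-∀ ℚ-ring

        ⊔-pos : ∀ p → 0ℚ < 0ℚ ⊔ p → 0ℚ < p
        ⊔-pos p lt = ≰⇒> λ p≤0 → <-irrefl refl (subst (0ℚ <_) (p≥q⇒p⊔q≡p p≤0) lt)

        f⁺⊆above : ∀ x → positive? f⁺ x ≡ true → ⌊ m <? f x ⌋ ≡ true
        f⁺⊆above x px = ⌊⌋-true (<-by-difference _ (⊔-pos (f x - m) (true-⌊⌋ px)) (identity m (f x)))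
          where
          identity : ∀ m u → m + (u - m) ≡ u
          identity = solve-∀ ℚ-ring

        f⁻⊆below : ∀ x → positive? f⁻ x ≡ true → ⌊ f x <? m ⌋ ≡ true
        f⁻⊆below x px =
          ⌊⌋-true (<-by-difference _ (⊔-pos (- (f x - m)) (true-⌊⌋ px)) (identity m (f x)))
          where
          identity : ∀ m u → u + - (u - m) ≡ m
          identity = solve-∀ ℚ-ring

-- Sign comparison and truncation

module SignedFunctions where

  open import Data.Integer.Base using (+_)
  open import Data.Rational.Base hiding (ℚ; floor; _≃_)
  open import Data.Rational.Properties
  open RationalSums
  open VertexExpansion

  xor≡false⇒≡ : ∀ a b → a xor b ≡ false → a ≡ b
  xor≡false⇒≡ true  true  _ = refl
  xor≡false⇒≡ false false _ = refl

  xor-telescope : ∀ a b c → a xor c ≡ (a xor b) xor (b xor c)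
  xor-telescope true  true  true  = refl
  xor-telescope true  true  false = refl
  xor-telescope true  false true  = refl
  xor-telescope true  false false = refl
  xor-telescope false true  true  = refl
  xor-telescope false true  false = refl
  xor-telescope false false true  = refl
  xor-telescope false false false = refl

  xor-cancelʳ : ∀ a b → b ≡ a xor b → a ≡ false
  xor-cancelʳ false b     _ = refl
  xor-cancelʳ true  true  ()
  xor-cancelʳ true  false ()

  xor-cancelˡ : ∀ a b → a ≡ a xor b → b ≡ false
  xor-cancelˡ false b     eq = sym eq
  xor-cancelˡ true  false _ = refl
  xor-cancelˡ true  true  ()

  not-xor≡false⇒≢ : ∀ a b → not (a xor b) ≡ false → a ≢ b
  not-xor≡false⇒≢ true  false _ ()
  not-xor≡false⇒≢ false true  _ ()

  xor-same : ∀ a b c → a xor b ≡ a xor c → b ≡ c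
  xor-same false b c eq = eq
  xor-same true true  true  _ = refl
  xor-same true false false _ = refl
  xor-same true true  false ()
  xor-same true false true  ()

  negative? : ℚ → Bool
  negative? p = ⌊ p <? 0ℚ ⌋

  signed : ∀ p → (negative? p ≡ false × p ≡ ∣ p ∣) ⊎ (negative? p ≡ true × p ≡ - ∣ p ∣)
  signed p with p <? 0ℚ
  ... | no  p≮0 = inj₁ (refl , sym (0≤p⇒∣p∣≡p (≮⇒≥ p≮0)))
  ... | yes p<0 = inj₂ (refl , trans (sym (double-neg p))
          (cong -_ (trans (sym (0≤p⇒∣p∣≡p (neg-antimono-≤ (<⇒≤ p<0)))) (∣-p∣≡∣p∣ p))))
    where
    double-neg : ∀ p → - - p ≡ p
    double-neg = solve-∀ ℚ-ring

  0≤2 : 0ℚ ≤ 2ℚ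
  0≤2 = <⇒≤ (positive⁻¹ 2ℚ)

  0≤4 : 0ℚ ≤ 4ℚ
  0≤4 = <⇒≤ (positive⁻¹ 4ℚ)

  0≤16 : 0ℚ ≤ 16ℚ
  0≤16 = <⇒≤ (positive⁻¹ 16ℚ)

  small : ∀ p → p ≤ ½ → 1ℚ ≤ 4ℚ * (1ℚ - p) ²
  small p p≤½ = *-monoˡ {p = ½ ²} 0≤4 (²-mono (<⇒≤ (positive⁻¹ ½)) (+-monoʳ-≤ 1ℚ (neg-antimono-≤ p≤½)))

  -- If a b and m have different signs, then either one of ∣a∣, ∣b∣ is at most ½, and its term is at
  -- least 4 · ¼ = 1, or ∣a b∣ ≥ ¼ with m on the other side of 0, and 16 (a b - m)² ≥ 1.
  xor-sign-bound : ∀ a b m → ind ((negative? a xor negative? b) xor negative? m) ≤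
                   4ℚ * (1ℚ - ∣ a ∣) ² + 4ℚ * (1ℚ - ∣ b ∣) ² + 16ℚ * (a * b - m) ²
  xor-sign-bound a b m with ≤-total ∣ a ∣ ½ | ≤-total ∣ b ∣ ½
  ... | inj₁ a≤½ | _ = ≤-trans (ind≤1 ((negative? a xor negative? b) xor negative? m))
        (≤-trans (small (∣ a ∣) a≤½) (≤-trans (≤-+ʳ (*-nonneg 0≤4 (²-nonneg (1ℚ - ∣ b ∣))))
          (≤-+ʳ (*-nonneg 0≤16 (²-nonneg (a * b - m))))))
  ... | inj₂ _ | inj₁ b≤½ = ≤-trans (ind≤1 ((negative? a xor negative? b) xor negative? m))
        (≤-trans (small (∣ b ∣) b≤½) (≤-trans (≤-+ˡ (*-nonneg 0≤4 (²-nonneg (1ℚ - ∣ a ∣))))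
          (≤-+ʳ (*-nonneg 0≤16 (²-nonneg (a * b - m))))))
  ... | inj₂ ½≤a | inj₂ ½≤b = ≤-trans (cases (signed a) (signed b) (signed m))
        (≤-+ˡ (+-nonneg (*-nonneg 0≤4 (²-nonneg (1ℚ - ∣ a ∣))) (*-nonneg 0≤4 (²-nonneg (1ℚ - ∣ b ∣)))))
    where
    goal : Bool → Bool → Bool → Set
    goal x y z = ind ((x xor y) xor z) ≤ 16ℚ * (a * b - m) ²

    apart : ℚ
    apart = ∣ a ∣ * ∣ b ∣ + ∣ m ∣

    separated : ∀ p → p ² ≡ apart ² → 1ℚ ≤ 16ℚ * p ²
    separated p eq = ≤-trans (*-monoˡ {p = (½ * ½) ²} 0≤16 (²-mono (<⇒≤ (positive⁻¹ (½ * ½)))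
        (+-mono-≤ {x = ½ * ½} {u = 0ℚ} (*-mono (<⇒≤ (positive⁻¹ ½)) (0≤∣p∣ a) ½≤a ½≤b) (0≤∣p∣ m))))
      (≤-reflexive (cong (16ℚ *_) (sym eq)))

    matched : 0ℚ ≤ 16ℚ * (a * b - m) ²
    matched = *-nonneg 0≤16 (²-nonneg (a * b - m))

    square₁ : ∀ p q r → (p * q - - r) * (p * q - - r) ≡ (p * q + r) * (p * q + r)
    square₁ = solve-∀ ℚ-ring
    square₂ : ∀ p q r → (- p * - q - - r) * (- p * - q - - r) ≡ (p * q + r) * (p * q + r)
    square₂ = solve-∀ ℚ-ring
    square₃ : ∀ p q r → (p * - q - r) * (p * - q - r) ≡ (p * q + r) * (p * q + r)
    square₃ = solve-∀ ℚ-ring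
    square₄ : ∀ p q r → (- p * q - r) * (- p * q - r) ≡ (p * q + r) * (p * q + r)
    square₄ = solve-∀ ℚ-ring

    value : ∀ {p q r} → a ≡ p → b ≡ q → m ≡ r → (a * b - m) ² ≡ (p * q - r) ²
    value a≡ b≡ m≡ = cong _² (cong₂ _-_ (cong₂ _*_ a≡ b≡) m≡)

    cases : (negative? a ≡ false × a ≡ ∣ a ∣) ⊎ (negative? a ≡ true × a ≡ - ∣ a ∣) →
            (negative? b ≡ false × b ≡ ∣ b ∣) ⊎ (negative? b ≡ true × b ≡ - ∣ b ∣) →
            (negative? m ≡ false × m ≡ ∣ m ∣) ⊎ (negative? m ≡ true × m ≡ - ∣ m ∣) →
            goal (negative? a) (negative? b) (negative? m)
    cases (inj₁ (s , a≡)) (inj₁ (t , b≡)) (inj₁ (u , m≡)) rewrite s | t | u = matched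
    cases (inj₁ (s , a≡)) (inj₂ (t , b≡)) (inj₂ (u , m≡)) rewrite s | t | u = matched
    cases (inj₂ (s , a≡)) (inj₁ (t , b≡)) (inj₂ (u , m≡)) rewrite s | t | u = matched
    cases (inj₂ (s , a≡)) (inj₂ (t , b≡)) (inj₁ (u , m≡)) rewrite s | t | u = matched
    cases (inj₁ (s , a≡)) (inj₁ (t , b≡)) (inj₂ (u , m≡)) rewrite s | t | u =
      separated (a * b - m) (trans (value a≡ b≡ m≡) (square₁ (∣ a ∣) (∣ b ∣) (∣ m ∣)))
    cases (inj₁ (s , a≡)) (inj₂ (t , b≡)) (inj₁ (u , m≡)) rewrite s | t | u =
      separated (a * b - m) (trans (value a≡ b≡ m≡) (square₃ (∣ a ∣) (∣ b ∣) (∣ m ∣)))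
    cases (inj₂ (s , a≡)) (inj₁ (t , b≡)) (inj₁ (u , m≡)) rewrite s | t | u =
      separated (a * b - m) (trans (value a≡ b≡ m≡) (square₄ (∣ a ∣) (∣ b ∣) (∣ m ∣)))
    cases (inj₂ (s , a≡)) (inj₂ (t , b≡)) (inj₂ (u , m≡)) rewrite s | t | u =
      separated (a * b - m) (trans (value a≡ b≡ m≡) (square₂ (∣ a ∣) (∣ b ∣) (∣ m ∣)))

  -- For equal signs ∣a + b∣ = ∣a∣ + ∣b∣, so either ∣a∣ ≤ ½ or ∣a + b∣ ≥ ½.
  same-sign-bound : ∀ a b → ind (not (negative? a xor negative? b)) ≤
                    4ℚ * (1ℚ - ∣ a ∣) ² + 4ℚ * (b + a) ²
  same-sign-bound a b with ≤-total ∣ a ∣ ½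
  ... | inj₁ a≤½ = ≤-trans (ind≤1 (not (negative? a xor negative? b)))
        (≤-trans (small (∣ a ∣) a≤½) (≤-+ʳ (*-nonneg 0≤4 (²-nonneg (b + a)))))
  ... | inj₂ ½≤a = ≤-trans (cases (signed a) (signed b))
        (≤-+ˡ (*-nonneg 0≤4 (²-nonneg (1ℚ - ∣ a ∣))))
    where
    different : 0ℚ ≤ 4ℚ * (b + a) ²
    different = *-nonneg 0≤4 (²-nonneg (b + a))

    separated : (b + a) ² ≡ (∣ b ∣ + ∣ a ∣) ² → 1ℚ ≤ 4ℚ * (b + a) ²
    separated eq = ≤-trans (*-monoˡ {p = ½ ²} 0≤4 (²-mono (<⇒≤ (positive⁻¹ ½))
        (+-mono-≤ {x = 0ℚ} {u = ½} (0≤∣p∣ b) ½≤a)))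
      (≤-reflexive (cong (4ℚ *_) (sym eq)))

    square : ∀ p q → (- p + - q) * (- p + - q) ≡ (p + q) * (p + q)
    square = solve-∀ ℚ-ring

    cases : (negative? a ≡ false × a ≡ ∣ a ∣) ⊎ (negative? a ≡ true × a ≡ - ∣ a ∣) →
            (negative? b ≡ false × b ≡ ∣ b ∣) ⊎ (negative? b ≡ true × b ≡ - ∣ b ∣) →
            ind (not (negative? a xor negative? b)) ≤ 4ℚ * (b + a) ²
    cases (inj₁ (s , a≡)) (inj₂ (t , b≡)) rewrite s | t = different
    cases (inj₂ (s , a≡)) (inj₁ (t , b≡)) rewrite s | t = different
    cases (inj₁ (s , a≡)) (inj₁ (t , b≡)) rewrite s | t = separated (cong _² (cong₂ _+_ b≡ a≡))
    cases (inj₂ (s , a≡)) (inj₂ (t , b≡)) rewrite s | t =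
      separated (trans (cong _² (cong₂ _+_ b≡ a≡)) (square (∣ b ∣) (∣ a ∣)))

  -- Truncation to [-1, 1], composed of two positive parts and reflections so that `⊔-lipschitz`
  -- makes it a contraction.
  clamp : ℚ → ℚ
  clamp p = 1ℚ - (0ℚ ⊔ (2ℚ - (0ℚ ⊔ (p + 1ℚ))))

  clamp-low : ∀ {p} → p ≤ - 1ℚ → clamp p ≡ - 1ℚ
  clamp-low p≤-1 = cong (λ u → 1ℚ - (0ℚ ⊔ (2ℚ - u))) (p≥q⇒p⊔q≡p (+-monoˡ-≤ 1ℚ p≤-1))

  clamp-mid : ∀ {p} → - 1ℚ ≤ p → p ≤ 1ℚ → clamp p ≡ p
  clamp-mid {p} -1≤p p≤1 = trans
    (cong (λ u → 1ℚ - (0ℚ ⊔ (2ℚ - u))) (p≤q⇒p⊔q≡q (+-monoˡ-≤ 1ℚ -1≤p)))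
    (trans (cong (λ u → 1ℚ - u) (p≤q⇒p⊔q≡q (subst (0ℚ ≤_) (shift p) (p≤q⇒0≤q-p p≤1)))) (identity p))
    where
    shift : ∀ p → 1ℚ - p ≡ 2ℚ - (p + 1ℚ)
    shift = solve-∀ ℚ-ring
    identity : ∀ p → 1ℚ - (2ℚ - (p + 1ℚ)) ≡ p
    identity = solve-∀ ℚ-ring

  clamp-high : ∀ {p} → 1ℚ ≤ p → clamp p ≡ 1ℚ
  clamp-high {p} 1≤p = trans
    (cong (λ u → 1ℚ - (0ℚ ⊔ (2ℚ - u))) (p≤q⇒p⊔q≡q (≤-trans 0≤2 (+-monoˡ-≤ 1ℚ 1≤p))))
    (cong (λ u → 1ℚ - u) (p≥q⇒p⊔q≡p (subst (_≤ 0ℚ) (shift p) (neg-antimono-≤ (p≤q⇒0≤q-p 1≤p)))))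
    where
    shift : ∀ p → - (p - 1ℚ) ≡ 2ℚ - (p + 1ℚ)
    shift = solve-∀ ℚ-ring

  data Clamped (p : ℚ) : Set where
    low  : p ≤ - 1ℚ → Clamped p
    mid  : - 1ℚ ≤ p → p ≤ 1ℚ → Clamped p
    high : 1ℚ ≤ p → Clamped p

  clamped : ∀ p → Clamped p
  clamped p with ≤-total p (- 1ℚ) | ≤-total p 1ℚ
  ... | inj₁ p≤-1 | _        = low p≤-1
  ... | inj₂ -1≤p | inj₁ p≤1 = mid -1≤p p≤1
  ... | inj₂ _    | inj₂ 1≤p = high 1≤p

  clamp-odd : ∀ p → clamp (- p) ≡ - clamp p
  clamp-odd p with clamped p
  ... | low p≤-1 = trans (clamp-high (neg-antimono-≤ p≤-1)) (cong -_ (sym (clamp-low p≤-1)))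
  ... | mid -1≤p p≤1 =
    trans (clamp-mid (neg-antimono-≤ p≤1) (neg-antimono-≤ -1≤p)) (cong -_ (sym (clamp-mid -1≤p p≤1)))
  ... | high 1≤p = trans (clamp-low (neg-antimono-≤ 1≤p)) (cong -_ (sym (clamp-high 1≤p)))

  clamp-²≤1 : ∀ p → clamp p ² ≤ 1ℚ
  clamp-²≤1 p with clamped p
  ... | low p≤-1 = ≤-reflexive (cong _² (clamp-low p≤-1))
  ... | high 1≤p = ≤-reflexive (cong _² (clamp-high 1≤p))
  ... | mid -1≤p p≤1 = subst (λ u → u ² ≤ 1ℚ) (sym (clamp-mid -1≤p p≤1))
    (≤-by-difference _ (*-nonneg (p≤q⇒0≤q-p p≤1) (p≤q⇒0≤q-p -1≤p)) (identity p))
    where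
    identity : ∀ p → p * p + (1ℚ - p) * (p - - 1ℚ) ≡ 1ℚ
    identity = solve-∀ ℚ-ring

  -- Truncation only acts where ∣p∣ ≥ 1, and there the defect becomes 0.
  clamp-defect : ∀ p → (1ℚ - ∣ clamp p ∣) ² ≤ (1ℚ - ∣ p ∣) ²
  clamp-defect p with clamped p
  ... | low p≤-1 = subst (_≤ (1ℚ - ∣ p ∣) ²)
    (cong (λ u → (1ℚ - ∣ u ∣) ²) (sym (clamp-low p≤-1))) (²-nonneg (1ℚ - ∣ p ∣))
  ... | high 1≤p = subst (_≤ (1ℚ - ∣ p ∣) ²)
    (cong (λ u → (1ℚ - ∣ u ∣) ²) (sym (clamp-high 1≤p))) (²-nonneg (1ℚ - ∣ p ∣))
  ... | mid -1≤p p≤1 = ≤-reflexive (cong (λ u → (1ℚ - ∣ u ∣) ²) (clamp-mid -1≤p p≤1))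

  clamp-lipschitz : ∀ p q → (clamp p - clamp q) ² ≤ (p - q) ²
  clamp-lipschitz p q = begin
    (clamp p - clamp q) ²    ≡⟨ reflect₁ (top p) (top q) ⟩
    (top p - top q) ²        ≤⟨ ⊔-lipschitz (2ℚ - bottom p) (2ℚ - bottom q) ⟩
    ((2ℚ - bottom p) - (2ℚ - bottom q)) ²  ≡⟨ reflect₂ (bottom p) (bottom q) ⟩
    (bottom p - bottom q) ²  ≤⟨ ⊔-lipschitz (p + 1ℚ) (q + 1ℚ) ⟩
    ((p + 1ℚ) - (q + 1ℚ)) ²  ≡⟨ shift p q ⟩
    (p - q) ²                ∎
    where
    open ≤-Reasoning
    bottom top : ℚ → ℚ
    bottom p = 0ℚ ⊔ (p + 1ℚ)
    top p = 0ℚ ⊔ (2ℚ - bottom p)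
    reflect₁ : ∀ u v → ((1ℚ - u) - (1ℚ - v)) * ((1ℚ - u) - (1ℚ - v)) ≡ (u - v) * (u - v)
    reflect₁ = solve-∀ ℚ-ring
    reflect₂ : ∀ u v → ((2ℚ - u) - (2ℚ - v)) * ((2ℚ - u) - (2ℚ - v)) ≡ (u - v) * (u - v)
    reflect₂ = solve-∀ ℚ-ring
    shift : ∀ u v → ((u + 1ℚ) - (v + 1ℚ)) * ((u + 1ℚ) - (v + 1ℚ)) ≡ (u - v) * (u - v)
    shift = solve-∀ ℚ-ring

  -- By oddness the sum is the difference of the values at p and -q, so the Lipschitz bound applies.
  clamp-sum : ∀ p q → (clamp p + clamp q) ² ≤ (p + q) ²
  clamp-sum p q = subst₂ _≤_
    (trans (cong (λ u → (clamp p - u) ²) (clamp-odd q)) (double-neg (clamp p) (clamp q)))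
    (double-neg p q)
    (clamp-lipschitz p (- q))
    where
    double-neg : ∀ p q → (p - - q) * (p - - q) ≡ (p + q) * (p + q)
    double-neg = solve-∀ ℚ-ring

  avoid : ∀ {n} (p q r : Fin n → Bool) → # p + # q + # r < size n →
          ∃[ x ] (p x ≡ false × q x ≡ false × r x ≡ false)
  avoid {n} p q r lt with ∑<∑⇒∃< {n} {λ x → ind (p x) + ind (q x) + ind (r x)} {const 1ℚ} (subst (_< size n)
      (sym (trans (∑-distrib-+ (λ x → ind (p x) + ind (q x)) (ind ∘ r))
        (cong (_+ # r) (∑-distrib-+ (ind ∘ p) (ind ∘ q))))) lt)
  ... | x , sum<1 = x , all-false (p x) (q x) (r x) sum<1
    where
    all-false : ∀ a b c → ind a + ind b + ind c < 1ℚ → a ≡ false × b ≡ false × c ≡ false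
    all-false false false false _ = refl , refl , refl
    all-false true b c lt = contradiction lt λ lt′ → <-irrefl refl (<-≤-trans lt′
      (≤-trans (≤-+ʳ (ind-nonneg b)) (≤-+ʳ (ind-nonneg c))))
    all-false false true c lt =
      contradiction lt λ lt′ → <-irrefl refl (<-≤-trans lt′ (≤-+ʳ (ind-nonneg c)))
    all-false false false true lt = contradiction lt (<-irrefl refl)

  ∑-const : ∀ n c → ∑ {n} (const c) ≡ c * size n
  ∑-const n c = trans (∑-cong {n} {const c} {λ _ → c * 1ℚ} λ _ → sym (*-identityʳ c))
    (sym (*-distribˡ-sum {n} c (const 1ℚ)))

  three-rare : ∀ b s → 0ℚ < 1ℚ - 3ℚ * b → 0ℚ < s → b * s + b * s + b * s < s
  three-rare b s 0<1-3b 0<s = <-by-difference ((1ℚ - 3ℚ * b) * s) (*-pos 0<1-3b 0<s) (identity b s)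
    where
    identity : ∀ b s → (b * s + b * s + b * s) + (1ℚ - 3ℚ * b) * s ≡ s
    identity = solve-∀ ℚ-ring

  rare-pairs : ∀ b c s → 0ℚ < 1ℚ - (2ℚ * b + c) → 0ℚ < s →
               (b * s) * s + (b * s) * s + (c * s) * s < s * s
  rare-pairs b c s 0<slack 0<s = <-by-difference ((1ℚ - (2ℚ * b + c)) * (s * s))
    (*-pos 0<slack (*-pos 0<s 0<s)) (identity b c s)
    where
    identity : ∀ b c s →
      ((b * s) * s + (b * s) * s + (c * s) * s) + (1ℚ - (2ℚ * b + c)) * (s * s) ≡ s * s
    identity = solve-∀ ℚ-ring

  -- Small enough that three sets of bad points cannot cover the group: 3 · 72 ε₁ < 1.
  ε₀ ε₁ : ℚ
  ε₀ = + 1 / 1600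
  ε₁ = 4ℚ * ε₀

  0≤ε₀ : 0ℚ ≤ ε₀
  0≤ε₀ = <⇒≤ (positive⁻¹ ε₀)

  0≤ε₁ : 0ℚ ≤ ε₁
  0≤ε₁ = *-nonneg 0≤4 0≤ε₀

  -- Translations, sign characters and the signless energy of a Cayley graph

  module Cayley {n} {_·_ : Fin n → Fin n → Fin n} {e : Fin n} {_⁻¹ : Fin n → Fin n}
    (isGroup : IsGroup _≡_ _·_ e _⁻¹) (S : Fin n → Bool) where

    open IsGroup isGroup using (assoc; identityˡ; identityʳ; inverseˡ; inverseʳ)

    adj : Fin n → Fin n → Bool
    adj x y = S (x · (y ⁻¹))

    open Expansion adj using (edge; dirichlet)

    signless : (Fin n → ℚ) → ℚ
    signless f = ∑₂ λ x y → edge x y * (f x + f y) ²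

    cancelʳ : ∀ x g → (x · g) · (g ⁻¹) ≡ x
    cancelʳ x g = trans (assoc x g (g ⁻¹)) (trans (cong (x ·_) (inverseʳ g)) (identityʳ x))

    cancelʳ′ : ∀ x g → (x · (g ⁻¹)) · g ≡ x
    cancelʳ′ x g = trans (assoc x (g ⁻¹) g) (trans (cong (x ·_) (inverseˡ g)) (identityʳ x))

    cancelˡ : ∀ x g → (g ⁻¹) · (g · x) ≡ x
    cancelˡ x g = trans (sym (assoc (g ⁻¹) g x)) (trans (cong (_· x) (inverseˡ g)) (identityˡ x))

    cancelˡ′ : ∀ x g → g · ((g ⁻¹) · x) ≡ x
    cancelˡ′ x g = trans (sym (assoc g (g ⁻¹) x)) (trans (cong (_· x) (inverseʳ g)) (identityˡ x))

    ∑-translateʳ : ∀ g (f : Fin n → ℚ) → ∑ (λ x → f (x · g)) ≡ ∑ f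
    ∑-translateʳ g f = sym (sum-permute f (Permutation.permutation (_· g) (_· (g ⁻¹))
      (λ x → cancelʳ′ x g) (λ x → cancelʳ x g)))

    ∑-translateˡ : ∀ g (f : Fin n → ℚ) → ∑ (λ x → f (g · x)) ≡ ∑ f
    ∑-translateˡ g f = sym (sum-permute f (Permutation.permutation (g ·_) ((g ⁻¹) ·_)
      (λ x → cancelˡ′ x g) (λ x → cancelˡ x g)))

    -- Right translations are automorphisms because (x g)(y g)⁻¹ = x y⁻¹.
    adj-translate : ∀ x y g → adj (x · g) (y · g) ≡ adj x y
    adj-translate x y g = cong S (begin
      (x · g) · ((y · g) ⁻¹)
        ≡⟨ cong (λ z → (z · g) · ((y · g) ⁻¹)) (cancelʳ′ x y) ⟨
      (((x · (y ⁻¹)) · y) · g) · ((y · g) ⁻¹)      ≡⟨ cong (_· ((y · g) ⁻¹)) (assoc (x · (y ⁻¹)) y g) ⟩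
      ((x · (y ⁻¹)) · (y · g)) · ((y · g) ⁻¹)      ≡⟨ cancelʳ (x · (y ⁻¹)) (y · g) ⟩
      x · (y ⁻¹)                                   ∎)
      where open ≡-Reasoning

    signless-translate : ∀ g f → signless (λ x → f (x · g)) ≡ signless f
    signless-translate g f = begin
      ∑₂ (λ x y → edge x y * (f (x · g) + f (y · g)) ²)
        ≡⟨ ∑₂-cong (λ x y → cong (λ b → ind b * (f (x · g) + f (y · g)) ²) (sym (adj-translate x y g))) ⟩
      ∑₂ (λ x y → edge (x · g) (y · g) * (f (x · g) + f (y · g)) ²)
        ≡⟨ ∑-cong (λ x → ∑-translateʳ g (λ y → edge (x · g) y * (f (x · g) + f y) ²)) ⟩
      ∑ (λ x → ∑ λ y → edge (x · g) y * (f (x · g) + f y) ²)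
        ≡⟨ ∑-translateʳ g (λ x → ∑ λ y → edge x y * (f x + f y) ²) ⟩
      signless f ∎
      where open ≡-Reasoning

    signless-nonneg : ∀ f → 0ℚ ≤ signless f
    signless-nonneg f = ∑-nonneg λ x → ∑-nonneg λ y →
      *-nonneg (ind-nonneg (adj x y)) (²-nonneg (f x + f y))

    signless-mono : ∀ f g → (∀ x y → (f x + f y) ² ≤ (g x + g y) ²) → signless f ≤ signless g
    signless-mono f g le = ∑₂-mono λ x y → *-monoˡ (ind-nonneg (adj x y)) (le x y)

    -- Since (s z) z⁻¹ = s, the points s z and z are adjacent; the left side keeps one edge at each
    -- z.
    left-shift-bound : ∀ s f → S s ≡ true → ∑ (λ z → (f (s · z) + f z) ²) ≤ signless f
    left-shift-bound s f s∈S = begin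
      ∑ (λ z → (f (s · z) + f z) ²)
        ≤⟨ ∑-mono (λ z → subst (_≤ ∑ λ x → edge x z * (f x + f z) ²)
          (trans (cong (λ b → ind b * (f (s · z) + f z) ²) (trans (cong S (cancelʳ s z)) s∈S))
            (*-identityˡ _))
          (term≤∑ (λ x → *-nonneg (ind-nonneg (adj x z)) (²-nonneg (f x + f z))) (s · z))) ⟩
      ∑₂ (λ z x → edge x z * (f x + f z) ²)              ≡⟨ ∑-comm (λ z x → edge x z * (f x + f z) ²) ⟩
      signless f                                         ∎
      where open ≤-Reasoning

    module _ (κ : ℚ) (0≤κ : 0ℚ ≤ κ) (κ≤1 : κ ≤ 1ℚ)
      (poincaré : ∀ f → ∃[ m ] κ * ∑ (λ x → (f x - m) ²) ≤ dirichlet f) where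

      -- Both bounds are proportional to the number of points; the extra κ in `energy` is what the
      -- Poincaré inequality divides out.
      module NearlySigned (F : Fin n → ℚ) (0<κ : 0ℚ < κ) (F²≤1 : ∀ x → F x ² ≤ 1ℚ)
        (defect : ∑ (λ x → (1ℚ - ∣ F x ∣) ²) ≤ ε₁ * size n)
        (energy : signless F ≤ ε₁ * κ * size n) where

        product : Fin n → Fin n → ℚ
        product g x = F x * F (x · g)

        -- The sign changes of the two factors along an edge cancel, so a small signless energy of F
        -- becomes a small Dirichlet energy of the product, to which the Poincaré inequality
        -- applies. By translation invariance both factors have the same signless energy.
        product-energy : ∀ g → dirichlet (product g) ≤ 4ℚ * signless F
        product-energy g = begin
          dirichlet (product g)
            ≤⟨ ∑₂-mono (λ x y → pointwise (edge x y) (ind-nonneg (adj x y)) (F x) (F (x · g)) (F y)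
                (F (y · g)) (F²≤1 x) (F²≤1 (y · g))) ⟩
          ∑₂ (λ x y → 2ℚ * (edge x y * (F (x · g) + F (y · g)) ²) + 2ℚ * (edge x y * (F x + F y) ²))
            ≡⟨ ∑₂-linear 2ℚ 2ℚ (λ x y → edge x y * (F (x · g) + F (y · g)) ²)
                (λ x y → edge x y * (F x + F y) ²) ⟩
          2ℚ * signless (λ x → F (x · g)) + 2ℚ * signless F
            ≡⟨ cong (λ s → 2ℚ * s + 2ℚ * signless F) (signless-translate g F) ⟩
          2ℚ * signless F + 2ℚ * signless F   ≡⟨ double (signless F) ⟩
          4ℚ * signless F                     ∎
          where
          open ≤-Reasoning
          double : ∀ s → 2ℚ * s + 2ℚ * s ≡ 4ℚ * s
          double = solve-∀ ℚ-ring
          -- aa′ - bb′ = a (a′ + b′) - b′ (a + b).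
          pointwise : ∀ w → 0ℚ ≤ w → ∀ a a′ b b′ → a ² ≤ 1ℚ → b′ ² ≤ 1ℚ →
            w * (a * a′ - b * b′) ² ≤ 2ℚ * (w * (a′ + b′) ²) + 2ℚ * (w * (a + b) ²)
          pointwise w 0≤w a a′ b b′ a≤ b≤ = ≤-by-difference _
            (*-nonneg 0≤w (+-nonneg (*-nonneg 0≤2 (+-nonneg
               (*-nonneg (p≤q⇒0≤q-p a≤) (²-nonneg (a′ + b′)))
               (*-nonneg (p≤q⇒0≤q-p b≤) (²-nonneg (a + b)))))
               (²-nonneg (a * (a′ + b′) + b′ * (a + b)))))
            (identity w a a′ b b′)
            where
            identity : ∀ w a a′ b b′ → w * ((a * a′ - b * b′) * (a * a′ - b * b′)) +
              w * (2ℚ * ((1ℚ - a * a) * ((a′ + b′) * (a′ + b′)) + (1ℚ - b′ * b′) * ((a + b) * (a + b))) +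
                (a * (a′ + b′) + b′ * (a + b)) * (a * (a′ + b′) + b′ * (a + b))) ≡
              2ℚ * (w * ((a′ + b′) * (a′ + b′))) + 2ℚ * (w * ((a + b) * (a + b)))
            identity = solve-∀ ℚ-ring

        centre : Fin n → ℚ
        centre g = proj₁ (poincaré (product g))

        concentrated : ∀ g → ∑ (λ x → (product g x - centre g) ²) ≤ 4ℚ * ε₁ * size n
        concentrated g = *-cancelˡ 0<κ (begin
          κ * ∑ (λ x → (product g x - centre g) ²)  ≤⟨ proj₂ (poincaré (product g)) ⟩
          dirichlet (product g)                     ≤⟨ product-energy g ⟩
          4ℚ * signless F                           ≤⟨ *-monoˡ 0≤4 energy ⟩
          4ℚ * (ε₁ * κ * size n)                    ≡⟨ rearrange ε₁ κ (size n) ⟩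
          κ * (4ℚ * ε₁ * size n)                    ∎)
          where
          open ≤-Reasoning
          rearrange : ∀ c k s → 4ℚ * (c * k * s) ≡ k * (4ℚ * c * s)
          rearrange = solve-∀ ℚ-ring

        -- `true` stands for -1, so that `xor` is multiplication of signs.
        σ χ : Fin n → Bool
        σ x = negative? (F x)
        χ g = negative? (centre g)

        bad : Fin n → Fin n → Bool
        bad g x = (σ x xor σ (x · g)) xor χ g

        good⇒ : ∀ {g x} → bad g x ≡ false → σ x xor σ (x · g) ≡ χ g
        good⇒ {g} {x} = xor≡false⇒≡ (σ x xor σ (x · g)) (χ g)

        same : Fin n → Fin n → Bool
        same s z = not (σ z xor σ (s · z))

        -- 72 = 4 + 4 + 16 · 4 comes from the coefficients of `xor-sign-bound` and the 4 in
        -- `concentrated`; 8 = 4 + 4 comes from `same-sign-bound` together with κ ≤ 1.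
        β γ : ℚ
        β = 72ℚ * ε₁
        γ = 8ℚ * ε₁

        bad-rare : ∀ g → # (bad g) ≤ β * size n
        bad-rare g = begin
          # (bad g)
            ≤⟨ ∑-mono (λ x → xor-sign-bound (F x) (F (x · g)) (centre g)) ⟩
          ∑ (λ x → 4ℚ * d x + 4ℚ * d (x · g) + 16ℚ * (product g x - centre g) ²)
            ≡⟨ ∑-linear₃ 4ℚ 4ℚ 16ℚ d (λ x → d (x · g)) (λ x → (product g x - centre g) ²) ⟩
          4ℚ * ∑ d + 4ℚ * ∑ (λ x → d (x · g)) + 16ℚ * ∑ (λ x → (product g x - centre g) ²)
            ≡⟨ cong (λ s → 4ℚ * ∑ d + 4ℚ * s + 16ℚ * ∑ (λ x → (product g x - centre g) ²))
                (∑-translateʳ g d) ⟩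
          4ℚ * ∑ d + 4ℚ * ∑ d + 16ℚ * ∑ (λ x → (product g x - centre g) ²)
            ≤⟨ +-mono-≤ (+-mono-≤ (*-monoˡ 0≤4 defect) (*-monoˡ 0≤4 defect))
                (*-monoˡ 0≤16 (concentrated g)) ⟩
          4ℚ * (ε₁ * size n) + 4ℚ * (ε₁ * size n) + 16ℚ * (4ℚ * ε₁ * size n)
            ≡⟨ total ε₁ (size n) ⟩
          β * size n ∎
          where
          open ≤-Reasoning
          d : Fin n → ℚ
          d x = (1ℚ - ∣ F x ∣) ²
          total : ∀ c s → 4ℚ * (c * s) + 4ℚ * (c * s) + 16ℚ * (4ℚ * c * s) ≡ 72ℚ * c * s
          total = solve-∀ ℚ-ring

        same-rare : ∀ s → S s ≡ true → # (same s) ≤ γ * size n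
        same-rare s s∈S = begin
          # (same s)                           ≤⟨ ∑-mono (λ z → same-sign-bound (F z) (F (s · z))) ⟩
          ∑ (λ z → 4ℚ * (1ℚ - ∣ F z ∣) ² + 4ℚ * (F (s · z) + F z) ²)
            ≡⟨ ∑-linear 4ℚ 4ℚ (λ z → (1ℚ - ∣ F z ∣) ²) (λ z → (F (s · z) + F z) ²) ⟩
          4ℚ * ∑ (λ z → (1ℚ - ∣ F z ∣) ²) + 4ℚ * ∑ (λ z → (F (s · z) + F z) ²)
            ≤⟨ +-mono-≤ (*-monoˡ 0≤4 defect) (*-monoˡ 0≤4 (≤-trans (left-shift-bound s F s∈S) energy)) ⟩
          4ℚ * (ε₁ * size n) + 4ℚ * (ε₁ * κ * size n)
            ≤⟨ ≤-by-difference _ (*-nonneg (*-nonneg 0≤4 0≤ε₁) (*-nonneg (p≤q⇒0≤q-p κ≤1) 0≤size))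
                (total ε₁ κ (size n)) ⟩
          γ * size n ∎
          where
          open ≤-Reasoning
          0≤size : 0ℚ ≤ size n
          0≤size = ∑-nonneg {n} λ _ → ind-nonneg true
          total : ∀ c k s → (4ℚ * (c * s) + 4ℚ * (c * k * s)) + (4ℚ * c) * ((1ℚ - k) * s) ≡ 8ℚ * c * s
          total = solve-∀ ℚ-ring

        0<size : Fin n → 0ℚ < size n
        0<size x = <-≤-trans (positive⁻¹ 1ℚ) (term≤∑ {f = const 1ℚ} (λ _ → ind-nonneg true) x)

        -- Some x is good for g and for g k while x g is good for k. At this x the signs telescope
        -- along x, x g, x g k; one point suffices because χ does not depend on x.
        χ-hom : ∀ g k → χ (g · k) ≡ χ g xor χ k
        χ-hom g k = at good
          where
          rare : # (bad g) + # (λ x → bad k (x · g)) + # (bad (g · k)) < size n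
          rare = begin-strict
            # (bad g) + # (λ x → bad k (x · g)) + # (bad (g · k))
              ≡⟨ cong (λ s → # (bad g) + s + # (bad (g · k))) (∑-translateʳ g (ind ∘ bad k)) ⟩
            # (bad g) + # (bad k) + # (bad (g · k))
              ≤⟨ +-mono-≤ (+-mono-≤ (bad-rare g) (bad-rare k)) (bad-rare (g · k)) ⟩
            β * size n + β * size n + β * size n
              <⟨ three-rare β (size n) (positive⁻¹ (1ℚ - 3ℚ * β)) (0<size g) ⟩
            size n ∎
            where open ≤-Reasoning

          good : ∃[ x ] (bad g x ≡ false × bad k (x · g) ≡ false × bad (g · k) x ≡ false)
          good = avoid (bad g) (λ x → bad k (x · g)) (bad (g · k)) rare

          open ≡-Reasoning

          at : ∃[ x ] (bad g x ≡ false × bad k (x · g) ≡ false × bad (g · k) x ≡ false) →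
               χ (g · k) ≡ χ g xor χ k
          at (x , p , q , r) = begin
            χ (g · k)                                          ≡⟨ good⇒ r ⟨
            σ x xor σ (x · (g · k))
              ≡⟨ cong (λ y → σ x xor σ y) (assoc x g k) ⟨
            σ x xor σ ((x · g) · k)
              ≡⟨ xor-telescope (σ x) (σ (x · g)) (σ ((x · g) · k)) ⟩
            (σ x xor σ (x · g)) xor (σ (x · g) xor σ ((x · g) · k)) ≡⟨ cong₂ _xor_ (good⇒ p) (good⇒ q) ⟩
            χ g xor χ k                                        ∎

        -- The right multiplier that takes z to s z; it turns a step along an edge into a right
        -- translation, where χ applies.
        conjugate : Fin n → Fin n → Fin n
        conjugate s z = (z ⁻¹) · (s · z)

        -- `bad-rare` needs a fixed multiplier, while z⁻¹ s z g varies with z. For each z, however,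
        -- left multiplication by z⁻¹ s z permutes the g, so over all pairs (z, g) the second kind
        -- of bad event is as rare as the first. Averaging gives a z, and a union bound then gives
        -- g.
        good-pair : ∀ s → S s ≡ true → ∃[ z ] ∃[ g ]
          (bad g z ≡ false × bad (conjugate s z · g) z ≡ false × same s (z · g) ≡ false)
        good-pair s s∈S = proj₁ row , avoid (λ g → bad g (proj₁ row))
            (λ g → bad (conjugate s (proj₁ row) · g) (proj₁ row)) (λ g → same s (proj₁ row · g)) (proj₂ row)
          where
          open ≤-Reasoning

          A B C : Fin n → ℚ
          A z = # λ g → bad g z
          B z = # λ g → bad (conjugate s z · g) z
          C z = # λ g → same s (z · g)

          ∑A≤ : ∑ A ≤ (β * size n) * size n
          ∑A≤ = begin
            ∑ A                         ≡⟨ ∑-comm (λ z g → ind (bad g z)) ⟩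
            ∑ (λ g → # (bad g))         ≤⟨ ∑-mono bad-rare ⟩
            ∑ {n} (const (β * size n))  ≡⟨ ∑-const n (β * size n) ⟩
            (β * size n) * size n       ∎

          ∑C≤ : ∑ C ≤ (γ * size n) * size n
          ∑C≤ = begin
            ∑ C                         ≡⟨ ∑-cong (λ z → ∑-translateˡ z (ind ∘ same s)) ⟩
            ∑ {n} (const (# (same s)))  ≤⟨ ∑-mono {n} (λ _ → same-rare s s∈S) ⟩
            ∑ {n} (const (γ * size n))  ≡⟨ ∑-const n (γ * size n) ⟩
            (γ * size n) * size n ∎

          row : ∃[ z ] A z + B z + C z < size n
          row = ∑<∑⇒∃< {f = λ z → A z + B z + C z} {g = const (size n)} (begin-strict
            ∑ (λ z → A z + B z + C z)
              ≡⟨ trans (∑-distrib-+ (λ z → A z + B z) C) (cong (_+ ∑ C) (∑-distrib-+ A B)) ⟩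
            ∑ A + ∑ B + ∑ C
              ≡⟨ cong (λ t → ∑ A + t + ∑ C)
                  (∑-cong λ z → ∑-translateˡ (conjugate s z) (λ g → ind (bad g z))) ⟩
            ∑ A + ∑ A + ∑ C             ≤⟨ +-mono-≤ (+-mono-≤ ∑A≤ ∑A≤) ∑C≤ ⟩
            (β * size n) * size n + (β * size n) * size n + (γ * size n) * size n
              <⟨ rare-pairs β γ (size n) (positive⁻¹ (1ℚ - (2ℚ * β + γ))) (0<size s) ⟩
            size n * size n             ≡⟨ ∑-const n (size n) ⟨
            ∑ {n} (const (size n))      ∎)

        χ-conjugate : ∀ s z → χ s ≡ false → χ (conjugate s z) ≡ false
        χ-conjugate s z χs = xor-cancelˡ (χ z) (χ (conjugate s z)) (begin
          χ z                            ≡⟨ cong (_xor χ z) χs ⟨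
          χ s xor χ z                    ≡⟨ χ-hom s z ⟨
          χ (s · z)                      ≡⟨ cong χ (cancelˡ′ (s · z) z) ⟨
          χ (z · conjugate s z)          ≡⟨ χ-hom z (conjugate s z) ⟩
          χ z xor χ (conjugate s z)      ∎)
          where open ≡-Reasoning

        -- Equal colours would make χ trivial on s = x y⁻¹ and on its conjugates. At a good pair, z
        -- g and z (z⁻¹ s z) g = s z g then have the same sign relative to z, contrary to the choice
        -- of a pair at which s changes the sign.
        χ-colouring : ∀ x y → adj x y ≡ true → χ x ≢ χ y
        χ-colouring x y x∼y χx≡χy = at (good-pair s x∼y)
          where
          open ≡-Reasoning

          s = x · (y ⁻¹)

          χs≡false : χ s ≡ false
          χs≡false = xor-cancelʳ (χ s) (χ y) (trans (sym χx≡χy)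
            (trans (cong χ (sym (cancelʳ′ x y))) (χ-hom s y)))

          at : ¬ (∃[ z ] ∃[ g ]
            (bad g z ≡ false × bad (conjugate s z · g) z ≡ false × same s (z · g) ≡ false))
          at (z , g , p , q , r) = not-xor≡false⇒≢ (σ (z · g)) (σ (s · (z · g))) r
            (xor-same (σ z) (σ (z · g)) (σ (s · (z · g))) (begin
              σ z xor σ (z · g)                      ≡⟨ good⇒ p ⟩
              χ g                                    ≡⟨ cong (_xor χ g) (χ-conjugate s z χs≡false) ⟨
              χ (conjugate s z) xor χ g              ≡⟨ χ-hom (conjugate s z) g ⟨
              χ (conjugate s z · g)                  ≡⟨ good⇒ q ⟨
              σ z xor σ (z · (conjugate s z · g))
                ≡⟨ cong (λ u → σ z xor σ u) (assoc z (conjugate s z) g) ⟨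
              σ z xor σ ((z · conjugate s z) · g)
                ≡⟨ cong (λ u → σ z xor σ (u · g)) (cancelˡ′ (s · z) z) ⟩
              σ z xor σ ((s · z) · g)                ≡⟨ cong (λ u → σ z xor σ u) (assoc s z g) ⟩
              σ z xor σ (s · (z · g))                ∎))

      signless-bound : ¬ (∃[ colour ] ∀ x y → adj x y ≡ true → colour x ≢ (Bool ∋ colour y)) →
                       ∀ f → ε₀ * κ * ∑ (λ x → f x ²) ≤ signless f
      signless-bound nonBipartite f = ≮⇒≥ violated⇒⊥
        where
        N = size n
        Q = ∑ λ x → f x ²
        E = signless f
        μ = ∣ proj₁ (poincaré (∣_∣ ∘ f)) ∣
        V = ∑ λ x → (∣ f x ∣ - μ) ²

        0≤E : 0ℚ ≤ E
        0≤E = signless-nonneg f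

        0≤Q : 0ℚ ≤ Q
        0≤Q = ∑-nonneg λ x → ²-nonneg (f x)

        -- The two sides differ by 2 (p q + ∣p∣ ∣q∣) ≥ 0.
        abs-difference : ∀ p q → (∣ p ∣ - ∣ q ∣) ² ≤ (p + q) ²
        abs-difference p q = ≤-by-difference _
          (*-nonneg 0≤2 (p≤q⇒0≤q-p (subst (λ u → - u ≤ p * q) (∣p*q∣≡∣p∣*∣q∣ p q) (-∣p∣≤p (p * q)))))
          (trans (identity p q (∣ p ∣) (∣ q ∣))
            (trans (cong₂ (λ u v → (p + q) ² + (u - p ²) + (v - q ²)) (∣p∣²≡p² p) (∣p∣²≡p² q))
              (cancel p q)))
          where
          identity : ∀ p q a b → (a - b) * (a - b) + 2ℚ * (p * q - - (a * b)) ≡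
            (p + q) * (p + q) + (a * a - p * p) + (b * b - q * q)
          identity = solve-∀ ℚ-ring
          cancel : ∀ p q → (p + q) * (p + q) + (p * p - p * p) + (q * q - q * q) ≡ (p + q) * (p + q)
          cancel = solve-∀ ℚ-ring

        -- As ∣f∣ is nonnegative, its centre may be replaced by the absolute value of that centre; μ
        -- is then nonnegative and can serve as the scale of ∣f∣.
        closer : ∀ p m → (∣ p ∣ - ∣ m ∣) ² ≤ (∣ p ∣ - m) ²
        closer p m = ≤-by-difference _ (*-nonneg (*-nonneg 0≤2 (0≤∣p∣ p)) (p≤q⇒0≤q-p (p≤∣p∣ m)))
          (trans (identity (∣ p ∣) m (∣ m ∣))
            (trans (cong (λ u → (∣ p ∣ - m) ² + (u - m ²)) (∣p∣²≡p² m)) (cancel (∣ p ∣) m)))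
          where
          identity : ∀ a m b →
            (a - b) * (a - b) + 2ℚ * a * (b - m) ≡ (a - m) * (a - m) + (b * b - m * m)
          identity = solve-∀ ℚ-ring
          cancel : ∀ a m → (a - m) * (a - m) + (m * m - m * m) ≡ (a - m) * (a - m)
          cancel = solve-∀ ℚ-ring

        κV≤E : κ * V ≤ E
        κV≤E = begin
          κ * V
            ≤⟨ *-monoˡ 0≤κ (∑-mono λ x → closer (f x) (proj₁ (poincaré (∣_∣ ∘ f)))) ⟩
          κ * ∑ (λ x → (∣ f x ∣ - proj₁ (poincaré (∣_∣ ∘ f))) ²)  ≤⟨ proj₂ (poincaré (∣_∣ ∘ f)) ⟩
          dirichlet (∣_∣ ∘ f)
            ≤⟨ ∑₂-mono (λ x y → *-monoˡ (ind-nonneg (adj x y)) (abs-difference (f x) (f y))) ⟩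
          E                                      ∎
          where open ≤-Reasoning

        Q≤2V+2Nμ² : Q ≤ 2ℚ * V + 2ℚ * μ ² * N
        Q≤2V+2Nμ² = begin
          Q                                            ≤⟨ ∑-mono pointwise ⟩
          ∑ (λ x → 2ℚ * (∣ f x ∣ - μ) ² + 2ℚ * μ ² * 1ℚ)
            ≡⟨ ∑-linear 2ℚ (2ℚ * μ ²) (λ x → (∣ f x ∣ - μ) ²) (const 1ℚ) ⟩
          2ℚ * V + 2ℚ * μ ² * N                        ∎
          where
          open ≤-Reasoning
          identity : ∀ a m →
            a * a + (a - 2ℚ * m) * (a - 2ℚ * m) ≡ 2ℚ * ((a - m) * (a - m)) + 2ℚ * (m * m) * 1ℚ
          identity = solve-∀ ℚ-ring
          pointwise : ∀ x → f x ² ≤ 2ℚ * (∣ f x ∣ - μ) ² + 2ℚ * μ ² * 1ℚ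
          pointwise x = subst (_≤ 2ℚ * (∣ f x ∣ - μ) ² + 2ℚ * μ ² * 1ℚ) (∣p∣²≡p² (f x))
            (≤-by-difference _ (²-nonneg (∣ f x ∣ - 2ℚ * μ)) (identity (∣ f x ∣) μ))

        violated⇒⊥ : ¬ (E < ε₀ * κ * Q)
        violated⇒⊥ lt = nonBipartite (χ , χ-colouring)
          where
          0<κ : 0ℚ < κ
          0<κ = ≰⇒> λ κ≤0 → <-irrefl refl (≤-<-trans 0≤E (<-≤-trans lt
            (subst (λ u → ε₀ * u * Q ≤ 0ℚ) (≤-antisym 0≤κ κ≤0) (≤-reflexive (zero′ ε₀ Q)))))
            where
            zero′ : ∀ c q → c * 0ℚ * q ≡ 0ℚ
            zero′ = solve-∀ ℚ-ring

          V≤εQ : V ≤ ε₀ * Q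
          V≤εQ = *-cancelˡ 0<κ (≤-trans κV≤E (≤-trans (<⇒≤ lt) (≤-reflexive (rearrange ε₀ κ Q))))
            where
            rearrange : ∀ c k q → c * k * q ≡ k * (c * q)
            rearrange = solve-∀ ℚ-ring

          -- In Q ≤ 2V + 2Nμ² the term 2V ≤ 2ε₀Q is at most Q/2 and is absorbed. This 4 is the ratio
          -- between ε₁ and ε₀: it turns bounds relative to Q into bounds relative to N after
          -- scaling.
          Q≤4Nμ² : Q ≤ 4ℚ * μ ² * N
          Q≤4Nμ² = ≤-by-difference _
            (+-nonneg (*-nonneg 0≤2 (p≤q⇒0≤q-p Q≤2V+2Nμ²))
              (+-nonneg (*-nonneg 0≤4 (p≤q⇒0≤q-p V≤εQ))
                (*-nonneg (<⇒≤ (positive⁻¹ (1ℚ - 4ℚ * ε₀))) 0≤Q)))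
            (identity ε₀ Q V (μ ²) N)
            where
            identity : ∀ c q v m N → q + (2ℚ * ((2ℚ * v + 2ℚ * m * N) - q) +
              (4ℚ * (c * q - v) + (1ℚ - 4ℚ * c) * q)) ≡ 4ℚ * m * N
            identity = solve-∀ ℚ-ring

          -- μ = 0 would force Q = 0, and the assumed violation would read E < 0.
          μ≢0 : NonZero μ
          μ≢0 = ≢-nonZero {μ} λ μ≡0 → <-irrefl refl (≤-<-trans 0≤E (<-≤-trans lt
            (subst (λ q → ε₀ * κ * q ≤ 0ℚ)
              (≤-antisym 0≤Q (subst (Q ≤_) (trans (cong (λ u → 4ℚ * u ² * N) μ≡0) (zero₁ N)) Q≤4Nμ²))
              (≤-reflexive (zero₂ ε₀ κ)))))
            where
            zero₁ : ∀ N → 4ℚ * (0ℚ * 0ℚ) * N ≡ 0ℚ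
            zero₁ = solve-∀ ℚ-ring
            zero₂ : ∀ c k → c * k * 0ℚ ≡ 0ℚ
            zero₂ = solve-∀ ℚ-ring

          -- Scaling by 1/μ moves the centre of ∣f∣ to 1, so that the deviation V becomes the defect
          -- of F from ±1.
          r = (1/ μ) {{μ≢0}}

          0≤r : 0ℚ ≤ r
          0≤r = ≮⇒≥ λ r<0 → <-irrefl refl (<-≤-trans (positive⁻¹ 1ℚ)
            (subst (_≤ 0ℚ) (*-inverseʳ μ {{μ≢0}})
              (subst (μ * r ≤_) (*-zeroʳ μ)
                (*-monoˡ {r} {0ℚ} {μ} (0≤∣p∣ (proj₁ (poincaré (∣_∣ ∘ f)))) (<⇒≤ r<0)))))

          scaled : ∀ c {t} → t ≤ c * (4ℚ * μ ² * N) → r ² * t ≤ 4ℚ * c * N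
          scaled c {t} le = ≤-trans (*-monoˡ (²-nonneg r) le) (≤-reflexive
            (trans (regroup r c μ N)
              (trans (cong (λ u → 4ℚ * c * N * u ²) (*-inverseʳ μ {{μ≢0}})) (*-identityʳ (4ℚ * c * N)))))
            where
            regroup : ∀ r c m N → r * r * (c * (4ℚ * (m * m) * N)) ≡ 4ℚ * c * N * ((m * r) * (m * r))
            regroup = solve-∀ ℚ-ring

          F : Fin n → ℚ
          F x = clamp (r * f x)

          defect : ∑ (λ x → (1ℚ - ∣ F x ∣) ²) ≤ ε₁ * N
          defect = begin
            ∑ (λ x → (1ℚ - ∣ F x ∣) ²)       ≤⟨ ∑-mono (λ x → clamp-defect (r * f x)) ⟩
            ∑ (λ x → (1ℚ - ∣ r * f x ∣) ²)   ≡⟨ ∑-cong (λ x → pointwise (f x)) ⟩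
            ∑ (λ x → r ² * (∣ f x ∣ - μ) ²)  ≡⟨ *-distribˡ-sum (r ²) (λ x → (∣ f x ∣ - μ) ²) ⟨
            r ² * V                          ≤⟨ scaled ε₀ (≤-trans V≤εQ (*-monoˡ 0≤ε₀ Q≤4Nμ²)) ⟩
            4ℚ * ε₀ * N                       ∎
            where
            open ≤-Reasoning
            square : ∀ r a m → (m * r - r * a) * (m * r - r * a) ≡ r * r * ((a - m) * (a - m))
            square = solve-∀ ℚ-ring
            pointwise : ∀ p → (1ℚ - ∣ r * p ∣) ² ≡ r ² * (∣ p ∣ - μ) ²
            pointwise p = trans (cong₂ (λ u v → (u - v) ²) (sym (*-inverseʳ μ {{μ≢0}}))
              (trans (∣p*q∣≡∣p∣*∣q∣ r p) (cong (_* ∣ p ∣) (0≤p⇒∣p∣≡p 0≤r)))) (square r (∣ p ∣) μ)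

          energy : signless F ≤ ε₁ * κ * N
          energy = begin
            signless F
              ≤⟨ signless-mono F (λ x → r * f x) (λ x y → clamp-sum (r * f x) (r * f y)) ⟩
            signless (λ x → r * f x)       ≡⟨ ∑₂-cong (λ x y → homogeneous (edge x y) r (f x) (f y)) ⟩
            ∑₂ (λ x y → r ² * (edge x y * (f x + f y) ²))
              ≡⟨ ∑₂-scale (r ²) (λ x y → edge x y * (f x + f y) ²) ⟩
            r ² * E
              ≤⟨ scaled (ε₀ * κ) (≤-trans (<⇒≤ lt) (*-monoˡ (*-nonneg 0≤ε₀ 0≤κ) Q≤4Nμ²)) ⟩
            4ℚ * (ε₀ * κ) * N               ≡⟨ rearrange ε₀ κ N ⟩
            ε₁ * κ * N                     ∎
            where
            open ≤-Reasoning
            homogeneous : ∀ w r p q →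
              w * ((r * p + r * q) * (r * p + r * q)) ≡ r * r * (w * ((p + q) * (p + q)))
            homogeneous = solve-∀ ℚ-ring
            rearrange : ∀ c k N → 4ℚ * (c * k) * N ≡ 4ℚ * c * k * N
            rearrange = solve-∀ ℚ-ring

          open NearlySigned F 0<κ (λ x → clamp-²≤1 (r * f x)) defect energy using (χ; χ-colouring)

-- Determinants: row operations, rank-one shifts, coercive forms

module Determinants where

  open import Data.Rational.Base hiding (ℚ; floor; _≃_)
  open import Data.Rational.Properties
  open RationalSums

  sign : ℕ → ℚ
  sign zero    = 1ℚ
  sign (suc k) = - sign k

  minor : ∀ {m n} → (Fin m → Fin (suc n) → ℚ) → Fin (suc n) → Fin m → Fin n → ℚ
  minor R j i k = R i (punchIn j k)

  det : ∀ {n} → (Fin n → Fin n → ℚ) → ℚ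
  det {zero}  M = 1ℚ
  det {suc n} M = ∑ λ j → sign (toℕ j) * (M zero j * det (minor (M ∘ suc) j))

  det-cong : ∀ {n} {M N : Fin n → Fin n → ℚ} → (∀ i j → M i j ≡ N i j) → det M ≡ det N
  det-cong {zero}  M≡N = refl
  det-cong {suc n} M≡N = ∑-cong λ j → cong₂ (λ u v → sign (toℕ j) * (u * v))
    (M≡N zero j) (det-cong λ i k → M≡N (suc i) (punchIn j k))

  det-minors : ∀ {n} (r : Fin (suc n) → ℚ) {R S : Fin n → Fin (suc n) → ℚ} →
               (∀ j → det (minor R j) ≡ det (minor S j)) → det (r ∷ R) ≡ det (r ∷ S)
  det-minors r eq = ∑-cong λ j → cong (λ u → sign (toℕ j) * (r j * u)) (eq j)

  det-row-linear : ∀ {n} a b (r s : Fin (suc n) → ℚ) R →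
                   det ((λ j → a * r j + b * s j) ∷ R) ≡ a * det (r ∷ R) + b * det (s ∷ R)
  det-row-linear a b r s R = trans
    (∑-cong λ j → identity a b (sign (toℕ j)) (r j) (s j) (det (minor R j)))
    (∑-linear a b (term r) (term s))
    where
    term : (Fin _ → ℚ) → Fin _ → ℚ
    term r j = sign (toℕ j) * (r j * det (minor R j))
    identity : ∀ a b e r s d → e * ((a * r + b * s) * d) ≡ a * (e * (r * d)) + b * (e * (s * d))
    identity = solve-∀ ℚ-ring

  det-row-∑ : ∀ {m n} (T : Fin m → Fin (suc n) → ℚ) R →
              det ((λ j → ∑ λ i → T i j) ∷ R) ≡ ∑ λ i → det (T i ∷ R)
  det-row-∑ T R = trans
    (∑-cong λ j → trans (cong (sign (toℕ j) *_) (*-distribʳ-sum (det (minor R j)) (λ i → T i j)))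
                        (*-distribˡ-sum (sign (toℕ j)) (λ i → T i j * det (minor R j))))
    (∑-comm λ j i → sign (toℕ j) * (T i j * det (minor R j)))

  -- The sum over ordered pairs of distinct columns j and `punchIn j k` in the Laplace expansion
  -- along two rows; k is the position of the second column once the first is removed.
  alternating-sum : ∀ {n} → (Fin (suc n) → Fin (suc n) → ℚ) → ℚ
  alternating-sum {n} G = ∑ λ j → ∑ {n} λ k → (sign (toℕ j) * sign (toℕ k)) * G j (punchIn j k)

  -- Exchanging the two columns changes exactly one of the positions by one, hence the sign. In the
  -- induction the terms whose first column is zero trade places with those whose second column is
  -- zero.
  alternating-sum-flip : ∀ {n} (G : Fin (suc n) → Fin (suc n) → ℚ) →
                         alternating-sum G ≡ - alternating-sum (flip G)
  alternating-sum-flip {zero}  G = refl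
  alternating-sum-flip {suc n} G = begin
    alternating-sum G                        ≡⟨ split G ⟩
    first G + (- first (flip G) + rest G)
      ≡⟨ cong (λ s → first G + (- first (flip G) + s)) (alternating-sum-flip (λ j k → G (suc j) (suc k))) ⟩
    first G + (- first (flip G) - rest (flip G))
      ≡⟨ identity (first G) (first (flip G)) (rest (flip G)) ⟩
    - (first (flip G) + (- first G + rest (flip G)))  ≡⟨ cong -_ (split (flip G)) ⟨
    - alternating-sum (flip G)               ∎
    where
    open ≡-Reasoning

    first rest : (Fin (suc (suc n)) → Fin (suc (suc n)) → ℚ) → ℚ
    first G = ∑ λ k → sign (toℕ k) * G zero (suc k)
    rest G = alternating-sum λ j k → G (suc j) (suc k)

    signs₁ : ∀ e g → (1ℚ * e) * g ≡ e * g
    signs₁ = solve-∀ ℚ-ring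

    signs₂ : ∀ e g → (- e * 1ℚ) * g ≡ (- 1ℚ) * (e * g)
    signs₂ = solve-∀ ℚ-ring

    signs₃ : ∀ d e g → (- d * - e) * g ≡ (d * e) * g
    signs₃ = solve-∀ ℚ-ring

    -1* : ∀ u → (- 1ℚ) * u ≡ - u
    -1* = solve-∀ ℚ-ring

    identity : ∀ u v w → u + (- v - w) ≡ - (v + (- u + w))
    identity = solve-∀ ℚ-ring

    split : ∀ G → alternating-sum G ≡ first G + (- first (flip G) + rest G)
    split G = cong₂ _+_
      (∑-cong λ k → signs₁ (sign (toℕ k)) (G zero (suc k)))
      (trans (∑-cong λ j → cong₂ _+_
                (signs₂ (sign (toℕ j)) (G (suc j) zero))
                (∑-cong λ k → signs₃ (sign (toℕ j)) (sign (toℕ k)) (G (suc j) (suc (punchIn j k)))))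
        (trans (∑-distrib-+ (λ j → (- 1ℚ) * (sign (toℕ j) * G (suc j) zero))
                  (λ j → ∑ λ k → (sign (toℕ j) * sign (toℕ k)) * G (suc j) (suc (punchIn j k))))
          (cong (_+ rest G)
            (trans (sym (*-distribˡ-sum (- 1ℚ) λ j → sign (toℕ j) * G (suc j) zero))
                   (-1* (first (flip G)))))))

  -- Unlike punchIn j ∘ punchIn k, symmetric in the two omitted points; junk when
  -- they coincide.
  punchIn₂ : ∀ {n} → Fin (suc (suc n)) → Fin (suc (suc n)) → Fin n → Fin (suc (suc n))
  punchIn₂ zero    zero    x       = suc (suc x)
  punchIn₂ zero    (suc l) x       = suc (punchIn l x)
  punchIn₂ (suc j) zero    x       = suc (punchIn j x)
  punchIn₂ (suc j) (suc l) zero    = zero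
  punchIn₂ (suc j) (suc l) (suc x) = suc (punchIn₂ j l x)

  punchIn₂-comm : ∀ {n} j l (x : Fin n) → punchIn₂ j l x ≡ punchIn₂ l j x
  punchIn₂-comm zero    zero    x       = refl
  punchIn₂-comm zero    (suc l) x       = refl
  punchIn₂-comm (suc j) zero    x       = refl
  punchIn₂-comm (suc j) (suc l) zero    = refl
  punchIn₂-comm (suc j) (suc l) (suc x) = cong suc (punchIn₂-comm j l x)

  punchIn∘punchIn : ∀ {n} j k (x : Fin n) → punchIn j (punchIn k x) ≡ punchIn₂ j (punchIn j k) x
  punchIn∘punchIn zero    k       x       = refl
  punchIn∘punchIn (suc j) zero    x       = refl
  punchIn∘punchIn (suc j) (suc k) zero    = refl
  punchIn∘punchIn (suc j) (suc k) (suc x) = cong suc (punchIn∘punchIn j k x)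

  -- Expansion along both rows gives an alternating sum whose complementary minor is symmetric in
  -- the two removed columns, so only the product of the two entries is flipped.
  det-swap : ∀ {n} (r s : Fin (suc (suc n)) → ℚ) R → det (r ∷ s ∷ R) ≡ - det (s ∷ r ∷ R)
  det-swap r s R = begin
    det (r ∷ s ∷ R)                              ≡⟨ expand r s ⟩
    alternating-sum (G r s)                      ≡⟨ alternating-sum-flip (G r s) ⟩
    - alternating-sum (flip (G r s))
      ≡⟨ cong -_ (∑₂-cong λ j k → cong (sign (toℕ j) * sign (toℕ k) *_) (G-flip j (punchIn j k))) ⟩
    - alternating-sum (G s r)                    ≡⟨ cong -_ (expand s r) ⟨
    - det (s ∷ r ∷ R)                            ∎
    where
    open ≡-Reasoning

    D : Fin _ → Fin _ → ℚ
    D j l = det λ i x → R i (punchIn₂ j l x)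

    G : (r s : Fin _ → ℚ) → Fin _ → Fin _ → ℚ
    G r s j l = (r j * s l) * D j l

    swap : ∀ u v d → (u * v) * d ≡ (v * u) * d
    swap = solve-∀ ℚ-ring

    G-flip : ∀ j l → G r s l j ≡ G s r j l
    G-flip j l = trans (cong (r l * s j *_) (det-cong λ i x → cong (R i) (punchIn₂-comm l j x)))
      (swap (r l) (s j) (D j l))

    regroup : ∀ d e r s g → d * (r * (e * (s * g))) ≡ (d * e) * ((r * s) * g)
    regroup = solve-∀ ℚ-ring

    expand : ∀ r s → det (r ∷ s ∷ R) ≡ alternating-sum (G r s)
    expand r s = ∑-cong λ j → trans
      (cong (sign (toℕ j) *_) (*-distribˡ-sum (r j) (term j)))
      (trans (*-distribˡ-sum (sign (toℕ j)) (λ k → r j * term j k))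
        (∑-cong λ k → trans
          (cong (λ d → sign (toℕ j) * (r j * (sign (toℕ k) * (s (punchIn j k) * d))))
            (det-cong λ i x → cong (R i) (punchIn∘punchIn j k x)))
          (regroup (sign (toℕ j)) (sign (toℕ k)) (r j) (s (punchIn j k)) (D j (punchIn j k)))))
      where
      term : ∀ j k → ℚ
      term j k = sign (toℕ k) * (s (punchIn j k) * det (minor (minor R j) k))

  p≡-p⇒p≡0 : ∀ {p} → p ≡ - p → p ≡ 0ℚ
  p≡-p⇒p≡0 {p} eq = trans (halves p) (trans (cong (λ q → ½ * (p + q)) eq) (cancel p))
    where
    halves : ∀ p → p ≡ ½ * (p + p)
    halves = solve-∀ ℚ-ring
    cancel : ∀ p → ½ * (p - p) ≡ 0ℚ
    cancel = solve-∀ ℚ-ring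

  -- Unless the twin is the next row, a swap moves the copy below `R zero`, and every minor along
  -- the new first row again has a repeated row at its top.
  det-repeated : ∀ {n} (R : Fin n → Fin (suc n) → ℚ) i → det (R i ∷ R) ≡ 0ℚ
  det-repeated R zero = trans (det-cong (unfold (R zero)))
    (p≡-p⇒p≡0 (det-swap (R zero) (R zero) (R ∘ suc)))
    where
    unfold : ∀ r i j → (r ∷ R) i j ≡ (r ∷ R zero ∷ R ∘ suc) i j
    unfold r zero          j = refl
    unfold r (suc zero)    j = refl
    unfold r (suc (suc i)) j = refl
  det-repeated {suc n} R (suc i) = begin
    det (R (suc i) ∷ R)                        ≡⟨ det-cong (unfold (R (suc i))) ⟩
    det (R (suc i) ∷ R zero ∷ R ∘ suc)         ≡⟨ det-swap (R (suc i)) (R zero) (R ∘ suc) ⟩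
    - det (R zero ∷ R (suc i) ∷ R ∘ suc)       ≡⟨ cong -_ (∑-cong λ j → trans
        (cong (λ d → sign (toℕ j) * (R zero j * d))
          (trans (det-cong (shift j)) (det-repeated (minor (R ∘ suc) j) i)))
        (vanish (sign (toℕ j)) (R zero j))) ⟩
    - ∑ {suc (suc n)} (const 0ℚ)               ≡⟨ cong -_ (sum-replicate-zero (suc (suc n))) ⟩
    0ℚ                                         ∎
    where
    open ≡-Reasoning
    vanish : ∀ e r → e * (r * 0ℚ) ≡ 0ℚ
    vanish = solve-∀ ℚ-ring
    unfold : ∀ r i j → (r ∷ R) i j ≡ (r ∷ R zero ∷ R ∘ suc) i j
    unfold r zero          j = refl
    unfold r (suc zero)    j = refl
    unfold r (suc (suc i)) j = refl
    shift : ∀ j l k → minor (R (suc i) ∷ R ∘ suc) j l k ≡ (minor (R ∘ suc) j i ∷ minor (R ∘ suc) j) l k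
    shift j zero    k = refl
    shift j (suc l) k = refl

  -- After a swap r is the first row of all minors along the second row, so induction clears the
  -- later rows; the second row is then cleared by linearity, the extra term having r twice.
  det-eliminate : ∀ {n} (r : Fin (suc n) → ℚ) (R : Fin n → Fin (suc n) → ℚ) (c : Fin n → ℚ) →
                  det (r ∷ λ i j → R i j + c i * r j) ≡ det (r ∷ R)
  det-eliminate {zero} r R c = det-minors r {λ i j → R i j + c i * r j} {R} λ j → refl
  det-eliminate {suc n} r R c = begin
    det (r ∷ R′)                                ≡⟨ det-cong unfold′ ⟩
    det (r ∷ R′ zero ∷ R′ ∘ suc)                ≡⟨ det-swap r (R′ zero) (R′ ∘ suc) ⟩
    - det (R′ zero ∷ r ∷ R′ ∘ suc)
      ≡⟨ cong -_ (det-minors (R′ zero) {r ∷ R′ ∘ suc} {r ∷ R ∘ suc} λ j →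
        trans (det-cong (shift′ j))
          (trans (det-eliminate (r ∘ punchIn j) (minor (R ∘ suc) j) (c ∘ suc))
            (sym (det-cong (shift j))))) ⟩
    - det (R′ zero ∷ r ∷ R ∘ suc)               ≡⟨ cong -_ (det-cong row) ⟩
    - det ((λ j → 1ℚ * R zero j + c zero * r j) ∷ r ∷ R ∘ suc)
      ≡⟨ cong -_ (det-row-linear 1ℚ (c zero) (R zero) r (r ∷ R ∘ suc)) ⟩
    - (1ℚ * det (R zero ∷ r ∷ R ∘ suc) + c zero * det (r ∷ r ∷ R ∘ suc))
      ≡⟨ cong₂ (λ u v → - (1ℚ * u + c zero * v)) (det-swap (R zero) r (R ∘ suc))
          (det-repeated (r ∷ R ∘ suc) zero) ⟩
    - (1ℚ * - det (r ∷ R zero ∷ R ∘ suc) + c zero * 0ℚ)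
      ≡⟨ identity (det (r ∷ R zero ∷ R ∘ suc)) (c zero) ⟩
    det (r ∷ R zero ∷ R ∘ suc)                  ≡⟨ det-cong unfold ⟨
    det (r ∷ R)                                 ∎
    where
    open ≡-Reasoning
    R′ : Fin (suc n) → Fin (suc (suc n)) → ℚ
    R′ i j = R i j + c i * r j
    identity : ∀ d e → - (1ℚ * - d + e * 0ℚ) ≡ d
    identity = solve-∀ ℚ-ring
    unfold : ∀ i j → (r ∷ R) i j ≡ (r ∷ R zero ∷ R ∘ suc) i j
    unfold zero          j = refl
    unfold (suc zero)    j = refl
    unfold (suc (suc i)) j = refl
    unfold′ : ∀ i j → (r ∷ R′) i j ≡ (r ∷ R′ zero ∷ R′ ∘ suc) i j
    unfold′ zero          j = refl
    unfold′ (suc zero)    j = refl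
    unfold′ (suc (suc i)) j = refl
    shift′ : ∀ j l k → minor (r ∷ R′ ∘ suc) j l k ≡
      (r ∘ punchIn j ∷ λ i k → minor (R ∘ suc) j i k + c (suc i) * r (punchIn j k)) l k
    shift′ j zero    k = refl
    shift′ j (suc l) k = refl
    shift : ∀ j l k → minor (r ∷ R ∘ suc) j l k ≡ (r ∘ punchIn j ∷ minor (R ∘ suc) j) l k
    shift j zero    k = refl
    shift j (suc l) k = refl
    row : ∀ i j → (R′ zero ∷ r ∷ R ∘ suc) i j ≡ ((λ j → 1ℚ * R zero j + c zero * r j) ∷ r ∷ R ∘ suc) i j
    row zero    j = cong (_+ c zero * r j) (sym (*-identityˡ (R zero j)))
    row (suc i) j = refl

  det-zero-column : ∀ {n} (M : Fin (suc n) → Fin (suc n) → ℚ) → (∀ i → M i zero ≡ 0ℚ) → det M ≡ 0ℚ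
  det-zero-column {n} M M≡0 = trans (∑-cong vanish) (sum-replicate-zero (suc n))
    where
    left : ∀ e d → e * (0ℚ * d) ≡ 0ℚ
    left = solve-∀ ℚ-ring
    right : ∀ e r → e * (r * 0ℚ) ≡ 0ℚ
    right = solve-∀ ℚ-ring
    vanish : ∀ j → sign (toℕ j) * (M zero j * det (minor (M ∘ suc) j)) ≡ 0ℚ
    vanish zero =
      trans (cong (λ u → 1ℚ * (u * det (minor (M ∘ suc) zero))) (M≡0 zero))
          (left 1ℚ (det (minor (M ∘ suc) zero)))
    vanish (suc {suc n} j) = trans
      (cong (λ u → sign (suc (toℕ j)) * (M zero (suc j) * u))
        (det-zero-column (minor (M ∘ suc) (suc j)) (M≡0 ∘ suc)))
      (right (sign (suc (toℕ j))) (M zero (suc j)))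

  -- Adding all rows to the first makes it a multiple of the row of ones, with factor ρ for B and ρ
  -- + n s for the shifted matrix; the row of ones then eliminates s from the other rows. The
  -- statement is free of division and so covers ρ = 0, which occurs at the eigenvalue 1.
  det-column-sums : ∀ {n} (B : Fin n → Fin n → ℚ) ρ s → (∀ j → ∑ (λ i → B i j) ≡ ρ) →
                    det (λ i j → B i j + s) * ρ ≡ (ρ + size n * s) * det B
  det-column-sums {zero} B ρ s _ = identity ρ s
    where
    identity : ∀ ρ s → 1ℚ * ρ ≡ (ρ + 0ℚ * s) * 1ℚ
    identity = solve-∀ ℚ-ring
  det-column-sums {suc n} B ρ s sums = trans
    (cong (_* ρ) (trans (sum-first-row (λ i j → B i j + s) (ρ + size (suc n) * s) shifted-sums)
      (cong ((ρ + size (suc n) * s) *_)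
        (trans (det-cong ones) (det-eliminate (const 1ℚ) (B ∘ suc) (const s))))))
    (trans (rearrange (ρ + size (suc n) * s) (det (const 1ℚ ∷ B ∘ suc)) ρ)
      (cong ((ρ + size (suc n) * s) *_) (sym (sum-first-row B ρ sums))))
    where
    rearrange : ∀ u d r → (u * d) * r ≡ u * (r * d)
    rearrange = solve-∀ ℚ-ring

    ones : ∀ i j → (const 1ℚ ∷ λ i j → B (suc i) j + s) i j ≡ (const 1ℚ ∷ λ i j → B (suc i) j + s * 1ℚ) i j
    ones zero    j = refl
    ones (suc i) j = cong (B (suc i) j +_) (sym (*-identityʳ s))

    shifted-sums : ∀ j → ∑ (λ i → B i j + s) ≡ ρ + size (suc n) * s
    shifted-sums j = trans (∑-distrib-+ (λ i → B i j) (const s)) (cong₂ _+_ (sums j)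
      (trans (∑-cong {suc n} {const s} {λ _ → 1ℚ * s} λ _ → sym (*-identityˡ s))
             (sym (*-distribʳ-sum {suc n} s (const 1ℚ)))))

    sum-first-row : ∀ (M : Fin (suc n) → Fin (suc n) → ℚ) σ → (∀ j → ∑ (λ i → M i j) ≡ σ) →
                    det M ≡ σ * det (const 1ℚ ∷ M ∘ suc)
    sum-first-row M σ sums = begin
      det M                                                       ≡⟨ add-zero (det M) ⟩
      1ℚ * det M + 1ℚ * 0ℚ
        ≡⟨ cong (λ z → 1ℚ * det M + 1ℚ * z) others ⟨
      1ℚ * det M + 1ℚ * det ((λ j → ∑ λ i → M (suc i) j) ∷ M ∘ suc)
        ≡⟨ det-row-linear 1ℚ 1ℚ (M zero) (λ j → ∑ λ i → M (suc i) j) (M ∘ suc) ⟨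
      det ((λ j → 1ℚ * M zero j + 1ℚ * ∑ λ i → M (suc i) j) ∷ M ∘ suc) ≡⟨ det-cong row ⟩
      det ((λ j → σ * 1ℚ + 0ℚ * 1ℚ) ∷ M ∘ suc)
        ≡⟨ det-row-linear σ 0ℚ (const 1ℚ) (const 1ℚ) (M ∘ suc) ⟩
      σ * det (const 1ℚ ∷ M ∘ suc) + 0ℚ * det (const 1ℚ ∷ M ∘ suc)
        ≡⟨ drop-zero (σ * det (const 1ℚ ∷ M ∘ suc)) (det (const 1ℚ ∷ M ∘ suc)) ⟩
      σ * det (const 1ℚ ∷ M ∘ suc)                                ∎
      where
      open ≡-Reasoning
      add-zero : ∀ d → d ≡ 1ℚ * d + 1ℚ * 0ℚ
      add-zero = solve-∀ ℚ-ring
      drop-zero : ∀ d e → d + 0ℚ * e ≡ d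
      drop-zero = solve-∀ ℚ-ring
      scale : ∀ u v → 1ℚ * u + 1ℚ * v ≡ (u + v) * 1ℚ + 0ℚ * 1ℚ
      scale = solve-∀ ℚ-ring
      others : det ((λ j → ∑ λ i → M (suc i) j) ∷ M ∘ suc) ≡ 0ℚ
      others = trans (det-row-∑ (M ∘ suc) (M ∘ suc))
        (trans (∑-cong (det-repeated (M ∘ suc))) (sum-replicate-zero n))
      row : ∀ i j → ((λ j → 1ℚ * M zero j + 1ℚ * ∑ λ i → M (suc i) j) ∷ M ∘ suc) i j ≡
                    ((λ j → σ * 1ℚ + 0ℚ * 1ℚ) ∷ M ∘ suc) i j
      row zero    j =
        trans (scale (M zero j) (∑ λ i → M (suc i) j)) (cong (λ t → t * 1ℚ + 0ℚ * 1ℚ) (sums j))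
      row (suc i) j = refl

  infixr 8 _^_
  _^_ : ℚ → ℕ → ℚ
  p ^ zero  = 1ℚ
  p ^ suc n = p * p ^ n

  ^-pos : ∀ {p} n → 0ℚ < p → 0ℚ < p ^ n
  ^-pos zero    0<p = positive⁻¹ 1ℚ
  ^-pos (suc n) 0<p = *-pos 0<p (^-pos n 0<p)

  form : ∀ {n} → (Fin n → Fin n → ℚ) → (Fin n → ℚ) → ℚ
  form B f = ∑₂ λ i j → f i * B i j * f j

  norm² : ∀ {n} → (Fin n → ℚ) → ℚ
  norm² f = ∑ λ i → f i ²

  form-∷ : ∀ {n} (B : Fin (suc n) → Fin (suc n) → ℚ) s g →
    form B (s ∷ g) ≡ (s * B zero zero * s + s * ∑ (λ j → B zero (suc j) * g j)) +
                     (∑ (λ i → g i * B (suc i) zero) * s + form (λ i j → B (suc i) (suc j)) g)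
  form-∷ B s g = cong₂ _+_
    (cong (s * B zero zero * s +_)
      (trans (∑-cong λ j → *-assoc s (B zero (suc j)) (g j))
        (sym (*-distribˡ-sum s λ j → B zero (suc j) * g j))))
    (trans (∑-distrib-+ (λ i → g i * B (suc i) zero * s)
              (λ i → ∑ λ j → g i * B (suc i) (suc j) * g j))
      (cong (_+ form (λ i j → B (suc i) (suc j)) g) (sym (*-distribʳ-sum s λ i → g i * B (suc i) zero))))

  ∑-* : ∀ {m n} (u : Fin m → ℚ) (v : Fin n → ℚ) → ∑₂ (λ i j → u i * v j) ≡ ∑ u * ∑ v
  ∑-* u v = trans (∑-cong λ i → sym (*-distribˡ-sum (u i) v)) (sym (*-distribʳ-sum (∑ v) u))

  -- Gaussian elimination: the Schur complement of the pivot satisfies the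
  -- same hypothesis, because its form is a value of the original form.
  coercive⇒det-bound : ∀ {n m} → 0ℚ < m → (B : Fin n → Fin n → ℚ) →
                       (∀ f → m * norm² f ≤ ∣ form B f ∣) → m ^ n ≤ ∣ det B ∣
  coercive⇒det-bound {zero}  0<m B coercive = ≤-refl
  coercive⇒det-bound {suc n} {m} 0<m B coercive = begin
    m * m ^ n              ≤⟨ *-mono (<⇒≤ (^-pos n 0<m)) (0≤∣p∣ a) m≤∣a∣
                                (coercive⇒det-bound 0<m S S-coercive) ⟩
    ∣ a ∣ * ∣ det S ∣      ≡⟨ ∣p*q∣≡∣p∣*∣q∣ a (det S) ⟨
    ∣ a * det S ∣          ≡⟨ cong ∣_∣ det≡ ⟨
    ∣ det B ∣              ∎
    where
    open ≤-Reasoning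

    a = B zero zero

    C : Fin n → Fin n → ℚ
    C i j = B (suc i) (suc j)

    m≤∣a∣ : m ≤ ∣ a ∣
    m≤∣a∣ = subst₂ (λ u v → u ≤ ∣ v ∣) (trans (cong (λ z → m * (1ℚ + z)) zeros) (*-identityʳ m))
      (trans (form-∷ B 1ℚ (const 0ℚ)) (trans (cong₂ (λ u v → (1ℚ * a * 1ℚ + 1ℚ * u) + v)
          (trans (∑-cong λ j → *-zeroʳ (B zero (suc j))) zeros)
          (cong₂ (λ u v → u * 1ℚ + v)
            (trans (∑-cong λ i → *-zeroˡ (B (suc i) zero)) zeros)
            (trans (∑-cong λ i → trans (∑-cong λ j → *-zeroʳ (0ℚ * C i j)) zeros) zeros)))
        (simplify a)))
      (coercive (1ℚ ∷ const 0ℚ))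
      where
      zeros = sum-replicate-zero n
      simplify : ∀ a → (1ℚ * a * 1ℚ + 1ℚ * 0ℚ) + (0ℚ * 1ℚ + 0ℚ) ≡ a
      simplify = solve-∀ ℚ-ring

    a≢0 : NonZero a
    a≢0 = ≢-nonZero λ a≡0 → <-irrefl refl (<-≤-trans 0<m (subst (λ u → m ≤ ∣ u ∣) a≡0 m≤∣a∣))

    a⁻¹ = (1/ a) {{a≢0}}

    c : Fin n → ℚ
    c i = - (B (suc i) zero * a⁻¹)

    S : Fin n → Fin n → ℚ
    S i j = B (suc i) (suc j) + c i * B zero (suc j)

    det≡ : det B ≡ a * det S
    det≡ = trans (sym (det-eliminate (B zero) (B ∘ suc) c))
      (trans (cong₂ _+_ (*-identityˡ (a * det S)) (trans (∑-cong vanish) (sum-replicate-zero n)))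
        (+-identityʳ (a * det S)))
      where
      right : ∀ e r → e * (r * 0ℚ) ≡ 0ℚ
      right = solve-∀ ℚ-ring
      pivot : ∀ b a i → b + - (b * i) * a ≡ b * (1ℚ - a * i)
      pivot = solve-∀ ℚ-ring
      cleared : ∀ i → B (suc i) zero + c i * a ≡ 0ℚ
      cleared i = trans (pivot (B (suc i) zero) a a⁻¹)
        (trans (cong (λ u → B (suc i) zero * (1ℚ - u)) (*-inverseʳ a {{a≢0}})) (*-zeroʳ (B (suc i) zero)))
      rows : Fin n → Fin (suc n) → ℚ
      rows i j = B (suc i) j + c i * B zero j
      minor≡0 : ∀ {n} (R : Fin n → Fin (suc n) → ℚ) → (∀ i → R i zero ≡ 0ℚ) →
                ∀ j → det (minor R (suc j)) ≡ 0ℚ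
      minor≡0 {suc n} R eq j = det-zero-column (minor R (suc j)) eq
      vanish : ∀ j → sign (suc (toℕ j)) * (B zero (suc j) * det (minor rows (suc j))) ≡ 0ℚ
      vanish j = trans (cong (λ d → sign (suc (toℕ j)) * (B zero (suc j) * d)) (minor≡0 rows cleared j))
        (right (sign (suc (toℕ j))) (B zero (suc j)))

    S-coercive : ∀ g → m * norm² g ≤ ∣ form S g ∣
    S-coercive g = begin
      m * norm² g
        ≤⟨ *-monoˡ (<⇒≤ 0<m) (≤-by-difference _ (²-nonneg s) (+-comm (norm² g) (s ²))) ⟩
      m * norm² (s ∷ g)      ≤⟨ coercive (s ∷ g) ⟩
      ∣ form B (s ∷ g) ∣
        ≡⟨ cong ∣_∣ (trans (form-∷ B s g)
            (trans (complete a a⁻¹ β β′ (form C g) (*-inverseʳ a {{a≢0}})) (sym form-S))) ⟩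
      ∣ form S g ∣           ∎
      where
      β = ∑ λ j → B zero (suc j) * g j
      β′ = ∑ λ i → g i * B (suc i) zero
      -- The solution of a s + β = 0: the first row of B annihilates `s ∷ g`, which leaves exactly
      -- the form of the Schur complement.
      s = - (β * a⁻¹)

      complete : ∀ a i β β′ q → a * i ≡ 1ℚ →
        (- (β * i) * a * - (β * i) + - (β * i) * β) + (β′ * - (β * i) + q) ≡ q + - i * β′ * β
      complete a i β β′ q ai≡1 = trans (factor a i β β′ q)
        (trans (cong (λ u → β * β * i * (u - 1ℚ) + (q + - i * β′ * β)) ai≡1)
          (drop (β * β * i) (q + - i * β′ * β)))
        where
        factor : ∀ a i β β′ q →
          (- (β * i) * a * - (β * i) + - (β * i) * β) + (β′ * - (β * i) + q) ≡
          β * β * i * (a * i - 1ℚ) + (q + - i * β′ * β)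
        factor = solve-∀ ℚ-ring
        drop : ∀ u v → u * (1ℚ - 1ℚ) + v ≡ v
        drop = solve-∀ ℚ-ring

      form-S : form S g ≡ form C g + - a⁻¹ * β′ * β
      form-S =
        trans (∑₂-cong λ i j → distribute (g i) (C i j) (B (suc i) zero) a⁻¹ (B zero (suc j)) (g j))
        (trans (∑₂-linear 1ℚ (- a⁻¹) (λ i j → g i * C i j * g j)
          (λ i j → (g i * B (suc i) zero) * (B zero (suc j) * g j)))
          (trans (cong (λ t → 1ℚ * form C g + - a⁻¹ * t)
            (∑-* (λ i → g i * B (suc i) zero) (λ j → B zero (suc j) * g j)))
            (tidy (form C g) a⁻¹ β′ β)))
        where
        distribute : ∀ u k b i b′ v →
          u * (k + - (b * i) * b′) * v ≡ 1ℚ * (u * k * v) + - i * ((u * b) * (b′ * v))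
        distribute = solve-∀ ℚ-ring
        tidy : ∀ f i b c → 1ℚ * f + - i * (b * c) ≡ f + - i * b * c
        tidy = solve-∀ ℚ-ring

-- Isoperimetry of finite graphs and the quadratic forms of regular graphs

module Graphs where

  open import Data.Fin.Subset using (∣_∣)
  open import Data.Nat.Base using (NonZero)
  open import Data.Integer.Base using (+_)
  open import Data.Rational.Base hiding (ℚ; floor; _≃_; ∣_∣; NonZero)
  open import Data.Rational.Properties
  open RationalSums
  open VertexExpansion
  open Determinants
  open R using (Graph; IsOuterIsoperimetricConstant)

  size≡ : ∀ k → size k ≡ + k / 1
  size≡ zero = refl
  size≡ (suc k) = trans (cong (λ s → 1ℚ + s) (size≡ k)) (toℚᵘ-injective (begin
      toℚᵘ (1ℚ + (+ k / 1))               ≈⟨ toℚᵘ-homo-+ 1ℚ (+ k / 1) ⟩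
      ℚᵘ.1ℚᵘ ℚᵘ.+ toℚᵘ (+ k / 1)          ≈⟨ ℚᵘ.+-congʳ ℚᵘ.1ℚᵘ (toℚᵘ-fromℚᵘ (ℚᵘ.mkℚᵘ (+ k) 0)) ⟩
      ℚᵘ.1ℚᵘ ℚᵘ.+ ℚᵘ.mkℚᵘ (+ k) 0         ≈⟨ ℚᵘ.*≡*
          (cong (λ j → (+ 1 ℤ.+ j) ℤ.* + 1) (ℤ.*-identityʳ (+ k))) ⟩
      ℚᵘ.mkℚᵘ (+ suc k) 0                 ≈⟨ toℚᵘ-fromℚᵘ (ℚᵘ.mkℚᵘ (+ suc k) 0) ⟨
      toℚᵘ (+ suc k / 1)                  ∎))
    where open ℚᵘ.≃-Reasoning

  -- Computed in unnormalised rationals, where a fraction is a plain pair and no common factor is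
  -- removed.
  /-*-size : ∀ a b .{{_ : NonZero b}} → (+ a / b) * size b ≡ size a
  /-*-size a b@(suc b-1) = trans (cong ((+ a / b) *_) (size≡ b)) (trans (toℚᵘ-injective (begin
      toℚᵘ ((+ a / b) * (+ b / 1))              ≈⟨ toℚᵘ-homo-* (+ a / b) (+ b / 1) ⟩
      toℚᵘ (+ a / b) ℚᵘ.* toℚᵘ (+ b / 1)        ≈⟨ ℚᵘ.*-cong (toℚᵘ-fromℚᵘ (ℚᵘ.mkℚᵘ (+ a) b-1))
          (toℚᵘ-fromℚᵘ (ℚᵘ.mkℚᵘ (+ b) 0)) ⟩
      ℚᵘ.mkℚᵘ (+ a) b-1 ℚᵘ.* ℚᵘ.mkℚᵘ (+ b) 0    ≈⟨ ℚᵘ.*≡*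
          (trans (ℤ.*-identityʳ (+ a ℤ.* + b)) (cong (+ a ℤ.*_) (cong +_ (sym (ℕ.*-identityʳ b))))) ⟩
      ℚᵘ.mkℚᵘ (+ a) 0                           ≈⟨ toℚᵘ-fromℚᵘ (ℚᵘ.mkℚᵘ (+ a) 0) ⟨
      toℚᵘ (+ a / 1)                            ∎)) (sym (size≡ a)))
    where open ℚᵘ.≃-Reasoning

  size-nonneg : ∀ k → 0ℚ ≤ size k
  size-nonneg k = ∑-nonneg {k} λ _ → ind-nonneg true

  size-pos : ∀ k → .{{NonZero k}} → 0ℚ < size k
  size-pos (suc k) = <-≤-trans (positive⁻¹ 1ℚ) (≤-+ʳ (size-nonneg k))

  size-mono : ∀ {j k} → j ℕ.≤ k → size j ≤ size k
  size-mono {k = k} ℕ.z≤n = size-nonneg k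
  size-mono (ℕ.s≤s j≤k) = +-monoʳ-≤ 1ℚ (size-mono j≤k)

  size-cancel : ∀ {j k} → size j ≤ size k → j ℕ.≤ k
  size-cancel {j} {k} le = ℕ.≮⇒≥ λ k<j → <-irrefl refl (<-≤-trans
    (<-by-difference 1ℚ (positive⁻¹ 1ℚ) (+-comm (size k) 1ℚ)) (≤-trans (size-mono k<j) le))

  size-double : ∀ k → size (2 ℕ.* k) ≡ 2ℚ * size k
  size-double k =
    trans (size-+ k (k ℕ.+ 0)) (trans (cong (λ j → size k + size j) (ℕ.+-identityʳ k)) (double (size k)))
    where
    size-+ : ∀ j k → size (j ℕ.+ k) ≡ size j + size k
    size-+ zero k = sym (+-identityˡ (size k))
    size-+ (suc j) k = trans (cong (λ s → 1ℚ + s) (size-+ j k)) (sym (+-assoc 1ℚ (size j) (size k)))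
    double : ∀ s → s + s ≡ 2ℚ * s
    double = solve-∀ ℚ-ring

  #-tabulate : ∀ {n} (p : Fin n → Bool) → # p ≡ size ∣ Vec.tabulate p ∣
  #-tabulate {zero} p = refl
  #-tabulate {suc n} p with p zero
  ... | true  = cong (λ s → 1ℚ + s) (#-tabulate (p ∘ suc))
  ... | false = trans (+-identityˡ (# (p ∘ suc))) (#-tabulate (p ∘ suc))

  ∈-tabulate : ∀ {n} {p : Fin n → Bool} {x} → x ∈ₛ Vec.tabulate p → p x ≡ true
  ∈-tabulate {p = p} {x} x∈ = trans (sym (lookup∘tabulate p x)) ([]=⇒lookup x∈)

  tabulate-∈ : ∀ {n} {p : Fin n → Bool} {x} → p x ≡ true → x ∈ₛ Vec.tabulate p
  tabulate-∈ {p = p} {x} px = lookup⇒[]= x (Vec.tabulate p) (trans (lookup∘tabulate p x) px)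

  ≢true⇒≡false : ∀ {b} → b ≢ true → b ≡ false
  ≢true⇒≡false {true} ≢ = contradiction refl ≢
  ≢true⇒≡false {false} _ = refl

  module Isoperimetry {n} (G : Graph n) (h : ℚ) (isMin : IsOuterIsoperimetricConstant G h) where
    open Graph G

    expansion-nonneg : ∀ V (ne : Nonempty V) → 0ℚ ≤ R.expansion G V ne
    expansion-nonneg V ne = *-cancelˡ (size-pos (∣ V ∣) {{R.nonempty⇒nonZero ne}})
      (subst₂ _≤_ (sym (*-zeroʳ (size ∣ V ∣)))
        (trans (sym (/-*-size (∣ R.∂ₒᵤₜ G V ∣) (∣ V ∣) {{R.nonempty⇒nonZero ne}}))
          (*-comm (R.expansion G V ne) (size ∣ V ∣)))
        (size-nonneg ∣ R.∂ₒᵤₜ G V ∣))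

    0≤h : 0ℚ ≤ h
    0≤h = at (proj₁ isMin)
      where
      at : ∃[ V ] Σ (R.Admissible G V) (λ adm → h ≡ R.expansion G V (proj₁ adm)) → 0ℚ ≤ h
      at (V , (ne , _) , h≡) = subst (0ℚ ≤_) (sym h≡) (expansion-nonneg V ne)

    isoperimetry : ∀ p q → 2ℚ * # p ≤ size n →
      (∀ x y → x ∼ y → p x ≡ true → p y ≡ false → q y ≡ true) → h * # p ≤ # q
    isoperimetry p q half boundary = at (nonempty? V)
      where
      open ≤-Reasoning
      V = Vec.tabulate p

      small : 2 ℕ.* ∣ V ∣ ℕ.≤ n
      small =
        size-cancel (subst (_≤ size n)
            (sym (trans (size-double ∣ V ∣) (cong (2ℚ *_) (sym (#-tabulate p))))) half)

      ∂⊆q : ∀ y → ⌊ R.inBoundary? G V y ⌋ ≡ true → q y ≡ true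
      ∂⊆q y eq = at (true-⌊⌋ {P? = R.inBoundary? G V y} eq)
        where
        at : R.InBoundary G V y → q y ≡ true
        at (y∉V , x , x∈V , x∼y) = boundary x y x∼y (∈-tabulate x∈V) (≢true⇒≡false (y∉V ∘ tabulate-∈))

      at : Dec (Nonempty V) → h * # p ≤ # q
      at (no empty) = subst (_≤ # q) (sym (trans (cong (h *_) (#≡0 {p = p} λ x →
        ≢true⇒≡false λ px → empty (x , tabulate-∈ px))) (*-zeroʳ h))) (∑-nonneg λ x → ind-nonneg (q x))
      at (yes ne) = begin
        h * # p                                        ≡⟨ cong (h *_) (#-tabulate p) ⟩
        h * size ∣ V ∣
          ≤⟨ *-monoʳ (size-nonneg ∣ V ∣) (proj₂ isMin V (ne , small)) ⟩
        R.expansion G V ne * size ∣ V ∣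
          ≡⟨ /-*-size (∣ R.∂ₒᵤₜ G V ∣) (∣ V ∣) {{R.nonempty⇒nonZero ne}} ⟩
        size ∣ R.∂ₒᵤₜ G V ∣                            ≡⟨ #-tabulate (λ y → ⌊ R.inBoundary? G V y ⌋) ⟨
        # (λ y → ⌊ R.inBoundary? G V y ⌋)              ≤⟨ #-mono ∂⊆q ⟩
        # q                                            ∎

  -- A set of ⌊n/2⌋ vertices, chosen without regard to the edges; it serves as a test set for h ≤ 2.
  alternating : ∀ {n} → Fin n → Bool
  alternating zero          = false
  alternating (suc zero)    = true
  alternating (suc (suc x)) = alternating x

  alternating-upper : ∀ n → 2ℚ * # (alternating {n}) ≤ size n
  alternating-upper zero = ≤-refl
  alternating-upper (suc zero) = <⇒≤ (positive⁻¹ 1ℚ)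
  alternating-upper (suc (suc n)) = ≤-by-difference _ (p≤q⇒0≤q-p (alternating-upper n))
    (identity (# (alternating {n})) (size n))
    where
    identity : ∀ a s → 2ℚ * (0ℚ + (1ℚ + a)) + (s - 2ℚ * a) ≡ 1ℚ + (1ℚ + s)
    identity = solve-∀ ℚ-ring

  alternating-lower : ∀ n → size n ≤ 2ℚ * # (alternating {n}) + 1ℚ
  alternating-lower zero = <⇒≤ (positive⁻¹ 1ℚ)
  alternating-lower (suc zero) = ≤-refl
  alternating-lower (suc (suc n)) = ≤-by-difference _ (p≤q⇒0≤q-p (alternating-lower n))
    (identity (# (alternating {n})) (size n))
    where
    identity : ∀ a s → (1ℚ + (1ℚ + s)) + ((2ℚ * a + 1ℚ) - s) ≡ 2ℚ * (0ℚ + (1ℚ + a)) + 1ℚ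
    identity = solve-∀ ℚ-ring

  -- With a = ⌊n/2⌋ ≥ 1 the complement has at most a + 1 ≤ 2a vertices.
  isoperimetric-constant≤2 : ∀ {n} (h : ℚ) → 2 ℕ.≤ n →
    (h * # (alternating {n}) ≤ # (not ∘ alternating {n})) → h ≤ 2ℚ
  isoperimetric-constant≤2 {suc (suc n)} h (ℕ.s≤s (ℕ.s≤s _)) le = *-cancelˡ 0<a (≤-by-difference _
      (+-nonneg (p≤q⇒0≤q-p le) (+-nonneg (p≤q⇒0≤q-p complement)
        (+-nonneg (p≤q⇒0≤q-p (alternating-lower (suc (suc n)))) (p≤q⇒0≤q-p 1≤a))))
      (identity h a (# (not ∘ alternating {suc (suc n)})) (size (suc (suc n)))))
    where
    a = # (alternating {suc (suc n)})

    1≤a : 1ℚ ≤ a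
    1≤a =
      ≤-trans (≤-+ʳ (∑-nonneg {n} λ x → ind-nonneg (alternating x))) (≤-reflexive (sym (+-identityˡ _)))

    0<a : 0ℚ < a
    0<a = <-≤-trans (positive⁻¹ 1ℚ) 1≤a

    complement : # (not ∘ alternating {suc (suc n)}) + a ≤ size (suc (suc n))
    complement = subst (_≤ size (suc (suc n)))
      (∑-distrib-+ (ind ∘ not ∘ alternating {suc (suc n)}) (ind ∘ alternating {suc (suc n)}))
      (∑-mono {suc (suc n)} {λ x → ind (not (alternating x)) + ind
        (alternating x)} {const 1ℚ} λ x → one (alternating x))
      where
      one : ∀ b → ind (not b) + ind b ≤ 1ℚ
      one true = ≤-refl
      one false = ≤-refl

    identity : ∀ h a c s →
      a * h + ((c - h * a) + ((s - (c + a)) + (((2ℚ * a + 1ℚ) - s) + (a - 1ℚ)))) ≡ a * 2ℚ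
    identity = solve-∀ ℚ-ring

  ⌊⌋-cong : ∀ {P Q : Set} {P? : Dec P} {Q? : Dec Q} → (P → Q) → (Q → P) → ⌊ P? ⌋ ≡ ⌊ Q? ⌋
  ⌊⌋-cong {P? = yes p} P⇒Q Q⇒P = sym (⌊⌋-true (P⇒Q p))
  ⌊⌋-cong {P? = no ¬p} P⇒Q Q⇒P = sym (⌊⌋-false (¬p ∘ Q⇒P))

  δ : ∀ {n} → Fin n → Fin n → ℚ
  δ i j = ind ⌊ i Fin.≟ j ⌋

  ∑-δ : ∀ {n} (i : Fin n) (g : Fin n → ℚ) → ∑ (λ j → δ i j * g j) ≡ g i
  ∑-δ {suc n} zero g = trans (cong₂ _+_ (*-identityˡ (g zero))
      (trans (∑-cong λ j → *-zeroˡ (g (suc j))) (sum-replicate-zero n))) (+-identityʳ (g zero))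
  ∑-δ {suc n} (suc i) g = trans (cong₂ _+_ (*-zeroˡ (g zero))
      (trans (∑-cong λ j → cong (λ b → ind b * g (suc j))
        (⌊⌋-cong {P? = suc i Fin.≟ suc j} {i Fin.≟ j} Fin.suc-injective (cong suc)))
        (∑-δ i (g ∘ suc)))) (+-identityˡ (g (suc i)))

  module RegularGraph {n} (adj : Fin n → Fin n → Bool) (adj-sym : ∀ x y → adj x y ≡ adj y x)
    (d : ℚ) (regular : ∀ y → ∑ (λ x → ind (adj x y)) ≡ d) (d⁻¹ : ℚ) (d⁻¹*d : d⁻¹ * d ≡ 1ℚ) where

    open Expansion adj using (edge; dirichlet)

    edge-sym : ∀ x y → edge x y ≡ edge y x
    edge-sym x y = cong ind (adj-sym x y)

    characteristic : ℚ → Fin n → Fin n → ℚ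
    characteristic x i j = x * δ i j - d⁻¹ * edge i j

    walk : (Fin n → ℚ) → ℚ
    walk f = ∑₂ λ i j → edge i j * (f i * f j)

    columns : ∀ f → ∑₂ (λ i j → edge i j * f j) ≡ d * ∑ f
    columns f = trans (∑-comm λ i j → edge i j * f j)
      (trans (∑-cong λ j → trans (sym (*-distribʳ-sum (f j) (λ i → edge i j))) (cong (_* f j) (regular j)))
        (sym (*-distribˡ-sum d f)))

    rows : ∀ f → ∑₂ (λ i j → edge i j * f i) ≡ d * ∑ f
    rows f = trans (∑₂-cong λ i j → cong (_* f i) (edge-sym i j))
      (trans (∑-comm λ i j → edge j i * f i) (columns f))

    -- The values s = -1 and s = 1 give the Dirichlet and the signless energy.
    energy : ∀ s f → ∑₂ (λ i j → edge i j * (f i + s * f j) ²) ≡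
             (1ℚ + s * s) * d * norm² f + 2ℚ * s * walk f
    energy s f = trans (∑₂-cong λ i j → expand (edge i j) s (f i) (f j))
      (trans (∑₂-linear 1ℚ (2ℚ * s) (λ i j → 1ℚ * (edge i j * f i ²) + (s * s) * (edge i j * f j ²))
        (λ i j → edge i j * (f i * f j)))
        (trans (cong (λ u → 1ℚ * u + 2ℚ * s * walk f)
            (trans (∑₂-linear 1ℚ (s * s) (λ i j → edge i j * f i ²) (λ i j → edge i j * f j ²))
              (cong₂ (λ u v → 1ℚ * u + (s * s) * v) (rows (λ i → f i ²)) (columns (λ i → f i ²)))))
          (collect s d (norm² f) (walk f))))
      where
      expand : ∀ e s p q → e * ((p + s * q) * (p + s * q)) ≡
        1ℚ * (1ℚ * (e * (p * p)) + (s * s) * (e * (q * q))) + (2ℚ * s) * (e * (p * q))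
      expand = solve-∀ ℚ-ring
      collect : ∀ s d q w →
        1ℚ * (1ℚ * (d * q) + (s * s) * (d * q)) + 2ℚ * s * w ≡ (1ℚ + s * s) * d * q + 2ℚ * s * w
      collect = solve-∀ ℚ-ring

    dirichlet≡ : ∀ f → dirichlet f ≡ 2ℚ * d * norm² f - 2ℚ * walk f
    dirichlet≡ f = trans (∑₂-cong λ i j → minus (edge i j) (f i) (f j))
      (trans (energy (- 1ℚ) f) (simplify d (norm² f) (walk f)))
      where
      minus : ∀ e p q → e * ((p - q) * (p - q)) ≡ e * ((p + (- 1ℚ) * q) * (p + (- 1ℚ) * q))
      minus = solve-∀ ℚ-ring
      simplify : ∀ d q w → (1ℚ + (- 1ℚ) * (- 1ℚ)) * d * q + 2ℚ * (- 1ℚ) * w ≡ 2ℚ * d * q - 2ℚ * w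
      simplify = solve-∀ ℚ-ring

    signless≡ : ∀ f → ∑₂ (λ i j → edge i j * (f i + f j) ²) ≡ 2ℚ * d * norm² f + 2ℚ * walk f
    signless≡ f = trans (∑₂-cong λ i j → plus (edge i j) (f i) (f j))
      (trans (energy 1ℚ f) (simplify d (norm² f) (walk f)))
      where
      plus : ∀ e p q → e * ((p + q) * (p + q)) ≡ e * ((p + 1ℚ * q) * (p + 1ℚ * q))
      plus = solve-∀ ℚ-ring
      simplify : ∀ d q w → (1ℚ + 1ℚ * 1ℚ) * d * q + 2ℚ * 1ℚ * w ≡ 2ℚ * d * q + 2ℚ * w
      simplify = solve-∀ ℚ-ring

    form-characteristic : ∀ x f → form (characteristic x) f ≡ x * norm² f - d⁻¹ * walk f
    form-characteristic x f = trans (∑₂-cong λ i j → expand (f i) (f j) x (δ i j) d⁻¹ (edge i j))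
      (trans (∑₂-linear x (- d⁻¹) (λ i j → δ i j * (f i * f j)) (λ i j → edge i j * (f i * f j)))
        (trans (cong (λ u → x * u + - d⁻¹ * walk f) (∑-cong λ i → ∑-δ i (λ j → f i * f j)))
          (collect x (norm² f) d⁻¹ (walk f))))
      where
      expand : ∀ p q x e i a → p * (x * e - i * a) * q ≡ x * (e * (p * q)) + - i * (a * (p * q))
      expand = solve-∀ ℚ-ring
      collect : ∀ x q i w → x * q + - i * w ≡ x * q - i * w
      collect = solve-∀ ℚ-ring

    characteristic-columns : ∀ x j → ∑ (λ i → characteristic x i j) ≡ x - 1ℚ
    characteristic-columns x j = trans (∑-cong λ i → expand x (δ i j) d⁻¹ (edge i j))
      (trans (∑-linear x (- d⁻¹) (λ i → δ i j) (λ i → edge i j))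
        (trans (cong₂ (λ u v → x * u + - d⁻¹ * v) δ-column (regular j))
          (trans (collect x d⁻¹ d) (cong (λ u → x - u) d⁻¹*d))))
      where
      expand : ∀ x e i a → x * e - i * a ≡ x * e + - i * a
      expand = solve-∀ ℚ-ring
      collect : ∀ x i d → x * 1ℚ + - i * d ≡ x - i * d
      collect = solve-∀ ℚ-ring
      δ-column : ∑ (λ i → δ i j) ≡ 1ℚ
      δ-column =
        trans (∑-cong λ i → trans (cong ind (⌊⌋-cong {P? = i Fin.≟ j} {j Fin.≟ i} sym sym))
            (sym (*-identityʳ (δ j i)))) (∑-δ j (const 1ℚ))

    module _ (0≤d⁻¹ : 0ℚ ≤ d⁻¹) where

      -- The signless bound says that A/d is at least -1 + λ₀/2d as a quadratic form, so for these x
      -- the form of x - A/d is at most -η.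
      lower-det-bound : ∀ λ₀ → (∀ f → λ₀ * norm² f ≤ ∑₂ (λ i j → edge i j * (f i + f j) ²)) →
        ∀ x η → 0ℚ < η → x + η ≤ - 1ℚ + ½ * d⁻¹ * λ₀ → η ^ n ≤ ℚ.∣ det (characteristic x) ∣
      lower-det-bound λ₀ signless-bound x η 0<η x+η≤ = coercive⇒det-bound 0<η (characteristic x) λ f →
        ≤-trans (below f) (-p≤∣p∣ (form (characteristic x) f))
        where
        -p≤∣p∣ : ∀ p → - p ≤ ℚ.∣ p ∣
        -p≤∣p∣ p = subst (- p ≤_) (∣-p∣≡∣p∣ p) (p≤∣p∣ (- p))

        0≤½ : 0ℚ ≤ ½
        0≤½ = <⇒≤ (positive⁻¹ ½)

        0≤norm² : ∀ (f : Fin n → ℚ) → 0ℚ ≤ norm² f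
        0≤norm² f = ∑-nonneg λ i → ²-nonneg (f i)

        below : ∀ f → η * norm² f ≤ - form (characteristic x) f
        below f = ≤-by-difference _
          (+-nonneg (*-nonneg (p≤q⇒0≤q-p x+η≤) (0≤norm² f))
            (*-nonneg (*-nonneg 0≤½ 0≤d⁻¹)
              (p≤q⇒0≤q-p (subst (λ₀ * norm² f ≤_) (signless≡ f) (signless-bound f)))))
          (trans (identity x η d d⁻¹ λ₀ (norm² f) (walk f))
            (trans (cong (λ u → (u - 1ℚ) * norm² f - (x * norm² f - d⁻¹ * walk f)) d⁻¹*d)
              (trans (cancel (norm² f) (x * norm² f - d⁻¹ * walk f))
                (cong -_ (sym (form-characteristic x f))))))
          where
          identity : ∀ x e d i l q w → e * q + (((- 1ℚ + ½ * i * l) - (x + e)) * q +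
            (½ * i) * ((2ℚ * d * q + 2ℚ * w) - l * q)) ≡ (i * d - 1ℚ) * q - (x * q - i * w)
          identity = solve-∀ ℚ-ring
          cancel : ∀ q f → (1ℚ - 1ℚ) * q - f ≡ - f
          cancel = solve-∀ ℚ-ring

      module _ (ν : ℚ) (ν*n : ν * size n ≡ 1ℚ) (0≤ν : 0ℚ ≤ ν) (κ : ℚ) (0≤κ : 0ℚ ≤ κ)
        (poincaré : ∀ f → ∃[ m ] κ * ∑ (λ x → (f x - m) ²) ≤ dirichlet f) where

        gap : ℚ
        gap = ½ * d⁻¹ * κ

        -- The all-ones matrix times ν = 1/n projects onto the constants. Adding `gap` times it to x
        -- - A/d replaces the eigenvalue 1 of A/d by 1 - gap, the bound sought for the others.
        shifted : ℚ → Fin n → Fin n → ℚ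
        shifted x i j = characteristic x i j + gap * ν

        0≤½d⁻¹ : 0ℚ ≤ ½ * d⁻¹
        0≤½d⁻¹ = *-nonneg (<⇒≤ (positive⁻¹ ½)) 0≤d⁻¹

        form-shifted : ∀ x f → form (shifted x) f ≡ (x * norm² f - d⁻¹ * walk f) + gap * ν * (∑ f * ∑ f)
        form-shifted x f = trans (∑₂-cong λ i j → expand (f i) (f j) (characteristic x i j) (gap * ν))
          (trans (∑₂-linear 1ℚ (gap * ν) (λ i j → f i * characteristic x i j * f j) (λ i j → f i * f j))
            (cong₂ _+_ (trans (*-identityˡ (form (characteristic x) f)) (form-characteristic x f))
              (cong (gap * ν *_) (∑-* f f))))
          where
          expand : ∀ p q c s → p * (c + s) * q ≡ 1ℚ * (p * c * q) + s * (p * q)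
          expand = solve-∀ ℚ-ring

        spread : ∀ (f : Fin n → ℚ) m → ∑ (λ x → (f x - m) ²) ≡ norm² f - 2ℚ * m * ∑ f + m * m * size n
        spread f m = trans (∑-cong λ x → expand (f x) m)
          (trans (∑-linear₃ 1ℚ (- (2ℚ * m)) (m * m) (λ x → f x ²) f (const 1ℚ))
            (collect (norm² f) m (∑ f) (size n)))
          where
          expand : ∀ p m → (p - m) * (p - m) ≡ 1ℚ * (p * p) + - (2ℚ * m) * p + m * m * 1ℚ
          expand = solve-∀ ℚ-ring
          collect : ∀ q m t s → 1ℚ * q + - (2ℚ * m) * t + m * m * s ≡ q - 2ℚ * m * t + m * m * s
          collect = solve-∀ ℚ-ring

        -- The centre m need not be the mean: ∑ (f - m)² exceeds the variance term ∑ f² - ν (∑ f)²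
        -- by ν (∑ f - m n)², the square in the certificate.
        shifted-coercive : ∀ x f → (x - (1ℚ - gap)) * norm² f ≤ form (shifted x) f
        shifted-coercive x f = at (poincaré f)
          where
          T = ∑ f
          at : ∃[ m ] κ * ∑ (λ x → (f x - m) ²) ≤ dirichlet f →
            (x - (1ℚ - gap)) * norm² f ≤ form (shifted x) f
          at (m , le) = ≤-by-difference _
            (+-nonneg
              (*-nonneg 0≤½d⁻¹ (p≤q⇒0≤q-p (subst₂ (λ u v → κ * u ≤ v) (spread f m) (dirichlet≡ f) le)))
              (*-nonneg (*-nonneg (*-nonneg 0≤½d⁻¹ 0≤κ) 0≤ν) (²-nonneg (T - m * size n))))
            (trans (identity x d d⁻¹ κ ν (norm² f) (walk f) T m (size n))
              (trans (cong₂ (λ u v →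
                ((u - 1ℚ) * norm² f + (½ * d⁻¹ * κ) * ((v - 1ℚ) * (m * m * size n - 2ℚ * m * T))) +
                  ((x * norm² f - d⁻¹ * walk f) + gap * ν * (T * T))) d⁻¹*d ν*n)
                (trans (cancel (norm² f) (½ * d⁻¹ * κ) (m * m * size n - 2ℚ * m * T)
                  ((x * norm² f - d⁻¹ * walk f) + gap * ν * (T * T)))
                  (sym (form-shifted x f)))))
            where
            identity : ∀ x d i k v q w t m s →
              (x - (1ℚ - ½ * i * k)) * q +
                ((½ * i) * ((2ℚ * d * q - 2ℚ * w) - k * (q - 2ℚ * m * t + m * m * s)) +
                 (½ * i * k * v) * ((t - m * s) * (t - m * s))) ≡
              ((i * d - 1ℚ) * q + (½ * i * k) * ((v * s - 1ℚ) * (m * m * s - 2ℚ * m * t))) +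
                ((x * q - i * w) + ½ * i * k * v * (t * t))
            identity = solve-∀ ℚ-ring
            cancel : ∀ q g r z → ((1ℚ - 1ℚ) * q + g * ((1ℚ - 1ℚ) * r)) + z ≡ z
            cancel = solve-∀ ℚ-ring

        -- The column sums of x - A/d are x - 1, so `det-column-sums` relates P x to the determinant
        -- of the coercive matrix `shifted x`.
        upper-det-bound : ∀ x → 1ℚ - gap < x →
          ℚ.∣ x - 1ℚ ∣ * (x - (1ℚ - gap)) ^ n ≤ (x - (1ℚ - gap)) * ℚ.∣ det (characteristic x) ∣
        upper-det-bound x b<x = begin
          ℚ.∣ x - 1ℚ ∣ * m ^ n
            ≤⟨ *-monoˡ (0≤∣p∣ (x - 1ℚ)) (coercive⇒det-bound 0<m (shifted x)
                                                               λ f → ≤-trans (shifted-coercive x f)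
                                                                   (p≤∣p∣ (form (shifted x) f))) ⟩
          ℚ.∣ x - 1ℚ ∣ * ℚ.∣ det (shifted x) ∣
            ≡⟨ *-comm (ℚ.∣ x - 1ℚ ∣) (ℚ.∣ det (shifted x) ∣) ⟩
          ℚ.∣ det (shifted x) ∣ * ℚ.∣ x - 1ℚ ∣            ≡⟨ ∣p*q∣≡∣p∣*∣q∣ (det (shifted x)) (x - 1ℚ) ⟨
          ℚ.∣ det (shifted x) * (x - 1ℚ) ∣
            ≡⟨ cong ℚ.∣_∣ (trans (det-column-sums (characteristic x) (x - 1ℚ) (gap * ν)
                (characteristic-columns x))
                                                               (cong (_* det (characteristic x)) shift≡)) ⟩
          ℚ.∣ m * det (characteristic x) ∣                ≡⟨ ∣p*q∣≡∣p∣*∣q∣ m (det (characteristic x)) ⟩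
          ℚ.∣ m ∣ * ℚ.∣ det (characteristic x) ∣
            ≡⟨ cong (_* ℚ.∣ det (characteristic x) ∣) (0≤p⇒∣p∣≡p (<⇒≤ 0<m)) ⟩
          m * ℚ.∣ det (characteristic x) ∣                ∎
          where
          open ≤-Reasoning

          m = x - (1ℚ - gap)

          0<m : 0ℚ < m
          0<m = p<q⇒0<q-p b<x

          shift≡ : (x - 1ℚ) + size n * (gap * ν) ≡ x - (1ℚ - gap)
          shift≡ =
            trans (identity x (size n) gap ν) (trans (cong (λ u → (x - 1ℚ) + gap * u) ν*n) (simplify x gap))
            where
            identity : ∀ x s g v → (x - 1ℚ) + s * (g * v) ≡ (x - 1ℚ) + g * (v * s)
            identity = solve-∀ ℚ-ring
            simplify : ∀ x g → (x - 1ℚ) + g * 1ℚ ≡ x - (1ℚ - g)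
            simplify = solve-∀ ℚ-ring

-- Roots of the characteristic polynomial along Cauchy sequences

module Reals where

  open import Data.Rational.Base hiding (ℚ; floor; _≃_)
  open import Data.Rational.Properties
  open RationalSums
  open Determinants
  open R using (ℝ; seq; cauchy; Eventually; _≃_; _≤ᴿ_; _-ᴿ_; Matrix)

  seq-∑ : ∀ {n} (v : Fin n → ℝ) k → seq (R.∑ v) k ≡ ∑ (λ j → seq (v j) k)
  seq-∑ {zero}  v k = refl
  seq-∑ {suc n} v k = cong (λ s → seq (v zero) k + s) (seq-∑ (v ∘ suc) k)

  seq-alternate : ∀ m x k → seq (R.alternate m x) k ≡ sign m * seq x k
  seq-alternate zero    x k = sym (*-identityˡ (seq x k))
  seq-alternate (suc m) x k = trans (cong -_ (seq-alternate m x k)) (neg-distribˡ-* (sign m) (seq x k))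

  seq-det : ∀ {n} (M : Matrix n) k → seq (R.det M) k ≡ det (λ i j → seq (M i j) k)
  seq-det {zero}  M k = refl
  seq-det {suc n} M k =
    trans (seq-∑ (λ j → R.alternate (toℕ j) (M zero j R.*ᴿ R.det (λ i l → M (suc i) (punchIn j l)))) k)
    (∑-cong λ j → trans (seq-alternate (toℕ j) (M zero j R.*ᴿ R.det (λ i l → M (suc i) (punchIn j l))) k)
      (cong (λ d → sign (toℕ j) * (seq (M zero j) k * d)) (seq-det (λ i l → M (suc i) (punchIn j l)) k)))

  infixr 3 _∧ᴱ_
  _∧ᴱ_ : {P Q : ℕ → Set} → Eventually P → Eventually Q → Eventually (λ k → P k × Q k)
  (a , p) ∧ᴱ (b , q) =
    a ℕ.⊔ b , λ k le → p k (ℕ.≤-trans (ℕ.m≤m⊔n a b) le) , q k (ℕ.≤-trans (ℕ.m≤n⊔m a b) le)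

  mapᴱ : {P Q : ℕ → Set} → (∀ k → P k → Q k) → Eventually P → Eventually Q
  mapᴱ f (a , p) = a , λ k le → f k (p k le)

  allᴱ : ∀ {n} {P : Fin n → ℕ → Set} → (∀ i → Eventually (P i)) → Eventually (λ k → ∀ i → P i k)
  allᴱ {zero}  p = 0 , λ k _ ()
  allᴱ {suc n} p = mapᴱ (λ k (p₀ , ps) → λ { zero → p₀ ; (suc i) → ps i }) (p zero ∧ᴱ allᴱ (p ∘ suc))

  ∣∣-triangle : ∀ p q → ∣ p ∣ ≤ ∣ p - q ∣ + ∣ q ∣
  ∣∣-triangle p q = subst (λ u → ∣ u ∣ ≤ ∣ p - q ∣ + ∣ q ∣) (cancel p q) (∣p+q∣≤∣p∣+∣q∣ (p - q) q)
    where
    cancel : ∀ p q → (p - q) + q ≡ p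
    cancel = solve-∀ ℚ-ring

  bound : ℝ → ℚ
  bound x = 1ℚ + ∣ seq x (proj₁ (cauchy x 1ℚ (positive⁻¹ 1ℚ))) ∣

  bound-nonneg : ∀ x → 0ℚ ≤ bound x
  bound-nonneg x = +-nonneg (<⇒≤ (positive⁻¹ 1ℚ)) (0≤∣p∣ (seq x (proj₁ (cauchy x 1ℚ (positive⁻¹ 1ℚ)))))

  bounded : ∀ x → Eventually λ k → ∣ seq x k ∣ ≤ bound x
  bounded x = proj₁ close , λ k le → ≤-trans (∣∣-triangle (seq x k) (seq x (proj₁ close)))
      (+-monoˡ-≤ (∣ seq x (proj₁ close) ∣) (<⇒≤ (proj₂ close k (proj₁ close) le ℕ.≤-refl)))
    where
    close = cauchy x 1ℚ (positive⁻¹ 1ℚ)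

  ^-mono : ∀ {p q} n → 0ℚ ≤ p → p ≤ q → p ^ n ≤ q ^ n
  ^-mono zero    0≤p p≤q = ≤-refl
  ^-mono {p} {q} (suc n) 0≤p p≤q = *-mono (^-nonneg n 0≤p) (≤-trans 0≤p p≤q) p≤q (^-mono n 0≤p p≤q)
    where
    ^-nonneg : ∀ {p} n → 0ℚ ≤ p → 0ℚ ≤ p ^ n
    ^-nonneg zero    0≤p = <⇒≤ (positive⁻¹ 1ℚ)
    ^-nonneg (suc n) 0≤p = *-nonneg 0≤p (^-nonneg n 0≤p)

  seq-∏-zero : ∀ {n} (v : Fin n → ℝ) i k → seq (v i) k ≡ 0ℚ → seq (R.∏ v) k ≡ 0ℚ
  seq-∏-zero v zero    k eq =
    trans (cong (_* seq (R.∏ (v ∘ suc)) k) eq) (*-zeroˡ (seq (R.∏ (v ∘ suc)) k))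
  seq-∏-zero v (suc i) k eq =
    trans (cong (λ u → seq (v zero) k * u) (seq-∏-zero (v ∘ suc) i k eq)) (*-zeroʳ (seq (v zero) k))

  module _ {B : ℚ} (1≤B : 1ℚ ≤ B) where

    ∣∣-step : ∀ {p q P Q} → ∣ p ∣ ≤ P → ∣ q ∣ ≤ Q → ∣ p * q ∣ ≤ P * Q
    ∣∣-step {p} {q} p≤ q≤ = subst (_≤ _) (sym (∣p*q∣≡∣p∣*∣q∣ p q))
      (*-mono (0≤∣p∣ q) (≤-trans (0≤∣p∣ p) p≤) p≤ q≤)

    ∏-bound : ∀ {n} (v : Fin n → ℝ) k → (∀ j → ∣ seq (v j) k ∣ ≤ B) → ∣ seq (R.∏ v) k ∣ ≤ B ^ n
    ∏-bound {zero}  v k b = ≤-refl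
    ∏-bound {suc n} v k b = ∣∣-step (b zero) (∏-bound (v ∘ suc) k (b ∘ suc))

    -- The full power of B is kept although one factor is replaced by w; as B ≥ 1 the surplus is
    -- harmless.
    ∏-bound₁ : ∀ {n} (v : Fin n → ℝ) k → (∀ j → ∣ seq (v j) k ∣ ≤ B) → ∀ {w} i → ∣ seq (v i) k ∣ ≤ w →
               ∣ seq (R.∏ v) k ∣ ≤ w * B ^ n
    ∏-bound₁ {suc n} v k b {w} zero vi≤ = ≤-trans (∣∣-step vi≤ (∏-bound (v ∘ suc) k (b ∘ suc)))
      (*-monoˡ (≤-trans (0≤∣p∣ _) vi≤) (grow (^-pos n (<-≤-trans (positive⁻¹ 1ℚ) 1≤B))))
      where
      grow : ∀ {p} → 0ℚ < p → p ≤ B * p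
      grow {p} 0<p = subst (_≤ B * p) (*-identityˡ p) (*-monoʳ (<⇒≤ 0<p) 1≤B)
    ∏-bound₁ {suc n} v k b {w} (suc i) vi≤ =
      ≤-trans (∣∣-step (b zero) (∏-bound₁ (v ∘ suc) k (b ∘ suc) i vi≤))
      (≤-reflexive (swap B w (B ^ n)))
      where
      swap : ∀ b w p → b * (w * p) ≡ w * (b * p)
      swap = solve-∀ ℚ-ring

    ∏-bound₂ : ∀ {n} (v : Fin n → ℝ) k → (∀ j → ∣ seq (v j) k ∣ ≤ B) → ∀ {w} i j → i ≢ j →
               ∣ seq (v i) k ∣ ≤ w → ∣ seq (v j) k ∣ ≤ w → ∣ seq (R.∏ v) k ∣ ≤ w * w * B ^ n
    ∏-bound₂ v k b zero zero i≢j _ _ = contradiction refl i≢j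
    ∏-bound₂ {suc n} v k b {w} zero (suc j) _ vi≤ vj≤ =
      first-and w v k b vi≤ (∏-bound₁ (v ∘ suc) k (b ∘ suc) j vj≤)
      where
      first-and : ∀ {n} w (v : Fin (suc n) → ℝ) k → (∀ j → ∣ seq (v j) k ∣ ≤ B) →
        ∣ seq (v zero) k ∣ ≤ w →
        ∣ seq (R.∏ (v ∘ suc)) k ∣ ≤ w * B ^ n → ∣ seq (R.∏ v) k ∣ ≤ w * w * B ^ suc n
      first-and {n} w v k b v0≤ rest≤ = ≤-trans (∣∣-step v0≤ rest≤)
        (≤-trans (*-monoˡ 0≤w
          (*-monoˡ 0≤w (subst (_≤ B * B ^ n) (*-identityˡ (B ^ n))
            (*-monoʳ (<⇒≤ (^-pos n (<-≤-trans (positive⁻¹ 1ℚ) 1≤B))) 1≤B))))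
          (≤-reflexive (sym (*-assoc w w (B * B ^ n)))))
        where
        0≤w : 0ℚ ≤ w
        0≤w = ≤-trans (0≤∣p∣ (seq (v zero) k)) v0≤
    ∏-bound₂ {suc n} v k b {w} (suc i) zero _ vi≤ vj≤ =
      ≤-trans (∣∣-step vj≤ (∏-bound₁ (v ∘ suc) k (b ∘ suc) i vi≤))
        (≤-trans (*-monoˡ 0≤w
          (*-monoˡ 0≤w (subst (_≤ B * B ^ n) (*-identityˡ (B ^ n))
            (*-monoʳ (<⇒≤ (^-pos n (<-≤-trans (positive⁻¹ 1ℚ) 1≤B))) 1≤B))))
          (≤-reflexive (sym (*-assoc w w (B * B ^ n)))))
        where
        0≤w : 0ℚ ≤ w
        0≤w = ≤-trans (0≤∣p∣ (seq (v zero) k)) vj≤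
    ∏-bound₂ {suc n} v k b {w} (suc i) (suc j) i≢j vi≤ vj≤ = ≤-trans
      (∣∣-step (b zero) (∏-bound₂ (v ∘ suc) k (b ∘ suc) i j (i≢j ∘ cong suc) vi≤ vj≤))
      (≤-reflexive (swap B w (B ^ n)))
      where
      swap : ∀ b w p → b * (w * w * p) ≡ w * w * (b * p)
      swap = solve-∀ ℚ-ring

  module Roots {n} (P : ℚ → ℚ) (χ : ℝ → ℝ) (seq-χ : ∀ x k → seq (χ x) k ≡ P (seq x k))
    (t : Fin n → ℝ) (factorisation : ∀ x → χ x ≃ R.∏ (λ i → x -ᴿ t i)) where

    approximation : ∀ x η → 0ℚ < η →
      Eventually λ k → ∣ P (seq x k) - seq (R.∏ (λ i → x -ᴿ t i)) k ∣ < η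
    approximation x η 0<η = mapᴱ
      (λ k → subst (λ u → ∣ u - seq (R.∏ (λ i → x -ᴿ t i)) k ∣ < η) (seq-χ x k)) (factorisation x η 0<η)

    -- At x = t i the factor t i - t i vanishes exactly at every index of the sequence, hence so
    -- does the product.
    root : ∀ i η → 0ℚ < η → Eventually λ k → ∣ P (seq (t i) k) ∣ < η
    root i η 0<η = mapᴱ
      (λ k → subst (λ u → ∣ u ∣ < η) (trans
        (cong (λ u → P (seq (t i) k) - u) (seq-∏-zero (λ j → t i -ᴿ t j) i k (+-inverseʳ (seq (t i) k))))
        (+-identityʳ (P (seq (t i) k)))))
      (approximation (t i) η 0<η)

    -- An approximation of t i more than ε below a would have ∣P∣ ≥ εⁿ, so smallness is requested at
    -- level εⁿ.
    root-lower : ∀ a → (∀ x η → 0ℚ < η → x + η ≤ a → η ^ n ≤ ∣ P x ∣) →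
                 ∀ i ε → 0ℚ < ε → Eventually λ k → a ≤ seq (t i) k + ε
    root-lower a P-large i ε 0<ε = mapᴱ
      (λ k P-small → ≮⇒≥ λ below → <-irrefl refl
        (<-≤-trans P-small (P-large (seq (t i) k) ε 0<ε (<⇒≤ below))))
      (root i (ε ^ n) (^-pos n 0<ε))

  -- Two eigenvalues near the top of the spectrum would both be close to 1,
  -- so P would vanish to second order at 1, while it is bounded below by a
  -- multiple of |x - 1| there.
  module DoubleRoot {n} (P : ℚ → ℚ) (χ : ℝ → ℝ) (seq-χ : ∀ x k → seq (χ x) k ≡ P (seq x k))
    (t : Fin (suc n) → ℝ) (factorisation : ∀ x → χ x ≃ R.∏ (λ i → x -ᴿ t i))
    (b : ℚ) (P-large : ∀ x → b < x → ∣ x - 1ℚ ∣ * (x - b) ^ suc n ≤ (x - b) * ∣ P x ∣)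
    (i j : Fin (suc n)) (i≢j : i ≢ j) (ti≤tj : t i ≤ᴿ t j) (ε : ℚ) (0<ε : 0ℚ < ε) where

    open Roots P χ seq-χ t factorisation

    η W B K θ z : ℚ

    0<η : 0ℚ < ½ * ε
    0<η = *-pos (positive⁻¹ ½) 0<ε

    -- One half of ε pays for the error in t i ≤ t j, the other keeps both approximations at least η
    -- above b. There W is the slope of the linear lower bound on ∣P∣.
    η = ½ * ε
    W = η ^ n
    B = ∑ (bound ∘ t) + 3ℚ
    K = 4ℚ * B ^ suc n + 1ℚ

    0<W : 0ℚ < W
    0<W = ^-pos n 0<η

    0≤∑ : 0ℚ ≤ ∑ (bound ∘ t)
    0≤∑ = ∑-nonneg (bound-nonneg ∘ t)

    1≤B : 1ℚ ≤ B
    1≤B =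
      ≤-by-difference (∑ (bound ∘ t) + 2ℚ) (+-nonneg 0≤∑ (<⇒≤ (positive⁻¹ 2ℚ))) (identity (∑ (bound ∘ t)))
      where
      identity : ∀ s → 1ℚ + (s + 2ℚ) ≡ s + 3ℚ
      identity = solve-∀ ℚ-ring

    1≤K : 1ℚ ≤ K
    1≤K = ≤-+ˡ (*-nonneg (<⇒≤ (positive⁻¹ 4ℚ)) (<⇒≤ (^-pos (suc n) (<-≤-trans (positive⁻¹ 1ℚ) 1≤B))))

    0<K : 0ℚ < K
    0<K = <-≤-trans (positive⁻¹ 1ℚ) 1≤K

    K≢0 : NonZero K
    K≢0 = pos⇒nonZero K {{positive 0<K}}

    1/K : ℚ
    1/K = (1/ K) {{K≢0}}

    0<1/K : 0ℚ < 1/K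
    0<1/K = positive⁻¹ 1/K {{1/pos⇒pos K {{positive 0<K}}}}

    1/K≤1 : 1/K ≤ 1ℚ
    1/K≤1 = *-cancelˡ 0<K (subst₂ _≤_ (sym (*-inverseʳ K {{K≢0}})) (sym (*-identityʳ K)) 1≤K)

    0<1⊓W : 0ℚ < 1ℚ ⊓ W
    0<1⊓W with ⊓-sel 1ℚ W
    ... | inj₁ eq = subst (0ℚ <_) (sym eq) (positive⁻¹ 1ℚ)
    ... | inj₂ eq = subst (0ℚ <_) (sym eq) 0<W

    -- The test point z has ∣P z∣ ≥ θ W. Two factors of the product at z are at most 2θ, so with the
    -- approximation error θ² the value is below θ² K ≤ θ W. The minimum with 1 keeps z ≤ 2, within
    -- the reach of B.
    θ = (1ℚ ⊓ W) * 1/K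
    z = 1ℚ + θ

    0<θ : 0ℚ < θ
    0<θ = *-pos 0<1⊓W 0<1/K

    θ≤1 : θ ≤ 1ℚ
    θ≤1 = *-mono (<⇒≤ 0<1/K) (<⇒≤ (positive⁻¹ 1ℚ)) (p⊓q≤p 1ℚ W) 1/K≤1

    θK≤W : θ * K ≤ W
    θK≤W = subst (_≤ W) (sym (trans (*-assoc (1ℚ ⊓ W) 1/K K)
      (trans (cong ((1ℚ ⊓ W) *_) (*-inverseˡ K {{K≢0}})) (*-identityʳ (1ℚ ⊓ W))))) (p⊓q≤q 1ℚ W)

    -- One power of x - b cancels against the right side of `P-large`, and the remaining n powers
    -- are at least ηⁿ.
    P-linear : ∀ x → b + η ≤ x → ∣ x - 1ℚ ∣ * W ≤ ∣ P x ∣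
    P-linear x b+η≤x = ≤-trans (*-monoˡ (0≤∣p∣ (x - 1ℚ)) (^-mono n (<⇒≤ 0<η) η≤m))
      (*-cancelˡ 0<m (≤-trans (≤-reflexive (swap (x - b) (∣ x - 1ℚ ∣) ((x - b) ^ n))) (P-large x b<x)))
      where
      swap : ∀ m u p → m * (u * p) ≡ u * (m * p)
      swap = solve-∀ ℚ-ring
      η≤m : η ≤ x - b
      η≤m = ≤-by-difference _ (p≤q⇒0≤q-p b+η≤x) (identity η b x)
        where
        identity : ∀ e b x → e + (x - (b + e)) ≡ x - b
        identity = solve-∀ ℚ-ring
      0<m : 0ℚ < x - b
      0<m = <-≤-trans 0<η η≤m
      b<x : b < x
      b<x = <-by-difference _ 0<m (identity b x)
        where
        identity : ∀ b x → b + (x - b) ≡ x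
        identity = solve-∀ ℚ-ring

    near-1 : ∀ x → b + η ≤ x → ∣ P x ∣ < θ * W → ∣ x - 1ℚ ∣ < θ
    near-1 x b+η≤x small =
      *-cancelʳ-<-nonNeg W {{nonNegative (<⇒≤ 0<W)}} (≤-<-trans (P-linear x b+η≤x) small)

    Late : ℕ → Set
    Late k = (∣ P (seq (t i) k) ∣ < θ * W) × (∣ P (seq (t j) k) ∣ < θ * W) ×
             (∣ P z - seq (R.∏ (λ l → R.fromℚ z -ᴿ t l)) k ∣ < θ * θ) ×
             (seq (t i) k ≤ seq (t j) k + η) × (∀ l → ∣ seq (t l) k ∣ ≤ bound (t l))

    late : Eventually Late
    late = root i (θ * W) (*-pos 0<θ 0<W) ∧ᴱ root j (θ * W) (*-pos 0<θ 0<W) ∧ᴱ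
      approximation (R.fromℚ z) (θ * θ) (*-pos 0<θ 0<θ) ∧ᴱ ti≤tj η 0<η ∧ᴱ allᴱ (bounded ∘ t)

    at : ∀ k → Late k → seq (t i) k ≤ b + ε
    at k (Px-small , Py-small , approx , x≤y+η , t-bounded) = ≮⇒≥ λ above → absurd above
      where
      x = seq (t i) k
      y = seq (t j) k

      v : Fin (suc n) → ℝ
      v l = R.fromℚ z -ᴿ t l

      halves : ∀ b e → b + ½ * e + ½ * e ≡ b + e
      halves = solve-∀ ℚ-ring

      triangle : ∀ {u} → ∣ u - 1ℚ ∣ < θ → ∣ z - u ∣ ≤ 2ℚ * θ
      triangle {u} u-close = ≤-trans
        (subst (λ p → ∣ p ∣ ≤ ∣ θ ∣ + ∣ - (u - 1ℚ) ∣) (identity θ u) (∣p+q∣≤∣p∣+∣q∣ θ (- (u - 1ℚ))))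
        (≤-trans (+-mono-≤ (≤-reflexive (0≤p⇒∣p∣≡p (<⇒≤ 0<θ)))
          (≤-trans (≤-reflexive (∣-p∣≡∣p∣ (u - 1ℚ))) (<⇒≤ u-close)))
          (≤-reflexive (double θ)))
        where
        identity : ∀ t u → t + - (u - 1ℚ) ≡ (1ℚ + t) - u
        identity = solve-∀ ℚ-ring
        double : ∀ t → t + t ≡ 2ℚ * t
        double = solve-∀ ℚ-ring

      v-bounded : ∀ l → ∣ z - seq (t l) k ∣ ≤ B
      v-bounded l = ≤-trans (∣p-q∣≤∣p∣+∣q∣ z (seq (t l) k))
        (≤-trans (+-mono-≤ ∣z∣≤ (≤-trans (t-bounded l) (term≤∑ (bound-nonneg ∘ t) l)))
          (≤-by-difference 1ℚ (<⇒≤ (positive⁻¹ 1ℚ)) (identity (∑ (bound ∘ t)))))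
        where
        ∣z∣≤ : ∣ z ∣ ≤ 2ℚ
        ∣z∣≤ =
          subst (_≤ 2ℚ) (sym (0≤p⇒∣p∣≡p (+-nonneg (<⇒≤ (positive⁻¹ 1ℚ)) (<⇒≤ 0<θ)))) (+-monoʳ-≤ 1ℚ θ≤1)
        identity : ∀ s → (2ℚ + s) + 1ℚ ≡ s + 3ℚ
        identity = solve-∀ ℚ-ring

      absurd : ¬ (b + ε < x)
      absurd above = <-irrefl refl (<-≤-trans too-small large)
        where
        b+η≤x : b + η ≤ x
        b+η≤x = ≤-trans (≤-+ʳ (<⇒≤ 0<η)) (≤-trans (≤-reflexive (halves b ε)) (<⇒≤ above))

        b+η≤y : b + η ≤ y
        b+η≤y =
          ≤-by-difference _ (+-nonneg (p≤q⇒0≤q-p (<⇒≤ above)) (p≤q⇒0≤q-p x≤y+η)) (identity b ε x y)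
          where
          identity : ∀ b e x y → (b + ½ * e) + ((x - (b + e)) + ((y + ½ * e) - x)) ≡ y
          identity = solve-∀ ℚ-ring

        x-close : ∣ x - 1ℚ ∣ < θ
        x-close = near-1 x b+η≤x Px-small

        y-close : ∣ y - 1ℚ ∣ < θ
        y-close = near-1 y b+η≤y Py-small

        -- Thus z also lies above b + η, where the linear lower bound holds.
        x≤z : x ≤ z
        x≤z = ≤-by-difference _ (p≤q⇒0≤q-p (≤-trans (p≤∣p∣ (x - 1ℚ)) (<⇒≤ x-close))) (identity x θ)
          where
          identity : ∀ x t → x + (t - (x - 1ℚ)) ≡ 1ℚ + t
          identity = solve-∀ ℚ-ring

        large : θ * W ≤ ∣ P z ∣
        large = subst (λ u → u * W ≤ ∣ P z ∣) (trans (cong ∣_∣ (identity θ)) (0≤p⇒∣p∣≡p (<⇒≤ 0<θ)))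
          (P-linear z (≤-trans b+η≤x x≤z))
          where
          identity : ∀ t → (1ℚ + t) - 1ℚ ≡ t
          identity = solve-∀ ℚ-ring

        too-small : ∣ P z ∣ < θ * W
        too-small = begin-strict
          ∣ P z ∣                                             ≤⟨ ∣∣-triangle (P z) (seq (R.∏ v) k) ⟩
          ∣ P z - seq (R.∏ v) k ∣ + ∣ seq (R.∏ v) k ∣
            <⟨ +-mono-<-≤ approx (∏-bound₂ 1≤B v k v-bounded i j i≢j (triangle x-close)
                (triangle y-close)) ⟩
          θ * θ + (2ℚ * θ) * (2ℚ * θ) * B ^ suc n             ≡⟨ collect θ (B ^ suc n) ⟩
          θ * (θ * K)                                         ≤⟨ *-monoˡ (<⇒≤ 0<θ) θK≤W ⟩
          θ * W                                               ∎
          where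
          open ≤-Reasoning
          collect : ∀ t p → t * t + (2ℚ * t) * (2ℚ * t) * p ≡ t * (t * (4ℚ * p + 1ℚ))
          collect = solve-∀ ℚ-ring

    root-upper : Eventually λ k → seq (t i) k ≤ b + ε
    root-upper = mapᴱ at late

  -- The second root that leads to the contradiction is the last eigenvalue; the condition on i
  -- makes the two indices distinct.
  eigenvalue-upper : ∀ {N} (P : ℚ → ℚ) (χ : ℝ → ℝ) → (∀ x k → seq (χ x) k ≡ P (seq x k)) →
    (t : Fin N → ℝ) → (∀ x → χ x ≃ R.∏ (λ i → x -ᴿ t i)) → (∀ i j → i Fin.≤ j → t i ≤ᴿ t j) →
    ∀ b → (∀ x → b < x → ∣ x - 1ℚ ∣ * (x - b) ^ N ≤ (x - b) * ∣ P x ∣) →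
    ∀ i → suc (toℕ i) ℕ.< N → ∀ ε → 0ℚ < ε → Eventually λ k → seq (t i) k ≤ b + ε
  eigenvalue-upper {suc n} P χ seq-χ t factorisation monotone b P-large i (ℕ.s≤s i<n) =
    λ ε 0<ε → DoubleRoot.root-upper P χ seq-χ t factorisation b P-large
      i (fromℕ n) i≢n (monotone i (fromℕ n) (Fin.≤fromℕ i)) ε 0<ε
    where
    i≢n : i ≢ fromℕ n
    i≢n i≡n = ℕ.<-irrefl (trans (cong toℕ i≡n) (Fin.toℕ-fromℕ n)) i<n

-- Spectra of Cayley graphs and the constants

module Spectra where

  open import Data.Fin.Subset using (∣_∣)
  open import Data.Nat.Base using (NonZero)
  open import Data.Integer.Base using (+_)
  open import Data.Rational.Base hiding (ℚ; floor; _≃_; ∣_∣; NonZero)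
  open import Data.Rational.Properties
  open RationalSums
  open VertexExpansion
  open SignedFunctions
  open Determinants
  open Graphs
  open Reals
  open R using (ℝ; seq; FiniteGroup; Symmetric; cayleyGraph; Bipartite; IsSpectrum;
    IsOuterIsoperimetricConstant; charPoly; Eventually; nonBipartite⇒nonZero)

  -- 1/16 is the inverse of the constant in `poincaré`; the ½ is that of `gap`.
  ⅟16 C₀ : ℚ
  ⅟16 = + 1 / 16
  C₀ = ½ * ⅟16

  inverse-nonneg : ∀ {i d} → 0ℚ < d → i * d ≡ 1ℚ → 0ℚ ≤ i
  inverse-nonneg {i} {d} 0<d i*d≡1 = *-cancelˡ 0<d
    (subst₂ _≤_ (sym (*-zeroʳ d)) (trans (sym i*d≡1) (*-comm i d)) (<⇒≤ (positive⁻¹ 1ℚ)))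

  seq-if : ∀ b k → seq (if b then R.1ᴿ else R.0ᴿ) k ≡ ind b
  seq-if true  k = refl
  seq-if false k = refl

  seq-normalised : ∀ {n} (G : R.Graph n) d .{{_ : NonZero d}} {i j b} k → ⌊ R.Graph._∼?_ G i j ⌋ ≡ b →
    seq (R.normalisedAdjacencyMatrix G d i j) k ≡ (+ 1 / d) * ind b
  seq-normalised G d {i} {j} k refl = cong (λ u → (+ 1 / d) * u) (seq-if ⌊ R.Graph._∼?_ G i j ⌋ k)

  ⌊∈?⌋≡lookup : ∀ {n} x (S : Subset n) → ⌊ x ∈ₛ? S ⌋ ≡ lookup S x
  ⌊∈?⌋≡lookup x S with x ∈ₛ? S
  ... | yes x∈S = sym ([]=⇒lookup x∈S)
  ... | no  x∉S = sym (≢true⇒≡false λ eq → x∉S (lookup⇒[]= x S eq))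

  #-lookup : ∀ {n} (S : Subset n) → # (lookup S) ≡ size ∣ S ∣
  #-lookup S = trans (#-tabulate (lookup S)) (cong (λ V → size ∣ V ∣) (tabulate∘lookup S))

  ≤ᴿ-lower : ∀ e h i x →
    (∀ η → 0ℚ < η → Eventually λ k → - 1ℚ + ½ * i * (e * (⅟16 * h ²)) ≤ seq x k + η) →
    R.-ᴿ R.1ᴿ R.+ᴿ R.fromℚ (e * C₀) R.*ᴿ R.fromℚ (h * h * i) R.≤ᴿ x
  ≤ᴿ-lower e h i x le η 0<η =
    mapᴱ (λ k → subst (λ u → - 1ℚ + u ≤ seq x k + η) (regroup e ½ ⅟16 i h)) (le η 0<η)
    where
    regroup : ∀ e a b c h → a * c * (e * (b * (h * h))) ≡ e * (a * b) * (h * h * c)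
    regroup = solve-∀ ℚ-ring

  ≤ᴿ-upper : ∀ h i x →
    (∀ η → 0ℚ < η → Eventually λ k → seq x k ≤ (1ℚ - ½ * i * (⅟16 * h ²)) + η) →
    x R.≤ᴿ R.1ᴿ R.-ᴿ R.fromℚ C₀ R.*ᴿ R.fromℚ (h * h * i)
  ≤ᴿ-upper h i x le η 0<η =
    mapᴱ (λ k → subst (λ u → seq x k ≤ (1ℚ - u) + η) (regroup ½ ⅟16 i h)) (le η 0<η)
    where
    regroup : ∀ a b c h → a * c * (b * (h * h)) ≡ a * b * (h * h * c)
    regroup = solve-∀ ℚ-ring

  module RegularSpectrum {n} .{{_ : NonZero n}} (adj : Fin n → Fin n → Bool)
    (adj-sym : ∀ x y → adj x y ≡ adj y x)
    (d : ℚ) (regular : ∀ y → ∑ (λ x → ind (adj x y)) ≡ d) (d⁻¹ : ℚ) (0≤d⁻¹ : 0ℚ ≤ d⁻¹)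
    (d⁻¹*d≡1 : d⁻¹ * d ≡ 1ℚ)
    (M : R.Matrix n) (seq-M : ∀ i j k → seq (M i j) k ≡ d⁻¹ * ind (adj i j))
    (t : Vector ℝ n) (spectrum : IsSpectrum M t) where

    ν : ℚ
    ν = + 1 / n

    ν*n≡1 : ν * size n ≡ 1ℚ
    ν*n≡1 = /-*-size 1 n

    open RegularGraph adj adj-sym d regular d⁻¹ d⁻¹*d≡1
      using (characteristic; lower-det-bound; upper-det-bound)
    open Expansion adj using (edge; dirichlet)

    P : ℚ → ℚ
    P x = det (characteristic x)

    seq-charPoly : ∀ x k → seq (charPoly M x) k ≡ P (seq x k)
    seq-charPoly x k = trans (seq-det (λ i j → x R.*ᴿ R.identityMatrix i j R.-ᴿ M i j) k)
      (det-cong λ i j → cong₂ (λ u v → seq x k * u - v) (seq-if ⌊ i Fin.≟ j ⌋ k) (seq-M i j k))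

    lower : ∀ λ₀ → (∀ f → λ₀ * norm² f ≤ ∑₂ (λ x y → edge x y * (f x + f y) ²)) →
      ∀ i η → 0ℚ < η → Eventually λ k → - 1ℚ + ½ * d⁻¹ * λ₀ ≤ seq (t i) k + η
    lower λ₀ bound = Roots.root-lower P (charPoly M) seq-charPoly t (proj₁ spectrum)
      (- 1ℚ + ½ * d⁻¹ * λ₀) (lower-det-bound 0≤d⁻¹ λ₀ bound)

    upper : ∀ κ → 0ℚ ≤ κ → (∀ f → ∃[ m ] κ * ∑ (λ x → (f x - m) ²) ≤ dirichlet f) →
      ∀ i → suc (toℕ i) ℕ.< n → ∀ η → 0ℚ < η → Eventually λ k → seq (t i) k ≤ (1ℚ - ½ * d⁻¹ * κ) + η
    upper κ 0≤κ poincaré =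
      eigenvalue-upper P (charPoly M) seq-charPoly t (proj₁ spectrum) (proj₂ spectrum)
      (1ℚ - ½ * d⁻¹ * κ) (upper-det-bound 0≤d⁻¹ ν ν*n≡1 (inverse-nonneg (size-pos n) ν*n≡1) κ 0≤κ poincaré)

  -- The group law is carried along the enumeration to `Fin N`, where equality is propositional and
  -- vertices coincide with group elements.
  module Transport (X : FiniteGroup) where
    open FiniteGroup X hiding (isGroup; isEquivalence)
      renaming (order to N; refl to ≈-refl; sym to ≈-sym; trans to ≈-trans)
    open Inverse enumeration using (strictlyInverseˡ; strictlyInverseʳ)

    _·_ : Fin N → Fin N → Fin N
    i · j = index (element i ∙ element j)

    e : Fin N
    e = index ε

    inv : Fin N → Fin N
    inv i = index (element i ⁻¹)

    element-index : ∀ x → element (index x) ≈ x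
    element-index = strictlyInverseʳ

    isGroup : IsGroup _≡_ _·_ e inv
    isGroup = record
      { isMonoid = record
        { isSemigroup = record
          { isMagma = record { isEquivalence = isEquivalence ; ∙-cong = cong₂ _·_ }
          ; assoc = λ i j k → index-cong (≈-trans (∙-congʳ (element-index (element i ∙ element j)))
              (≈-trans (assoc (element i) (element j) (element k))
                (∙-congˡ (≈-sym (element-index (element j ∙ element k))))))
          }
        ; identity = (λ i → trans (index-cong (≈-trans (∙-congʳ (element-index ε)) (identityˡ (element i))))
                              (strictlyInverseˡ i))
                   , (λ i → trans (index-cong (≈-trans (∙-congˡ (element-index ε)) (identityʳ (element i))))
                              (strictlyInverseˡ i))
        }
      ; inverse = (λ i → index-cong (≈-trans (∙-congʳ (element-index (element i ⁻¹))) (inverseˡ (element i))))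
                , (λ i → index-cong (≈-trans (∙-congˡ (element-index (element i ⁻¹))) (inverseʳ (element i))))
      ; ⁻¹-cong = cong inv
      }

    quotient : ∀ i j → i · inv j ≡ index (element i ∙ element j ⁻¹)
    quotient i j = index-cong (∙-congˡ (element-index (element j ⁻¹)))

  module CayleySpectrum (X : FiniteGroup) (S : Subset (FiniteGroup.order X))
    (2≤N : 2 ℕ.≤ FiniteGroup.order X) (symmetric : Symmetric X S)
    (nonBipartite : ¬ Bipartite (cayleyGraph X S symmetric))
    (h : ℚ) (isMin : IsOuterIsoperimetricConstant (cayleyGraph X S symmetric) h) where

    open FiniteGroup X using () renaming (order to N)
    open Transport X using (isGroup; quotient)

    open R.Graph (cayleyGraph X S symmetric) using (_∼_; _∼?_; ∼-sym)

    instance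
      d≢0 : NonZero ∣ S ∣
      d≢0 = nonBipartite⇒nonZero X S symmetric nonBipartite

      N≢0 : NonZero N
      N≢0 = ℕ.>-nonZero (ℕ.≤-trans (ℕ.s≤s ℕ.z≤n) 2≤N)

    open Cayley isGroup (lookup S) using (adj; ∑-translateʳ; signless; signless-bound)
    open Expansion adj using (dirichlet; poincaré)
    open Isoperimetry (cayleyGraph X S symmetric) h isMin

    adj≡ : ∀ x y → ⌊ x ∼? y ⌋ ≡ adj x y
    adj≡ x y = trans (⌊∈?⌋≡lookup _ S) (cong (lookup S) (sym (quotient x y)))

    ∼⇒adj : ∀ {x y} → x ∼ y → adj x y ≡ true
    ∼⇒adj {x} {y} x∼y = trans (sym (adj≡ x y)) (⌊⌋-true {P? = x ∼? y} x∼y)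

    adj-sym : ∀ x y → adj x y ≡ adj y x
    adj-sym x y = trans (sym (adj≡ x y)) (trans (⌊⌋-cong {P? = x ∼? y} {y ∼? x} ∼-sym ∼-sym) (adj≡ y x))

    adj-isoperimetry : ∀ p q → 2ℚ * # p ≤ size N →
      (∀ x y → adj x y ≡ true → p x ≡ true → p y ≡ false → q y ≡ true) → h * # p ≤ # q
    adj-isoperimetry p q half boundary = isoperimetry p q half λ x y x∼y → boundary x y (∼⇒adj x∼y)

    h≤2 : h ≤ 2ℚ
    h≤2 =
      isoperimetric-constant≤2 h 2≤N (isoperimetry alternating (not ∘ alternating) (alternating-upper N)
        λ x y _ _ py → cong not py)

    κ : ℚ
    κ = ⅟16 * h ²

    0≤κ : 0ℚ ≤ κ
    0≤κ = *-nonneg (<⇒≤ (positive⁻¹ ⅟16)) (²-nonneg h)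

    κ≤1 : κ ≤ 1ℚ
    κ≤1 = ≤-trans (*-monoˡ (<⇒≤ (positive⁻¹ ⅟16)) (²-mono 0≤h h≤2)) (≤ᵇ⇒≤ {⅟16 * 2ℚ ²} {1ℚ} tt)

    κ-poincaré : ∀ f → ∃[ m ] κ * ∑ (λ x → (f x - m) ²) ≤ dirichlet f
    κ-poincaré f = at (poincaré h 0≤h h≤2 adj-isoperimetry f)
      where
      at : ∃[ m ] h ² * ∑ (λ x → (f x - m) ²) ≤ 16ℚ * dirichlet f →
           ∃[ m ] κ * ∑ (λ x → (f x - m) ²) ≤ dirichlet f
      at (m , le) = m , ≤-trans (≤-reflexive (*-assoc ⅟16 (h ²) _)) (≤-trans (*-monoˡ (<⇒≤ (positive⁻¹ ⅟16)) le)
        (≤-reflexive (trans (sym (*-assoc ⅟16 16ℚ (dirichlet f))) (*-identityˡ (dirichlet f)))))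

    κ-signless : ∀ f → ε₀ * κ * norm² f ≤ signless f
    κ-signless = signless-bound κ 0≤κ κ≤1 κ-poincaré λ { (colour , proper) →
      nonBipartite (colour , λ x y x∼y → proper x y (∼⇒adj x∼y)) }

    regular : ∀ y → ∑ (λ x → ind (adj x y)) ≡ size ∣ S ∣
    regular y = trans (∑-translateʳ (Transport.inv X y) (ind ∘ lookup S)) (#-lookup S)

    d⁻¹*d≡1 : ((+ 1 / ∣ S ∣) {{nonBipartite⇒nonZero X S symmetric nonBipartite}}) * size ∣ S ∣ ≡ 1ℚ
    d⁻¹*d≡1 = /-*-size 1 ∣ S ∣

    0≤d⁻¹ : 0ℚ ≤ ((+ 1 / ∣ S ∣) {{nonBipartite⇒nonZero X S symmetric nonBipartite}})
    0≤d⁻¹ = inverse-nonneg {d = size ∣ S ∣} (size-pos ∣ S ∣) d⁻¹*d≡1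

    seq-M : ∀ i j k →
      seq (R.normalisedAdjacencyMatrix (cayleyGraph X S symmetric) ∣ S ∣
             {{nonBipartite⇒nonZero X S symmetric nonBipartite}} i j) k ≡
      ((+ 1 / ∣ S ∣) {{nonBipartite⇒nonZero X S symmetric nonBipartite}}) * ind (adj i j)
    seq-M i j k = seq-normalised (cayleyGraph X S symmetric) ∣ S ∣
      {{nonBipartite⇒nonZero X S symmetric nonBipartite}} {i} {j} {adj i j} k (adj≡ i j)

    module _ (t : Vector ℝ N)
      (spectrum : IsSpectrum (R.normalisedAdjacencyMatrix (cayleyGraph X S symmetric) ∣ S ∣
                                {{nonBipartite⇒nonZero X S symmetric nonBipartite}}) t) where

      open RegularSpectrum {{N≢0}} adj adj-sym (size ∣ S ∣) regular
        ((+ 1 / ∣ S ∣) {{nonBipartite⇒nonZero X S symmetric nonBipartite}}) 0≤d⁻¹ d⁻¹*d≡1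
        (R.normalisedAdjacencyMatrix (cayleyGraph X S symmetric) ∣ S ∣
           {{nonBipartite⇒nonZero X S symmetric nonBipartite}})
        seq-M t spectrum using (lower; upper)

      eigenvalue-bounds : ∀ i → suc (toℕ i) ℕ.< N →
        R.-ᴿ R.1ᴿ R.+ᴿ R.fromℚ (ε₀ * C₀)
          R.*ᴿ R.fromℚ (h * h * ((+ 1 / ∣ S ∣) {{nonBipartite⇒nonZero X S symmetric nonBipartite}})) R.≤ᴿ t i ×
        t i R.≤ᴿ R.1ᴿ R.-ᴿ R.fromℚ C₀
          R.*ᴿ R.fromℚ (h * h * ((+ 1 / ∣ S ∣) {{nonBipartite⇒nonZero X S symmetric nonBipartite}}))
      eigenvalue-bounds i i<N =
        ≤ᴿ-lower ε₀ h ((+ 1 / ∣ S ∣) {{nonBipartite⇒nonZero X S symmetric nonBipartite}}) (t i)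
          (lower (ε₀ * κ) κ-signless i) ,
        ≤ᴿ-upper h ((+ 1 / ∣ S ∣) {{nonBipartite⇒nonZero X S symmetric nonBipartite}}) (t i)
          (upper κ 0≤κ κ-poincaré i i<N)

  0<fromℚ : ∀ {q} → 0ℚ < q → R.0ᴿ R.<ᴿ R.fromℚ q
  0<fromℚ {q} 0<q = q , 0<q , 0 , λ _ _ → ≤-reflexive (+-identityˡ q)

  0<c₀ : 0ℚ < ε₀ * C₀
  0<c₀ = positive⁻¹ (ε₀ * C₀)

  0<C₀ : 0ℚ < C₀
  0<C₀ = positive⁻¹ C₀

open import Defs
open import Data.Fin.Subset using (∣_∣)
open import Data.Integer.Base using (+_)
open import Data.Nat.Base using (NonZero; _≤_; _<_)

theorem1p1 :
  ∃[ c ] ∃[ C ] 0ᴿ <ᴿ c × 0ᴿ <ᴿ C ×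
    ((X : FiniteGroup) (S : Subset (FiniteGroup.order X)) →
     let N = FiniteGroup.order X
         d = ∣ S ∣
     in 2 ≤ N →
        (symmetric : Symmetric X S) →
        let G = cayleyGraph X S symmetric
        in (nonBipartite : ¬ Bipartite G) →
           let instance
                 d≢0 : NonZero d
                 d≢0 = nonBipartite⇒nonZero X S symmetric nonBipartite
           in (t : Vector ℝ N) →
              IsSpectrum (normalisedAdjacencyMatrix G d) t →
              (h : ℚ) →
              IsOuterIsoperimetricConstant G h →
              (i : Fin N) →
              suc (toℕ i) < N →
              -ᴿ 1ᴿ +ᴿ c *ᴿ fromℚ (h ℚ.* h ℚ.* (+ 1 ℚ./ d)) ≤ᴿ t i
              × t i ≤ᴿ 1ᴿ -ᴿ C *ᴿ fromℚ (h ℚ.* h ℚ.* (+ 1 ℚ./ d)))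
theorem1p1 = fromℚ (SignedFunctions.ε₀ ℚ.* Spectra.C₀) , fromℚ Spectra.C₀ ,
  Spectra.0<fromℚ Spectra.0<c₀ , Spectra.0<fromℚ Spectra.0<C₀ ,
  λ X S 2≤N symmetric nonBipartite t spectrum h isMin →
    Spectra.CayleySpectrum.eigenvalue-bounds X S 2≤N symmetric nonBipartite h isMin t spectrum
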